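{- Let $k\ge2$. There exist natural numbers $q_{n,j}$ ($n\ge1$, $1\le j\le k$) with $q_{1,1}<\cdots<q_{1,k}<q_{2,1}<\cdots<q_{2,k}<q_{3,1}<\cdots$, $q_{n,j}\mid q_{n,j+1}$ for $1\le j\le k-1$, $q_{n,k}\mid q_{n+1,1}$ for all $n$, and $\lim_{n\to\infty}b_{n+1}/b_n=\infty$ where $b_{(n-1)k+j}=\log q_{n,j}$, such that the numbers $\zeta_j=\sum_{n\ge1}1/q_{n,j}$ ($1\le j\le k$) together with $1$ are linearly independent over $\mathbb{Q}$ and satisfy $\underline\psi_1=-1$ and $\underline\psi_{j+1}=\overline\psi_j$ for $1\le j\le k$; consequently $$\underline\psi_1=-1,\quad \overline\psi_1=\underline\psi_2=\frac{1-k}{2k},\quad \overline\psi_j=\underline\psi_{j+1}=\frac1k\ (2\le j\le k),\quad \overline\psi_{k+1}=\frac1k.$$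
   Context: For $Q>1$ and $1\le j\le k+1$, $\psi_j(Q)$ is the minimum of all real $\theta$ such that the system $|x|\le Q^{1+\theta}$, $|\zeta_ix-y_i|\le Q^{ -1/k+\theta}$ ($1\le i\le k$) has $j$ linearly independent solutions $(x,y_1,\dots,y_k)\in\mathbb{Z}^{k+1}$. Set $\underline\psi_j=\liminf_{Q\to\infty}\psi_j(Q)$ and $\overline\psi_j=\limsup_{Q\to\infty}\psi_j(Q)$. -}

module Defs where

open import Algebra.Bundles using (RawRing)
import Algebra.Definitions.RawMonoid as RawMonoidDefs
import Algebra.Definitions.RawSemiring as RawSemiringDefs
open import Data.Fin.Base using (Fin; toℕ)
open import Data.Integer.Base as ℤ using (ℤ; 0ℤ; 1ℤ; -1ℤ)
open import Data.Nat.Base as ℕ using (ℕ; zero; suc; _!)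
open import Data.Nat.Divisibility.Core using (_∣_)
import Data.Nat.Properties as ℕₚ
open import Data.Product.Base using (Σ; ∃; ∃-syntax; _×_; _,_; proj₁; proj₂)
open import Data.Rational.Base as ℚ using (ℚ; 0ℚ; 1ℚ; ½; Positive)
import Data.Rational.Properties as ℚₚ
import Data.Rational.Solver as ℚ-Solver
open import Data.Sum.Base using (inj₁; inj₂)
open import Data.Vec.Functional using (Vector; head; tail)
open import Level using (0ℓ)
open import Relation.Binary.PropositionalEquality
  using (_≡_; refl; sym; trans; cong; cong₂; subst)
open import Relation.Nullary.Negation.Core using (¬_)

-- Real numbers: Cauchy sequences of rationals, with equality _≈_ (the
-- difference tends to 0).

IsCauchy : (ℕ → ℚ) → Set
IsCauchy s = ∀ ε → 0ℚ ℚ.< ε → ∃[ N ] (∀ m n → N ℕ.≤ m → N ℕ.≤ n →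
             ℚ.∣ s m ℚ.- s n ∣ ℚ.< ε)

record ℝ : Set where
  constructor mkℝ
  field
    seq    : ℕ → ℚ
    cauchy : IsCauchy seq

open ℝ public

infix 4 _≈_ _<_ _≤_

_≈_ : ℝ → ℝ → Set
x ≈ y = ∀ ε → 0ℚ ℚ.< ε → ∃[ N ] (∀ n → N ℕ.≤ n → ℚ.∣ seq x n ℚ.- seq y n ∣ ℚ.< ε)

_<_ : ℝ → ℝ → Set
x < y = ∃[ δ ] (0ℚ ℚ.< δ × (∃[ N ] (∀ n → N ℕ.≤ n → seq x n ℚ.+ δ ℚ.≤ seq y n)))

_≤_ : ℝ → ℝ → Set
x ≤ y = ∀ ε → 0ℚ ℚ.< ε → ∃[ N ] (∀ n → N ℕ.≤ n → seq x n ℚ.≤ seq y n ℚ.+ ε)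

private
  ½-pos : ∀ {ε} → 0ℚ ℚ.< ε → 0ℚ ℚ.< ½ ℚ.* ε
  ½-pos {ε} 0<ε = subst (ℚ._< ½ ℚ.* ε) (ℚₚ.*-zeroʳ ½) (ℚₚ.*-monoʳ-<-pos ½ 0<ε)

  ½+½ : ∀ ε → ½ ℚ.* ε ℚ.+ ½ ℚ.* ε ≡ ε
  ½+½ ε = trans (sym (ℚₚ.*-distribʳ-+ ε ½ ½)) (ℚₚ.*-identityˡ ε)

  max-l : ∀ {M N n} → M ℕ.⊔ N ℕ.≤ n → M ℕ.≤ n
  max-l {M} {N} = ℕₚ.≤-trans (ℕₚ.m≤m⊔n M N)

  max-r : ∀ {M N n} → M ℕ.⊔ N ℕ.≤ n → N ℕ.≤ n
  max-r {M} {N} = ℕₚ.≤-trans (ℕₚ.m≤n⊔m M N)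

  [p-q]+q≡p : ∀ p q → (p ℚ.- q) ℚ.+ q ≡ p
  [p-q]+q≡p = solve 2 (λ p q → (p :- q) :+ q := p) refl
    where open ℚ-Solver.+-*-Solver

  [p+q]-q≡p : ∀ p q → (p ℚ.+ q) ℚ.- q ≡ p
  [p+q]-q≡p = solve 2 (λ p q → (p :+ q) :- q := p) refl
    where open ℚ-Solver.+-*-Solver

  neg-diff : ∀ p q → q ℚ.- p ≡ ℚ.- (p ℚ.- q)
  neg-diff = solve 2 (λ p q → q :- p := :- (p :- q)) refl
    where open ℚ-Solver.+-*-Solver

  diff-neg : ∀ p q → q ℚ.- p ≡ ℚ.- p ℚ.- ℚ.- q
  diff-neg = solve 2 (λ p q → q :- p := :- p :- :- q) refl
    where open ℚ-Solver.+-*-Solver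

  diff-+ : ∀ a b c d → (a ℚ.- b) ℚ.+ (c ℚ.- d) ≡ (a ℚ.+ c) ℚ.- (b ℚ.+ d)
  diff-+ = solve 4 (λ a b c d → (a :- b) :+ (c :- d) := (a :+ c) :- (b :+ d)) refl
    where open ℚ-Solver.+-*-Solver

  diff-* : ∀ a b c d → a ℚ.* (c ℚ.- d) ℚ.+ d ℚ.* (a ℚ.- b) ≡ a ℚ.* c ℚ.- b ℚ.* d
  diff-* = solve 4 (λ a b c d → a :* (c :- d) :+ d :* (a :- b) := a :* c :- b :* d) refl
    where open ℚ-Solver.+-*-Solver

  ∣a+c-[b+d]∣< : ∀ a b c d {ε η} → ℚ.∣ a ℚ.- b ∣ ℚ.< ε → ℚ.∣ c ℚ.- d ∣ ℚ.< η →
                 ℚ.∣ (a ℚ.+ c) ℚ.- (b ℚ.+ d) ∣ ℚ.< ε ℚ.+ η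
  ∣a+c-[b+d]∣< a b c d {ε} {η} h k = subst (λ r → ℚ.∣ r ∣ ℚ.< ε ℚ.+ η) (diff-+ a b c d)
    (ℚₚ.≤-<-trans (ℚₚ.∣p+q∣≤∣p∣+∣q∣ (a ℚ.- b) (c ℚ.- d)) (ℚₚ.+-mono-< h k))

  ∣p∣≤∣p-q∣+∣q∣ : ∀ p q → ℚ.∣ p ∣ ℚ.≤ ℚ.∣ p ℚ.- q ∣ ℚ.+ ℚ.∣ q ∣
  ∣p∣≤∣p-q∣+∣q∣ p q = subst (λ r → ℚ.∣ r ∣ ℚ.≤ ℚ.∣ p ℚ.- q ∣ ℚ.+ ℚ.∣ q ∣)
    ([p-q]+q≡p p q) (ℚₚ.∣p+q∣≤∣p∣+∣q∣ (p ℚ.- q) q)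

  ∣p∣-∣q∣≤∣p-q∣ : ∀ p q → ℚ.∣ p ∣ ℚ.- ℚ.∣ q ∣ ℚ.≤ ℚ.∣ p ℚ.- q ∣
  ∣p∣-∣q∣≤∣p-q∣ p q = subst (ℚ.∣ p ∣ ℚ.- ℚ.∣ q ∣ ℚ.≤_)
    ([p+q]-q≡p ℚ.∣ p ℚ.- q ∣ ℚ.∣ q ∣)
    (ℚₚ.+-monoˡ-≤ (ℚ.- ℚ.∣ q ∣) (∣p∣≤∣p-q∣+∣q∣ p q))

  ∣p-q∣≡∣q-p∣ : ∀ p q → ℚ.∣ p ℚ.- q ∣ ≡ ℚ.∣ q ℚ.- p ∣
  ∣p-q∣≡∣q-p∣ p q = trans (cong ℚ.∣_∣ (neg-diff q p)) (ℚₚ.∣-p∣≡∣p∣ (q ℚ.- p))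

  ∣-p--q∣≡∣p-q∣ : ∀ p q → ℚ.∣ ℚ.- p ℚ.- ℚ.- q ∣ ≡ ℚ.∣ p ℚ.- q ∣
  ∣-p--q∣≡∣p-q∣ p q = trans (cong ℚ.∣_∣ (sym (diff-neg p q))) (∣p-q∣≡∣q-p∣ q p)

  ∣∣p∣-∣q∣∣≤∣p-q∣ : ∀ p q → ℚ.∣ ℚ.∣ p ∣ ℚ.- ℚ.∣ q ∣ ∣ ℚ.≤ ℚ.∣ p ℚ.- q ∣
  ∣∣p∣-∣q∣∣≤∣p-q∣ p q with ℚₚ.∣p∣≡p∨∣p∣≡-p (ℚ.∣ p ∣ ℚ.- ℚ.∣ q ∣)
  ... | inj₁ eq rewrite eq = ∣p∣-∣q∣≤∣p-q∣ p q
  ... | inj₂ eq rewrite eq = subst (ℚ._≤ ℚ.∣ p ℚ.- q ∣)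
    (neg-diff ℚ.∣ p ∣ ℚ.∣ q ∣)
    (subst (ℚ.∣ q ∣ ℚ.- ℚ.∣ p ∣ ℚ.≤_) (∣p-q∣≡∣q-p∣ q p) (∣p∣-∣q∣≤∣p-q∣ q p))

  bounded : ∀ x → ∃[ K ] (0ℚ ℚ.< K × (∃[ N ] (∀ n → N ℕ.≤ n → ℚ.∣ seq x n ∣ ℚ.≤ K)))
  bounded x with cauchy x 1ℚ (ℚₚ.positive⁻¹ 1ℚ)
  ... | N , h = 1ℚ ℚ.+ ℚ.∣ seq x N ∣
    , ℚₚ.+-mono-<-≤ (ℚₚ.positive⁻¹ 1ℚ) (ℚₚ.0≤∣p∣ (seq x N))
    , N , λ n N≤n → ℚₚ.≤-trans (∣p∣≤∣p-q∣+∣q∣ (seq x n) (seq x N))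
            (ℚₚ.+-monoˡ-≤ ℚ.∣ seq x N ∣ (ℚₚ.<⇒≤ (h n N N≤n ℕₚ.≤-refl)))

private
  abstract
    const-cauchy : ∀ p → IsCauchy (λ _ → p)
    const-cauchy p ε 0<ε = 0 , λ _ _ _ _ →
      subst (λ r → ℚ.∣ r ∣ ℚ.< ε) (sym (ℚₚ.+-inverseʳ p)) 0<ε

    +-cauchy : ∀ x y → IsCauchy (λ n → seq x n ℚ.+ seq y n)
    +-cauchy x y ε 0<ε
      with cauchy x (½ ℚ.* ε) (½-pos 0<ε) | cauchy y (½ ℚ.* ε) (½-pos 0<ε)
    ... | M , hx | N , hy = M ℕ.⊔ N , λ m n N≤m N≤n →
      subst (ℚ.∣ (seq x m ℚ.+ seq y m) ℚ.- (seq x n ℚ.+ seq y n) ∣ ℚ.<_) (½+½ ε)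
        (∣a+c-[b+d]∣< (seq x m) (seq x n) (seq y m) (seq y n)
          (hx m n (max-l {M} N≤m) (max-l {M} N≤n))
          (hy m n (max-r {M} N≤m) (max-r {M} N≤n)))

    neg-cauchy : ∀ x → IsCauchy (λ n → ℚ.- seq x n)
    neg-cauchy x ε 0<ε with cauchy x ε 0<ε
    ... | N , h = N , λ m n N≤m N≤n →
      subst (ℚ._< ε) (sym (∣-p--q∣≡∣p-q∣ (seq x m) (seq x n))) (h m n N≤m N≤n)

    abs-cauchy : ∀ x → IsCauchy (λ n → ℚ.∣ seq x n ∣)
    abs-cauchy x ε 0<ε with cauchy x ε 0<ε
    ... | N , h = N , λ m n N≤m N≤n →
      ℚₚ.≤-<-trans (∣∣p∣-∣q∣∣≤∣p-q∣ (seq x m) (seq x n)) (h m n N≤m N≤n)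

    divide : ∀ S ε → 0ℚ ℚ.< S → 0ℚ ℚ.< ε → ∃[ δ ] (0ℚ ℚ.< δ × S ℚ.* δ ≡ ε)
    divide S ε 0<S 0<ε = ℚ.1/ S ℚ.* ε , 0<δ , Sδ≡ε
      where
      instance
        S-pos : Positive S
        S-pos = ℚ.positive 0<S

        S-nonZero : ℚ.NonZero S
        S-nonZero = ℚₚ.pos⇒nonZero S

        ε-pos : Positive ε
        ε-pos = ℚ.positive 0<ε

        1/S-pos : Positive (ℚ.1/ S)
        1/S-pos = ℚₚ.1/pos⇒pos S

      0<δ : 0ℚ ℚ.< ℚ.1/ S ℚ.* ε
      0<δ = ℚₚ.positive⁻¹ (ℚ.1/ S ℚ.* ε) {{ℚₚ.pos*pos⇒pos (ℚ.1/ S) ε}}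

      Sδ≡ε : S ℚ.* (ℚ.1/ S ℚ.* ε) ≡ ε
      Sδ≡ε = trans (sym (ℚₚ.*-assoc S (ℚ.1/ S) ε))
        (trans (cong (ℚ._* ε) (ℚₚ.*-inverseʳ S)) (ℚₚ.*-identityˡ ε))

    ∣uv∣< : ∀ C u v {δ} → 0ℚ ℚ.< C → ℚ.∣ u ∣ ℚ.≤ C → ℚ.∣ v ∣ ℚ.< δ →
            ℚ.∣ u ℚ.* v ∣ ℚ.< C ℚ.* δ
    ∣uv∣< C u v {δ} 0<C u≤C v<δ = subst (ℚ._< C ℚ.* δ) (sym (ℚₚ.∣p*q∣≡∣p∣*∣q∣ u v))
      (ℚₚ.≤-<-trans
        (ℚₚ.*-monoʳ-≤-nonNeg ℚ.∣ v ∣ {{ℚₚ.∣-∣-nonNeg v}} u≤C)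
        (ℚₚ.*-monoʳ-<-pos C {{ℚ.positive 0<C}} v<δ))

    ∣ac-bd∣< : ∀ K L a b c d {δ} → 0ℚ ℚ.< K → 0ℚ ℚ.< L →
               ℚ.∣ a ∣ ℚ.≤ K → ℚ.∣ d ∣ ℚ.≤ L → ℚ.∣ a ℚ.- b ∣ ℚ.< δ → ℚ.∣ c ℚ.- d ∣ ℚ.< δ →
               ℚ.∣ a ℚ.* c ℚ.- b ℚ.* d ∣ ℚ.< (K ℚ.+ L) ℚ.* δ
    ∣ac-bd∣< K L a b c d {δ} 0<K 0<L a≤K d≤L a-b<δ c-d<δ =
      subst (λ r → ℚ.∣ r ∣ ℚ.< (K ℚ.+ L) ℚ.* δ) (diff-* a b c d)
        (ℚₚ.≤-<-trans (ℚₚ.∣p+q∣≤∣p∣+∣q∣ (a ℚ.* (c ℚ.- d)) (d ℚ.* (a ℚ.- b)))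
          (subst (ℚ.∣ a ℚ.* (c ℚ.- d) ∣ ℚ.+ ℚ.∣ d ℚ.* (a ℚ.- b) ∣ ℚ.<_)
            (sym (ℚₚ.*-distribʳ-+ δ K L))
            (ℚₚ.+-mono-< (∣uv∣< K a (c ℚ.- d) 0<K a≤K c-d<δ)
                         (∣uv∣< L d (a ℚ.- b) 0<L d≤L a-b<δ))))

    +-pos : ∀ {p q} → 0ℚ ℚ.< p → 0ℚ ℚ.< q → 0ℚ ℚ.< p ℚ.+ q
    +-pos {p} {q} 0<p 0<q =
      ℚₚ.<-trans 0<p (subst (ℚ._< p ℚ.+ q) (ℚₚ.+-identityʳ p) (ℚₚ.+-monoʳ-< p 0<q))

    *-cauchy : ∀ x y → IsCauchy (λ n → seq x n ℚ.* seq y n)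
    *-cauchy x y ε 0<ε =
      let K , 0<K , A , hA = bounded x
          L , 0<L , B , hB = bounded y
          δ , 0<δ , Sδ≡ε   = divide (K ℚ.+ L) ε (+-pos 0<K 0<L) 0<ε
          M , hx           = cauchy x δ 0<δ
          N , hy           = cauchy y δ 0<δ
      in (A ℕ.⊔ B) ℕ.⊔ (M ℕ.⊔ N) , λ m n ≤m ≤n →
        ℚₚ.<-≤-trans
          (∣ac-bd∣< K L (seq x m) (seq x n) (seq y m) (seq y n) 0<K 0<L
            (hA m (max-l {A} {B} (max-l {A ℕ.⊔ B} {M ℕ.⊔ N} ≤m)))
            (hB n (max-r {A} {B} (max-l {A ℕ.⊔ B} {M ℕ.⊔ N} ≤n)))
            (hx m n (max-l {M} {N} (max-r {A ℕ.⊔ B} {M ℕ.⊔ N} ≤m))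
                    (max-l {M} {N} (max-r {A ℕ.⊔ B} {M ℕ.⊔ N} ≤n)))
            (hy m n (max-r {M} {N} (max-r {A ℕ.⊔ B} {M ℕ.⊔ N} ≤m))
                    (max-r {M} {N} (max-r {A ℕ.⊔ B} {M ℕ.⊔ N} ≤n))))
          (ℚₚ.≤-reflexive Sδ≡ε)

fromℚ : ℚ → ℝ
fromℚ p = mkℝ (λ _ → p) (const-cauchy p)

infixl 6 _+_ _-_
infixl 7 _*_
infix  8 -_

_+_ : ℝ → ℝ → ℝ
x + y = mkℝ (λ n → seq x n ℚ.+ seq y n) (+-cauchy x y)

-_ : ℝ → ℝ
- x = mkℝ (λ n → ℚ.- seq x n) (neg-cauchy x)

_-_ : ℝ → ℝ → ℝ
x - y = x + - y

∣_∣ : ℝ → ℝ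
∣ x ∣ = mkℝ (λ n → ℚ.∣ seq x n ∣) (abs-cauchy x)

_*_ : ℝ → ℝ → ℝ
x * y = mkℝ (λ n → seq x n ℚ.* seq y n) (*-cauchy x y)

0ℝ 1ℝ : ℝ
0ℝ = fromℚ 0ℚ
1ℝ = fromℚ 1ℚ

ℝ-rawRing : RawRing 0ℓ 0ℓ
ℝ-rawRing = record
  { Carrier = ℝ ; _≈_ = _≈_ ; _+_ = _+_ ; _*_ = _*_ ; -_ = -_ ; 0# = 0ℝ ; 1# = 1ℝ }

open RawSemiringDefs (RawRing.rawSemiring ℝ-rawRing) public using (sum; _^_)

infixl 7 _÷_

-- Only used with a positive denominator; the value at 0 is arbitrary.
_÷_ : ℤ → ℕ → ℝ
z ÷ zero    = 0ℝ
z ÷ (suc n) = fromℚ (z ℚ./ suc n)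

fromℤ : ℤ → ℝ
fromℤ z = z ÷ 1

IsQuotient : ℝ → ℝ → ℝ → Set
IsQuotient x y r = ¬ (y ≈ 0ℝ) × r * y ≈ x

-- Partial operations on reals are given by their graphs: the last
-- argument is the value.

ConvergesTo : (ℕ → ℝ) → ℝ → Set
ConvergesTo s x = ∀ ε → 0ℝ < ε → ∃[ N ] (∀ n → N ℕ.≤ n → ∣ s n - x ∣ < ε)

IsSeries : (ℕ → ℝ) → ℝ → Set
IsSeries a x = ConvergesTo (λ N → sum {N} (λ i → a (toℕ i))) x

IsExp : ℝ → ℝ → Set
IsExp x y = IsSeries (λ i → x ^ i * (1ℤ ÷ (i !))) y

IsLog : ℝ → ℝ → Set
IsLog x y = IsExp y x

-- P is Q to the real power θ, i.e. exp (θ log Q); this entails Q > 0.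
IsPower : ℝ → ℝ → ℝ → Set
IsPower Q θ P = ∃[ l ] (IsLog Q l × IsExp (θ * l) P)

RatiosTendTo∞ : (ℕ → ℝ) → Set
RatiosTendTo∞ b = ∀ M → ∃[ N ] (∀ m → N ℕ.≤ m →
  ∃[ r ] (IsQuotient (b (suc m)) (b m) r × M < r))

IsLiminf : (ℝ → ℝ) → ℝ → Set
IsLiminf f L =
    (∀ ε → 0ℝ < ε → ∃[ Q₀ ] (∀ Q → Q₀ < Q → L - ε < f Q))
  × (∀ ε → 0ℝ < ε → ∀ Q₀ → ∃[ Q ] (Q₀ < Q × f Q < L + ε))

IsLimsup : (ℝ → ℝ) → ℝ → Set
IsLimsup f L =
    (∀ ε → 0ℝ < ε → ∃[ Q₀ ] (∀ Q → Q₀ < Q → f Q < L + ε))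
  × (∀ ε → 0ℝ < ε → ∀ Q₀ → ∃[ Q ] (Q₀ < Q × L - ε < f Q))

IsMinimum : (ℝ → Set) → ℝ → Set
IsMinimum P m = P m × (∀ θ → P θ → m ≤ θ)

LinearlyIndependentℚ : ∀ {n} → Vector ℝ n → Set
LinearlyIndependentℚ {n} v = (c : Vector ℚ n) →
  sum (λ i → fromℚ (c i) * v i) ≈ 0ℝ → ∀ i → c i ≡ 0ℚ

-- For integer vectors, independence over ℤ, ℚ and ℝ coincide.
LinearlyIndependentℤ : ∀ {d n} → Vector (Vector ℤ d) n → Set
LinearlyIndependentℤ {d} {n} v = (c : Vector ℤ n) →
  (∀ i → ℤ-sum (λ l → c l ℤ.* v l i) ≡ 0ℤ) → ∀ l → c l ≡ 0ℤ
  where open RawMonoidDefs ℤ.+-0-rawMonoid renaming (sum to ℤ-sum)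

-- An integer point v is (x , y₁ , … , y_k).
Solves : ∀ {k} → Vector ℝ k → ℝ → ℝ → Vector ℤ (suc k) → Set
Solves {k} ζ Q θ v =
    (∃[ P ] (IsPower Q (1ℝ + θ) P × ∣ fromℤ x ∣ ≤ P))
  × (∃[ P ] (IsPower Q (-1ℤ ÷ k + θ) P × (∀ i → ∣ ζ i * fromℤ x - fromℤ (y i) ∣ ≤ P)))
  where
  x = head v
  y = tail v

HasIndependentSolutions : ∀ {k} → Vector ℝ k → ℕ → ℝ → ℝ → Set
HasIndependentSolutions {k} ζ j Q θ =
  Σ (Vector (Vector ℤ (suc k)) j) λ v →
    LinearlyIndependentℤ v × (∀ l → Solves ζ Q θ (v l))

-- ψ j Q is ψ_j(Q); only 1 ≤ j ≤ k + 1 and Q > 1 are constrained.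
IsPsi : ∀ {k} → Vector ℝ k → (ℕ → ℝ → ℝ) → Set
IsPsi {k} ζ ψ = ∀ j → 1 ℕ.≤ j → j ℕ.≤ suc k → ∀ Q → 1ℝ < Q →
  IsMinimum (HasIndependentSolutions ζ j Q) (ψ j Q)

-- The denominators q n j, for n ≥ 1 and 1 ≤ j ≤ k; other values of the
-- indices are unconstrained.

Increasing : ℕ → (ℕ → ℕ → ℕ) → Set
Increasing k q = ∀ n → 1 ℕ.≤ n →
    (∀ j → 1 ℕ.≤ j → j ℕ.< k → q n j ℕ.< q n (suc j))
  × q n k ℕ.< q (suc n) 1

Divisibility : ℕ → (ℕ → ℕ → ℕ) → Set
Divisibility k q = ∀ n → 1 ℕ.≤ n →
    (∀ j → 1 ℕ.≤ j → j ℕ.< k → q n j ∣ q n (suc j))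
  × q n k ∣ q (suc n) 1

{-# OPTIONS --safe #-}
module Submission where

-- Let dₘ = 2 ^ (m !) run through all the denominators q n j in increasing
-- order, and let pₘ be the numerators, over dₘ, of the partial sums of ζ up
-- to dₘ. The approximants (dₘ , pₘ) have error about dₘ / dₘ₊₁ in a single
-- coordinate and about dₘ / dₘ₊₂ in all the others. Write κ = 1 / k,
-- Q = exp l and τ = (κ - 1) / 2. At l = log dₘ₊₁ / (1 + κ) the m-th
-- approximant gives ψ₁ ≈ -1, while
-- |dₘ yᵢ - x pᵢ| < 1 forces every solution at κ - ε to be proportional to
-- it, so ψ₂ ≈ κ. At l = 2 log dₘ₊₁ / (1 + κ) the m-th and (m + 1)-st
-- approximants both have θ ≈ τ and no solution can do better. In between,
-- the same minors with the exceptional coordinate left free confine all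
-- solutions at κ - ε to a plane, so ψ₃ ≈ κ for all large Q; the unit points
-- give ψⱼ ≤ κ. The lower bound ψ₂ ≥ τ - ε comes from the 2 × 2 minors of
-- two solutions, which are integers of absolute value ≤ 2 Q ^ (1 - κ + 2θ).
-- Since log dₘ₊₁ / log dₘ → ∞, constants and log dₘ are negligible against l.

open import Algebra.Bundles using (CommutativeRing; RawRing)
import Algebra.Definitions.RawMonoid as RawMonoidDefs
import Algebra.Solver.Ring as RingSolver
open import Algebra.Solver.Ring.AlmostCommutativeRing
  using (_-Raw-AlmostCommutative⟶_; fromCommutativeRing)
open import Axiom.ExcludedMiddle using (ExcludedMiddle)
open import Data.Fin.Base as Fin using (Fin; toℕ)
open import Data.Fin.Patterns using (0F; 1F; 2F)
import Data.Fin.Properties as Finₚ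
open import Data.Integer.Base as ℤ using (ℤ; +_; -[1+_]; 0ℤ; 1ℤ; -1ℤ)
import Data.Integer.Properties as ℤₚ
import Data.Integer.Solver as ℤ-Solver
open import Data.Maybe.Base using (Maybe; just; nothing)
open import Data.Nat.Base as ℕ using (ℕ; zero; suc; _!; _∸_)
open import Data.Nat.Divisibility using (_∣_; m∣m*n)
open import Data.Nat.DivMod using (_mod_; [m+kn]%n≡m%n; m<n⇒m%n≡m)
import Data.Nat.Properties as ℕₚ
open import Data.Product.Base using (Σ; ∃-syntax; _×_; _,_; proj₁; proj₂)
open import Data.Rational.Base as ℚ using (ℚ; 0ℚ; 1ℚ; ½)
import Data.Rational.Properties as ℚₚ
import Data.Rational.Solver as ℚ-Solver
open import Data.Rational.Unnormalised.Base as ℚᵘ using (mkℚᵘ; *≡*; *≤*)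
import Data.Rational.Unnormalised.Properties as ℚᵘₚ
open import Data.Sum.Base using (_⊎_; inj₁; inj₂; [_,_]′)
open import Data.Vec.Functional using (Vector; []; _∷_)
import Defs
open import Function.Base using (_∘_; id)
open import Level using (0ℓ)
open import Relation.Binary.PropositionalEquality
  using (_≡_; _≢_; _≗_; refl; sym; trans; cong; cong₂; subst; subst₂; module ≡-Reasoning)
open import Relation.Nullary.Decidable using (Dec; yes; no; decidable-stable)
open import Relation.Nullary.Negation.Core using (¬_; contradiction)

open Defs using (LinearlyIndependentℤ)
open RawMonoidDefs ℤ.+-0-rawMonoid using () renaming (sum to ℤ-sum)

-- The exponents of the two bounds differ by `H = (1 + κ) l` for every `θ`; each estimate compares
-- `H` with the `log dₘ`. The choice `2 ^ (m !)` makes these logarithms integer multiples of `log 2`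
-- with `log dₘ₊₁ = (m + 1) log dₘ`, so after taking logarithms every estimate is an elementary
-- inequality in `l`, `ε` and a few `log dₘ`, certified by exhibiting its slack. Two obstacles lie
-- outside the Diophantine argument. First, `ψⱼ(Q)` has to be attained, not merely an infimum; this
-- follows from the finiteness of the integer points in a box. Second, reals are bare Cauchy
-- sequences and powers are given by graphs, so the exponential has to be built from its series,
-- while the total order, logarithms and minima come from excluded middle and bisection. The
-- Diophantine part is carried out in an abstract ordered ring containing the rationals. The
-- rationals are themselves an instance of it, and the estimates for the exponential series use the
-- same tools there.

fromℚᵘ-homo-+ : ∀ p q → ℚ.fromℚᵘ (p ℚᵘ.+ q) ≡ ℚ.fromℚᵘ p ℚ.+ ℚ.fromℚᵘ q
fromℚᵘ-homo-+ p q = ℚₚ.toℚᵘ-injective (ℚᵘₚ.≃-trans (ℚₚ.toℚᵘ-fromℚᵘ (p ℚᵘ.+ q))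
  (ℚᵘₚ.≃-sym (ℚᵘₚ.≃-trans (ℚₚ.toℚᵘ-homo-+ (ℚ.fromℚᵘ p) (ℚ.fromℚᵘ q))
    (ℚᵘₚ.+-cong (ℚₚ.toℚᵘ-fromℚᵘ p) (ℚₚ.toℚᵘ-fromℚᵘ q)))))

fromℚᵘ-homo-* : ∀ p q → ℚ.fromℚᵘ (p ℚᵘ.* q) ≡ ℚ.fromℚᵘ p ℚ.* ℚ.fromℚᵘ q
fromℚᵘ-homo-* p q = ℚₚ.toℚᵘ-injective (ℚᵘₚ.≃-trans (ℚₚ.toℚᵘ-fromℚᵘ (p ℚᵘ.* q))
  (ℚᵘₚ.≃-sym (ℚᵘₚ.≃-trans (ℚₚ.toℚᵘ-homo-* (ℚ.fromℚᵘ p) (ℚ.fromℚᵘ q))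
    (ℚᵘₚ.*-cong (ℚₚ.toℚᵘ-fromℚᵘ p) (ℚₚ.toℚᵘ-fromℚᵘ q)))))

fromℚᵘ-mono-≤ : ∀ {p q} → p ℚᵘ.≤ q → ℚ.fromℚᵘ p ℚ.≤ ℚ.fromℚᵘ q
fromℚᵘ-mono-≤ {p} {q} p≤q = ℚₚ.toℚᵘ-cancel-≤
  (ℚᵘₚ.≤-respˡ-≃ (ℚᵘₚ.≃-sym (ℚₚ.toℚᵘ-fromℚᵘ p)) (ℚᵘₚ.≤-respʳ-≃ (ℚᵘₚ.≃-sym (ℚₚ.toℚᵘ-fromℚᵘ q)) p≤q))

toℚ : ℤ → ℚ
toℚ z = z ℚ./ 1

toℚ-homo-+ : ∀ x y → toℚ (x ℤ.+ y) ≡ toℚ x ℚ.+ toℚ y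
toℚ-homo-+ x y = trans
  (ℚₚ.fromℚᵘ-cong {mkℚᵘ (x ℤ.+ y) 0} {mkℚᵘ x 0 ℚᵘ.+ mkℚᵘ y 0}
    (*≡* (cong (ℤ._* 1ℤ) (sym (cong₂ ℤ._+_ (ℤₚ.*-identityʳ x) (ℤₚ.*-identityʳ y))))))
  (fromℚᵘ-homo-+ (mkℚᵘ x 0) (mkℚᵘ y 0))

toℚ-homo-* : ∀ x y → toℚ (x ℤ.* y) ≡ toℚ x ℚ.* toℚ y
toℚ-homo-* x y = fromℚᵘ-homo-* (mkℚᵘ x 0) (mkℚᵘ y 0)

toℚ-pos-* : ∀ m n → toℚ (+ (m ℕ.* n)) ≡ toℚ (+ m) ℚ.* toℚ (+ n)
toℚ-pos-* m n = trans (cong toℚ (ℤₚ.pos-* m n)) (toℚ-homo-* (+ m) (+ n))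

toℚ-homo-neg : ∀ x → toℚ (ℤ.- x) ≡ ℚ.- toℚ x
toℚ-homo-neg x = begin
  toℚ (ℤ.- x)                              ≡⟨ sym (ℚₚ.+-identityʳ (toℚ (ℤ.- x))) ⟩
  toℚ (ℤ.- x) ℚ.+ 0ℚ                       ≡⟨ cong (toℚ (ℤ.- x) ℚ.+_) (sym (ℚₚ.+-inverseʳ (toℚ x))) ⟩
  toℚ (ℤ.- x) ℚ.+ (toℚ x ℚ.- toℚ x)        ≡⟨ sym (ℚₚ.+-assoc (toℚ (ℤ.- x)) (toℚ x) (ℚ.- toℚ x)) ⟩
  (toℚ (ℤ.- x) ℚ.+ toℚ x) ℚ.- toℚ x        ≡⟨ cong (ℚ._- toℚ x) (sym (toℚ-homo-+ (ℤ.- x) x)) ⟩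
  toℚ (ℤ.- x ℤ.+ x) ℚ.- toℚ x              ≡⟨ cong (λ z → toℚ z ℚ.- toℚ x) (ℤₚ.+-inverseˡ x) ⟩
  0ℚ ℚ.- toℚ x                             ≡⟨ ℚₚ.+-identityˡ (ℚ.- toℚ x) ⟩
  ℚ.- toℚ x                                ∎
  where open ≡-Reasoning

toℚ-mono-≤ : ∀ {x y} → x ℤ.≤ y → toℚ x ℚ.≤ toℚ y
toℚ-mono-≤ {x} {y} x≤y = fromℚᵘ-mono-≤ {mkℚᵘ x 0} {mkℚᵘ y 0} (*≤* (ℤₚ.*-monoʳ-≤-nonNeg 1ℤ x≤y))

0≤toℚ : ∀ n → 0ℚ ℚ.≤ toℚ (+ n)
0≤toℚ n = toℚ-mono-≤ {0ℤ} {+ n} (ℤ.+≤+ ℕ.z≤n)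

1/n*n≡1 : ∀ n .{{_ : ℕ.NonZero n}} → (1ℤ ℚ./ n) ℚ.* toℚ (+ n) ≡ 1ℚ
1/n*n≡1 (suc n) = trans (sym (fromℚᵘ-homo-* (mkℚᵘ 1ℤ n) (mkℚᵘ (+ suc n) 0)))
  (ℚₚ.fromℚᵘ-cong {mkℚᵘ 1ℤ n ℚᵘ.* mkℚᵘ (+ suc n) 0} {mkℚᵘ 1ℤ 0} (*≡* (cong +_
    (trans (ℕₚ.*-identityʳ (1 ℕ.* suc n)) (cong (1 ℕ.*_) (sym (ℕₚ.*-identityʳ (suc n))))))))

-- Kronecker delta, integer sums and powers of one half

δ : ∀ {n} → Fin n → Fin n → ℤ
δ 0F    0F    = 1ℤ
δ 0F    (Fin.suc _) = 0ℤ
δ (Fin.suc _) 0F    = 0ℤ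
δ (Fin.suc i) (Fin.suc j) = δ i j

δ-refl : ∀ {n} (i : Fin n) → δ i i ≡ 1ℤ
δ-refl 0F    = refl
δ-refl (Fin.suc i) = δ-refl i

δ-≢ : ∀ {n} {i j : Fin n} → i ≢ j → δ i j ≡ 0ℤ
δ-≢ {i = 0F}  {0F}  i≢j = contradiction refl i≢j
δ-≢ {i = 0F}  {Fin.suc _} _   = refl
δ-≢ {i = Fin.suc _} {0F}  _   = refl
δ-≢ {i = Fin.suc i} {Fin.suc j} i≢j = δ-≢ (i≢j ∘ cong Fin.suc)

δ-sym : ∀ {n} (i j : Fin n) → δ i j ≡ δ j i
δ-sym 0F    0F    = refl
δ-sym 0F    (Fin.suc _) = refl
δ-sym (Fin.suc _) 0F    = refl
δ-sym (Fin.suc i) (Fin.suc j) = δ-sym i j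

ℤ-sum-cong : ∀ {n} {f g : Vector ℤ n} → f ≗ g → ℤ-sum f ≡ ℤ-sum g
ℤ-sum-cong {zero}  f≗g = refl
ℤ-sum-cong {suc n} f≗g = cong₂ ℤ._+_ (f≗g 0F) (ℤ-sum-cong (f≗g ∘ Fin.suc))

ℤ-sum-*0 : ∀ {n} (c : Vector ℤ n) → ℤ-sum (λ l → c l ℤ.* 0ℤ) ≡ 0ℤ
ℤ-sum-*0 {zero}  c = refl
ℤ-sum-*0 {suc n} c = cong₂ ℤ._+_ (ℤₚ.*-zeroʳ (c 0F)) (ℤ-sum-*0 (c ∘ Fin.suc))

ℤ-sum-δ : ∀ {n} (c : Vector ℤ n) i → ℤ-sum (λ l → c l ℤ.* δ l i) ≡ c i
ℤ-sum-δ c 0F = trans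
  (cong₂ ℤ._+_ (ℤₚ.*-identityʳ (c 0F)) (ℤ-sum-*0 (c ∘ Fin.suc))) (ℤₚ.+-identityʳ (c 0F))
ℤ-sum-δ c (Fin.suc i) = trans
  (cong₂ ℤ._+_ (ℤₚ.*-zeroʳ (c 0F)) (ℤ-sum-δ (c ∘ Fin.suc) i)) (ℤₚ.+-identityˡ (c (Fin.suc i)))

½^ : ℕ → ℚ
½^ zero    = 1ℚ
½^ (suc n) = ½ ℚ.* ½^ n

½^-+ : ∀ m n → ½^ (m ℕ.+ n) ≡ ½^ m ℚ.* ½^ n
½^-+ zero    n = sym (ℚₚ.*-identityˡ (½^ n))
½^-+ (suc m) n = trans (cong (½ ℚ.*_) (½^-+ m n)) (sym (ℚₚ.*-assoc ½ (½^ m) (½^ n)))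

2^*½^ : ∀ n → toℚ (+ (2 ℕ.^ n)) ℚ.* ½^ n ≡ 1ℚ
2^*½^ zero    = refl
2^*½^ (suc n) = begin
  toℚ (+ (2 ℕ.* 2 ℕ.^ n)) ℚ.* (½ ℚ.* ½^ n)
    ≡⟨ cong (ℚ._* (½ ℚ.* ½^ n)) (toℚ-pos-* 2 (2 ℕ.^ n)) ⟩
  (toℚ (+ 2) ℚ.* t) ℚ.* (½ ℚ.* ½^ n)
    ≡⟨ solve 2 (λ t h → (con (toℚ (+ 2)) :* t) :* (con ½ :* h) := t :* h) refl t (½^ n) ⟩
  t ℚ.* ½^ n
    ≡⟨ 2^*½^ n ⟩
  1ℚ ∎
  where
  open ≡-Reasoning
  open ℚ-Solver.+-*-Solver
  t = toℚ (+ (2 ℕ.^ n))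

n<2^n : ∀ n → n ℕ.< 2 ℕ.^ n
n<2^n zero    = ℕₚ.≤-refl
n<2^n (suc n) = ℕₚ.+-mono-≤ (ℕₚ.m^n>0 2 n) (ℕₚ.≤-trans (n<2^n n) (ℕₚ.≤-reflexive (sym (ℕₚ.+-identityʳ (2 ℕ.^ n)))))

-- Ordered rings containing the rationals

record OrderedRing : Set₁ where
  infix 4 _≤_
  field
    commutativeRing : CommutativeRing 0ℓ 0ℓ
  open CommutativeRing commutativeRing public
    using (Carrier; _≈_; _+_; _*_; -_; _-_; 0#; 1#)
  field
    _≤_          : Carrier → Carrier → Set
    ≤-reflexive  : ∀ {x y} → x ≈ y → x ≤ y
    ≤-trans      : ∀ {x y z} → x ≤ y → y ≤ z → x ≤ z
    ≤-antisym    : ∀ {x y} → x ≤ y → y ≤ x → x ≈ y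
    ≤-total      : ∀ x y → x ≤ y ⊎ y ≤ x
    +-monoˡ-≤    : ∀ z {x y} → x ≤ y → x + z ≤ y + z
    *-nonNeg     : ∀ {x y} → 0# ≤ x → 0# ≤ y → 0# ≤ x * y
    fromℚ        : ℚ → Carrier
    fromℚ-homo-+ : ∀ p q → fromℚ (p ℚ.+ q) ≈ fromℚ p + fromℚ q
    fromℚ-homo-* : ∀ p q → fromℚ (p ℚ.* q) ≈ fromℚ p * fromℚ q
    fromℚ-homo-- : ∀ p → fromℚ (ℚ.- p) ≈ - fromℚ p
    fromℚ-homo-0 : fromℚ 0ℚ ≈ 0#
    fromℚ-homo-1 : fromℚ 1ℚ ≈ 1#
    fromℚ-mono   : ∀ {p q} → p ℚ.≤ q → fromℚ p ≤ fromℚ q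
    fromℚ-cancel : ∀ {p q} → fromℚ p ≤ fromℚ q → p ℚ.≤ q
    archimedean  : ∀ x → ∃[ n ] x ≤ fromℚ (+ n ℚ./ 1)
    ≤-limit      : ∀ {x y} → (∀ n → x ≤ y + fromℚ (1ℤ ℚ./ suc n)) → x ≤ y

module OrderedRingProperties (R : OrderedRing) where
  open OrderedRing R public
  open CommutativeRing commutativeRing public
    using (+-cong; *-cong; -‿cong; +-comm; *-comm; +-assoc; *-assoc; *-identityˡ; *-identityʳ; +-identityˡ; +-identityʳ; zeroʳ; -‿inverseʳ)
    renaming (refl to ≈-refl; sym to ≈-sym; trans to ≈-trans)

  infix 4 _<_
  -- Strictness in negative form carries no positive gap. For the reals, excluded middle recovers
  -- through `≰⇒>` the gap that the strict order on Cauchy sequences demands.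
  _<_ : Carrier → Carrier → Set
  x < y = ¬ (y ≤ x)

  fromℚ-cong : ∀ {p q} → p ≡ q → fromℚ p ≈ fromℚ q
  fromℚ-cong refl = ≈-refl

  private
    -- Rational coefficients let the ring solver normalise constants such as `½`, which occur
    -- throughout the slack certificates.
    coefficients : RawRing 0ℓ 0ℓ
    coefficients = CommutativeRing.rawRing ℚₚ.+-*-commutativeRing

    embedding : coefficients -Raw-AlmostCommutative⟶ fromCommutativeRing commutativeRing
    embedding = record
      { ⟦_⟧    = fromℚ
      ; +-homo = fromℚ-homo-+
      ; *-homo = fromℚ-homo-*
      ; -‿homo = fromℚ-homo--
      ; 0-homo = fromℚ-homo-0
      ; 1-homo = fromℚ-homo-1
      }

    _≟_ : ∀ p q → Maybe (fromℚ p ≈ fromℚ q)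
    p ≟ q with p ℚₚ.≟ q
    ... | yes p≡q = just (fromℚ-cong p≡q)
    ... | no  _   = nothing

  module Solver = RingSolver coefficients (fromCommutativeRing commutativeRing) embedding _≟_
  open Solver public using (solve; _:=_; _:+_; _:*_; _:-_; :-_; con)

  ≤-refl : ∀ {x} → x ≤ x
  ≤-refl = ≤-reflexive ≈-refl

  ≤-resp : ∀ {x x′ y y′} → x ≈ x′ → y ≈ y′ → x ≤ y → x′ ≤ y′
  ≤-resp x≈x′ y≈y′ x≤y =
    ≤-trans (≤-reflexive (≈-sym x≈x′)) (≤-trans x≤y (≤-reflexive y≈y′))

  <⇒≤ : ∀ {x y} → x < y → x ≤ y
  <⇒≤ {x} {y} x<y with ≤-total x y
  ... | inj₁ x≤y = x≤y
  ... | inj₂ y≤x = contradiction y≤x x<y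

  slack : ∀ {x y} → x ≤ y → 0# ≤ y - x
  slack {x} {y} x≤y = ≤-resp (-‿inverseʳ x) ≈-refl (+-monoˡ-≤ (- x) x≤y)

  -- An inequality is proved by exhibiting its slack as a nonnegative
  -- combination of the slacks of known inequalities.
  by-slack : ∀ {x y s} → 0# ≤ s → s ≈ y - x → x ≤ y
  by-slack {x} {y} 0≤s s≈y-x = ≤-resp (+-identityˡ x)
    (solve 2 (λ x y → (y :- x) :+ x := y) ≈-refl x y)
    (+-monoˡ-≤ x (≤-resp ≈-refl s≈y-x 0≤s))

  infixl 6 _⊕_
  infixl 7 _⊛_

  _⊕_ : ∀ {x y} → 0# ≤ x → 0# ≤ y → 0# ≤ x + y
  _⊕_ {x} {y} 0≤x 0≤y = ≤-trans 0≤x (≤-resp (+-identityˡ x) (+-comm y x) (+-monoˡ-≤ x 0≤y))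

  _⊛_ : ∀ {x y} → 0# ≤ x → 0# ≤ y → 0# ≤ x * y
  _⊛_ = *-nonNeg

  0≤fromℚ : ∀ p .{{_ : ℚ.NonNegative p}} → 0# ≤ fromℚ p
  0≤fromℚ p = ≤-resp fromℚ-homo-0 ≈-refl (fromℚ-mono (ℚₚ.nonNegative⁻¹ p))

  +-mono-≤ : ∀ {x y u v} → x ≤ y → u ≤ v → x + u ≤ y + v
  +-mono-≤ {x} {y} {u} {v} x≤y u≤v = by-slack (slack x≤y ⊕ slack u≤v)
    (solve 4 (λ x y u v → (y :- x) :+ (v :- u) := (y :+ v) :- (x :+ u)) ≈-refl x y u v)

  neg-antimono-≤ : ∀ {x y} → x ≤ y → - y ≤ - x
  neg-antimono-≤ {x} {y} x≤y = by-slack (slack x≤y)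
    (solve 2 (λ x y → y :- x := (:- x) :- (:- y)) ≈-refl x y)

  *-monoʳ-≤ : ∀ {x y z} → 0# ≤ z → x ≤ y → z * x ≤ z * y
  *-monoʳ-≤ {x} {y} {z} 0≤z x≤y = by-slack (0≤z ⊛ slack x≤y)
    (solve 3 (λ x y z → z :* (y :- x) := z :* y :- z :* x) ≈-refl x y z)

  *-mono-≤ : ∀ {x y u v} → 0# ≤ x → 0# ≤ u → x ≤ y → u ≤ v → x * u ≤ y * v
  *-mono-≤ {x} {y} {u} {v} 0≤x 0≤u x≤y u≤v =
    by-slack (slack x≤y ⊛ 0≤u ⊕ (≤-trans 0≤x x≤y) ⊛ slack u≤v)
    (solve 4 (λ x y u v → (y :- x) :* u :+ y :* (v :- u) := (y :* v) :- (x :* u)) ≈-refl x y u v)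

  infix 4 ∣_∣≤_
  -- The abstract ring has no absolute value; a pair of inequalities also feeds directly into slack
  -- certificates.
  ∣_∣≤_ : Carrier → Carrier → Set
  ∣ x ∣≤ y = x ≤ y × - x ≤ y

  ∣∣≤-resp : ∀ {x x′ y y′} → x ≈ x′ → y ≤ y′ → ∣ x ∣≤ y → ∣ x′ ∣≤ y′
  ∣∣≤-resp x≈x′ y≤y′ (x≤y , -x≤y) =
      ≤-trans (≤-resp x≈x′ ≈-refl x≤y) y≤y′
    , ≤-trans (≤-resp (-‿cong x≈x′) ≈-refl -x≤y) y≤y′

  ∣x+y∣≤ : ∀ {x y u v} → ∣ x ∣≤ u → ∣ y ∣≤ v → ∣ x + y ∣≤ u + v
  ∣x+y∣≤ {x} {y} (x≤u , -x≤u) (y≤v , -y≤v) =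
      +-mono-≤ x≤u y≤v
    , ≤-resp (solve 2 (λ x y → (:- x) :+ (:- y) := :- (x :+ y)) ≈-refl x y) ≈-refl
        (+-mono-≤ -x≤u -y≤v)

  ∣-x∣≤ : ∀ {x u} → ∣ x ∣≤ u → ∣ - x ∣≤ u
  ∣-x∣≤ {x} (x≤u , -x≤u) = -x≤u , ≤-resp (solve 1 (λ x → x := :- (:- x)) ≈-refl x) ≈-refl x≤u

  -- The slack `u v - x y` is half of `(u - x)(v + y) + (u + x)(v - y)`, and similarly for the other
  -- sign, so no case distinction on signs arises.
  ∣x*y∣≤ : ∀ {x y u v} → ∣ x ∣≤ u → ∣ y ∣≤ v → ∣ x * y ∣≤ u * v
  ∣x*y∣≤ {x} {y} {u} {v} X@(x≤u , -x≤u) Y@(y≤v , -y≤v) =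
      by-slack (0≤fromℚ ½ ⊛ (slack x≤u ⊛ slack -y≤v ⊕ slack -x≤u ⊛ slack y≤v))
        (solve 4 (λ x y u v → con ½ :* ((u :- x) :* (v :- :- y) :+ (u :- :- x) :* (v :- y))
                  := u :* v :- x :* y) ≈-refl x y u v)
    , by-slack (0≤fromℚ ½ ⊛ (slack x≤u ⊛ slack y≤v ⊕ slack -x≤u ⊛ slack -y≤v))
        (solve 4 (λ x y u v → con ½ :* ((u :- x) :* (v :- y) :+ (u :- :- x) :* (v :- :- y))
                  := u :* v :- :- (x :* y)) ≈-refl x y u v)

-- The rationals as an ordered ring, and geometrically decreasing tails

p≤∣↥p∣ : ∀ p → p ℚ.≤ toℚ (+ ℤ.∣ ℚ.↥ p ∣)
p≤∣↥p∣ p@record{} = subst (ℚ._≤ toℚ (+ ℤ.∣ ℚ.↥ p ∣)) (ℚₚ.fromℚᵘ-toℚᵘ p)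
  (fromℚᵘ-mono-≤ {ℚ.toℚᵘ p} {mkℚᵘ (+ ℤ.∣ ℚ.↥ p ∣) 0} (*≤* (bound (ℚ.↥ p) (ℚ.denominator-1 p))))
  where
  bound : ∀ n d → n ℤ.* 1ℤ ℤ.≤ + ℤ.∣ n ∣ ℤ.* + suc d
  bound (+ n) d = subst₂ ℤ._≤_ (ℤₚ.pos-* n 1) (ℤₚ.pos-* n (suc d))
    (ℤ.+≤+ (ℕₚ.*-monoʳ-≤ n (ℕ.s≤s ℕ.z≤n)))
  bound -[1+ n ] d = ℤ.-≤+

-- The numerator of a positive fraction is at least 1, so the reciprocal of its own denominator is a
-- lower bound.
1/n≤p : ∀ p → 0ℚ ℚ.< p → ∃[ n ] (1ℤ ℚ./ suc n) ℚ.≤ p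
1/n≤p p@record{} 0<p = ℚ.denominator-1 p , subst ((1ℤ ℚ./ suc (ℚ.denominator-1 p)) ℚ.≤_) (ℚₚ.fromℚᵘ-toℚᵘ p)
  (fromℚᵘ-mono-≤ {mkℚᵘ 1ℤ (ℚ.denominator-1 p)} {ℚ.toℚᵘ p} (*≤* (ℤₚ.*-monoʳ-≤-nonNeg (ℚ.↧ p) (1≤↥ (ℚ.↥ p) (ℚₚ.drop-*<* 0<p)))))
  where
  1≤↥ : ∀ n → 0ℤ ℤ.* ℚ.↧ p ℤ.< n ℤ.* 1ℤ → 1ℤ ℤ.≤ n
  1≤↥ n 0<n = ℤₚ.i<j⇒suc[i]≤j (subst (0ℤ ℤ.<_) (ℤₚ.*-identityʳ n) 0<n)

ℚ-≤-limit : ∀ {p q} → (∀ n → p ℚ.≤ q ℚ.+ (1ℤ ℚ./ suc n)) → p ℚ.≤ q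
ℚ-≤-limit {p} {q} bound with p ℚₚ.≤? q
... | yes p≤q = p≤q
... | no  p≰q = contradiction (ℚₚ.<-≤-trans (ℚₚ.<-≤-trans q+g<p (bound n)) (ℚₚ.+-monoʳ-≤ q 1/n≤g)) (ℚₚ.<-irrefl refl)
  where
  open ℚ-Solver.+-*-Solver
  g = ½ ℚ.* (p ℚ.- q)
  0<p-q : 0ℚ ℚ.< p ℚ.- q
  0<p-q = subst (ℚ._< p ℚ.- q) (ℚₚ.+-inverseʳ q) (ℚₚ.+-monoˡ-< (ℚ.- q) (ℚₚ.≰⇒> p≰q))
  0<g : 0ℚ ℚ.< g
  0<g = ℚₚ.*-monoʳ-<-pos ½ 0<p-q
  n = proj₁ (1/n≤p g 0<g)
  1/n≤g = proj₂ (1/n≤p g 0<g)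
  q+g<p : q ℚ.+ g ℚ.< p
  q+g<p = subst (q ℚ.+ g ℚ.<_) (solve 2 (λ p q → (q :+ con ½ :* (p :- q)) :+ con ½ :* (p :- q) := p) refl p q)
    (subst (ℚ._< (q ℚ.+ g) ℚ.+ g) (ℚₚ.+-identityʳ (q ℚ.+ g)) (ℚₚ.+-monoʳ-< (q ℚ.+ g) 0<g))

ℚ-orderedRing : OrderedRing
ℚ-orderedRing = record
  { commutativeRing = ℚₚ.+-*-commutativeRing
  ; _≤_             = ℚ._≤_
  ; ≤-reflexive     = ℚₚ.≤-reflexive
  ; ≤-trans         = ℚₚ.≤-trans
  ; ≤-antisym       = ℚₚ.≤-antisym
  ; ≤-total         = ℚₚ.≤-total
  ; +-monoˡ-≤       = ℚₚ.+-monoˡ-≤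
  ; *-nonNeg        = λ {x} {y} 0≤x 0≤y → ℚₚ.nonNegative⁻¹ (x ℚ.* y)
      {{ℚₚ.nonNeg*nonNeg⇒nonNeg x {{ℚ.nonNegative 0≤x}} y {{ℚ.nonNegative 0≤y}}}}
  ; fromℚ           = λ p → p
  ; fromℚ-homo-+    = λ _ _ → refl
  ; fromℚ-homo-*    = λ _ _ → refl
  ; fromℚ-homo--    = λ _ → refl
  ; fromℚ-homo-0    = refl
  ; fromℚ-homo-1    = refl
  ; fromℚ-mono      = λ p≤q → p≤q
  ; fromℚ-cancel    = λ p≤q → p≤q
  ; ≤-limit         = ℚ-≤-limit
  ; archimedean     = λ p → ℤ.∣ ℚ.↥ p ∣ , p≤∣↥p∣ p
  }

module Q = OrderedRingProperties ℚ-orderedRing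

½^-nonNeg : ∀ n → 0ℚ ℚ.≤ ½^ n
½^-nonNeg zero    = ℚₚ.nonNegative⁻¹ 1ℚ
½^-nonNeg (suc n) = Q.*-nonNeg (ℚₚ.nonNegative⁻¹ ½) (½^-nonNeg n)

½^-≤1 : ∀ n → ½^ n ℚ.≤ 1ℚ
½^-≤1 zero    = ℚₚ.≤-refl
½^-≤1 (suc n) = Q.by-slack (Q.0≤fromℚ ½ Q.⊛ Q.slack (½^-≤1 n) Q.⊕ Q.0≤fromℚ ½)
  (Q.solve 1 (λ h → Q.con ½ Q.:* (Q.con 1ℚ Q.:- h) Q.:+ Q.con ½ Q.:= Q.con 1ℚ Q.:- Q.con ½ Q.:* h) refl (½^ n))

½^-antitone : ∀ {m n} → m ℕ.≤ n → ½^ n ℚ.≤ ½^ m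
½^-antitone {m} {n} m≤n = subst₂ ℚ._≤_
  (trans (sym (½^-+ m (n ℕ.∸ m))) (cong ½^ (ℕₚ.m+[n∸m]≡n m≤n))) (ℚₚ.*-identityʳ (½^ m))
  (Q.*-monoʳ-≤ (½^-nonNeg m) (½^-≤1 (n ℕ.∸ m)))

-- The bound telescopes because f n ≤ 2 f n - 2 f (n + 1).
halving-tail : ∀ (s f : ℕ → ℚ) N →
  (∀ i → N ℕ.≤ i → Q.∣ s (suc i) ℚ.- s i ∣≤ f i) →
  (∀ i → N ℕ.≤ i → f (suc i) ℚ.≤ ½ ℚ.* f i) →
  ∀ r → Q.∣ s (r ℕ.+ N) ℚ.- s N ∣≤ (toℚ (+ 2) ℚ.* f N ℚ.- toℚ (+ 2) ℚ.* f (r ℕ.+ N))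
halving-tail s f N step halves zero =
  Q.∣∣≤-resp {0ℚ} {s N ℚ.- s N} {0ℚ} {toℚ (+ 2) ℚ.* f N ℚ.- toℚ (+ 2) ℚ.* f N}
    (sym (ℚₚ.+-inverseʳ (s N))) (ℚₚ.≤-reflexive (sym (ℚₚ.+-inverseʳ (toℚ (+ 2) ℚ.* f N))))
    (ℚₚ.≤-refl , ℚₚ.≤-refl)
halving-tail s f N step halves (suc r) = Q.∣∣≤-resp
  (solve 3 (λ a b c → (a :- b) :+ (b :- c) := a :- c) refl (s (suc n)) (s n) (s N))
  (Q.by-slack {s = toℚ (+ 2) ℚ.* (½ ℚ.* f n ℚ.- f (suc n))}
    (Q.0≤fromℚ (toℚ (+ 2)) Q.⊛ Q.slack (halves n (ℕₚ.m≤n+m N r)))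
    (solve 3 (λ a b c → con (toℚ (+ 2)) :* (con ½ :* b :- c)
       := (con (toℚ (+ 2)) :* a :- con (toℚ (+ 2)) :* c)
          :- (b :+ (con (toℚ (+ 2)) :* a :- con (toℚ (+ 2)) :* b)))
      refl (f N) (f n) (f (suc n))))
  (Q.∣x+y∣≤ (step n (ℕₚ.m≤n+m N r)) (halving-tail s f N step halves r))
  where
  open Q using (solve; con; _:+_; _:*_; _:-_; _:=_)
  n = r ℕ.+ N

-- Linear dependence of integer points

tail-independent : ∀ {d n} (v : Vector (Vector ℤ d) (suc n)) →
                   LinearlyIndependentℤ v → LinearlyIndependentℤ (v ∘ Fin.suc)
tail-independent v ind c zero-sum l = ind (0ℤ ∷ c)
  (λ i → trans (ℤₚ.+-identityˡ (ℤ-sum (λ m → c m ℤ.* v (Fin.suc m) i))) (zero-sum i)) (Fin.suc l)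

standard-basis-independent : ∀ {n} → LinearlyIndependentℤ {n} δ
standard-basis-independent c zero-sum l = trans (sym (ℤ-sum-δ c l)) (zero-sum l)

relation⇒dependent : ∀ {d n} (v : Vector (Vector ℤ d) n) (c : Vector ℤ n) l → c l ≢ 0ℤ →
                     (∀ i → ℤ-sum (λ l → c l ℤ.* v l i) ≡ 0ℤ) → ¬ LinearlyIndependentℤ v
relation⇒dependent v c l cl≢0 zero-sum ind = cl≢0 (ind c zero-sum l)

zero-dependent : ∀ {d n} (v : Vector (Vector ℤ d) (suc n)) → (∀ i → v 0F i ≡ 0ℤ) →
                 ¬ LinearlyIndependentℤ v
zero-dependent {n = n} v v₀≡0 = relation⇒dependent v (λ l → δ 0F l) 0F (λ ()) λ i →
  trans (cong₂ ℤ._+_ (cong (1ℤ ℤ.*_) (v₀≡0 i)) (sum-0* (λ l → v (Fin.suc l) i))) refl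
  where
  sum-0* : ∀ {n} (c : Vector ℤ n) → ℤ-sum (λ l → 0ℤ ℤ.* c l) ≡ 0ℤ
  sum-0* {zero}  c = refl
  sum-0* {suc n} c = trans (ℤₚ.+-identityˡ _) (sum-0* (c ∘ Fin.suc))

-- Two points (x , y) and (x′ , y′) satisfy the relation with coefficients
-- x′ and - x, which is nontrivial unless both have first coordinate 0.
minors-vanish⇒dependent : ∀ {d} (v : Vector (Vector ℤ (suc d)) 2) →
  (∀ i → v 1F 0F ℤ.* v 0F (Fin.suc i)
         ≡ v 0F 0F ℤ.* v 1F (Fin.suc i)) →
  (v 0F 0F ≡ 0ℤ → ∀ i → v 0F (Fin.suc i) ≡ 0ℤ) →
  ¬ LinearlyIndependentℤ v
minors-vanish⇒dependent v minors x≡0⇒y≡0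
  with v 0F 0F ℤₚ.≟ 0ℤ
... | yes x≡0 = zero-dependent v λ
  { 0F    → x≡0
  ; (Fin.suc i) → x≡0⇒y≡0 x≡0 i }
... | no  x≢0 = relation⇒dependent v (x′ ∷ ℤ.- x ∷ []) 1F -x≢0 λ
  { 0F    → solve 2 (λ x x′ → x′ :* x :+ ((:- x) :* x′ :+ con 0ℤ) := con 0ℤ) refl x x′
  ; (Fin.suc i) → trans
      (solve 3 (λ a x b → a :+ ((:- x) :* b :+ con 0ℤ) := a :- x :* b) refl
        (x′ ℤ.* v 0F (Fin.suc i)) x (v 1F (Fin.suc i)))
      (ℤₚ.i≡j⇒i-j≡0 (minors i)) }
  where
  open ℤ-Solver.+-*-Solver
  x  = v 0F 0F
  x′ = v 1F 0F
  -x≢0 : ℤ.- x ≢ 0ℤ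
  -x≢0 -x≡0 = x≢0 (trans (sym (ℤₚ.neg-involutive x)) (cong ℤ.-_ -x≡0))

-- The cross product of `a` and `b` is orthogonal to both, and it settles the case where its last
-- entry `D₂` is nonzero. If `D₂` vanishes, `(-a₁, a₀, 0)` or `(-b₁, b₀, 0)` is orthogonal to both,
-- and if both of these have middle entry 0, the first unit vector is.
three-in-plane : (a b : Vector ℤ 3) → Σ (Vector ℤ 3) λ c → (∃[ l ] c l ≢ 0ℤ)
  × ℤ-sum (λ l → c l ℤ.* a l) ≡ 0ℤ × ℤ-sum (λ l → c l ℤ.* b l) ≡ 0ℤ
three-in-plane a b = cases
  where
  open ℤ-Solver.+-*-Solver
  a₀ = a 0F
  a₁ = a 1F
  a₂ = a 2F
  b₀ = b 0F
  b₁ = b 1F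
  b₂ = b 2F
  D₀ = a₁ ℤ.* b₂ ℤ.- a₂ ℤ.* b₁
  D₁ = a₂ ℤ.* b₀ ℤ.- a₀ ℤ.* b₂
  D₂ = a₀ ℤ.* b₁ ℤ.- a₁ ℤ.* b₀

  Goal = Σ (Vector ℤ 3) λ c → (∃[ l ] c l ≢ 0ℤ)
    × ℤ-sum (λ l → c l ℤ.* a l) ≡ 0ℤ × ℤ-sum (λ l → c l ℤ.* b l) ≡ 0ℤ

  nontrivial : D₂ ≢ 0ℤ → Goal
  nontrivial D₂≢0 = D₀ ∷ D₁ ∷ D₂ ∷ [] , (2F , D₂≢0)
    , solve 6 (λ a₀ a₁ a₂ b₀ b₁ b₂ →
        (a₁ :* b₂ :- a₂ :* b₁) :* a₀ :+ ((a₂ :* b₀ :- a₀ :* b₂) :* a₁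
          :+ ((a₀ :* b₁ :- a₁ :* b₀) :* a₂ :+ con 0ℤ)) := con 0ℤ) refl a₀ a₁ a₂ b₀ b₁ b₂
    , solve 6 (λ a₀ a₁ a₂ b₀ b₁ b₂ →
        (a₁ :* b₂ :- a₂ :* b₁) :* b₀ :+ ((a₂ :* b₀ :- a₀ :* b₂) :* b₁
          :+ ((a₀ :* b₁ :- a₁ :* b₀) :* b₂ :+ con 0ℤ)) := con 0ℤ) refl a₀ a₁ a₂ b₀ b₁ b₂

  first-zero : a₀ ≡ 0ℤ → b₀ ≡ 0ℤ → Goal
  first-zero a₀≡0 b₀≡0 = 1ℤ ∷ 0ℤ ∷ 0ℤ ∷ [] , (0F , λ ())
    , trans (solve 3 (λ x y z → con 1ℤ :* x :+ (con 0ℤ :* y :+ (con 0ℤ :* z :+ con 0ℤ)) := x) refl a₀ a₁ a₂) a₀≡0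
    , trans (solve 3 (λ x y z → con 1ℤ :* x :+ (con 0ℤ :* y :+ (con 0ℤ :* z :+ con 0ℤ)) := x) refl b₀ b₁ b₂) b₀≡0

  proportional : D₂ ≡ 0ℤ → a₀ ≢ 0ℤ → Goal
  proportional D₂≡0 a₀≢0 = ℤ.- a₁ ∷ a₀ ∷ 0ℤ ∷ [] , (1F , a₀≢0)
    , solve 3 (λ x y z → (:- y) :* x :+ (x :* y :+ (con 0ℤ :* z :+ con 0ℤ)) := con 0ℤ) refl a₀ a₁ a₂
    , trans (solve 5 (λ a₀ a₁ b₀ b₁ b₂ → (:- a₁) :* b₀ :+ (a₀ :* b₁ :+ (con 0ℤ :* b₂ :+ con 0ℤ))
              := a₀ :* b₁ :- a₁ :* b₀) refl a₀ a₁ b₀ b₁ b₂) D₂≡0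

  proportional′ : D₂ ≡ 0ℤ → b₀ ≢ 0ℤ → Goal
  proportional′ D₂≡0 b₀≢0 = ℤ.- b₁ ∷ b₀ ∷ 0ℤ ∷ [] , (1F , b₀≢0)
    , trans (solve 5 (λ a₀ a₁ a₂ b₀ b₁ → (:- b₁) :* a₀ :+ (b₀ :* a₁ :+ (con 0ℤ :* a₂ :+ con 0ℤ))
              := :- (a₀ :* b₁ :- a₁ :* b₀)) refl a₀ a₁ a₂ b₀ b₁) (cong ℤ.-_ D₂≡0)
    , solve 3 (λ x y z → (:- y) :* x :+ (x :* y :+ (con 0ℤ :* z :+ con 0ℤ)) := con 0ℤ) refl b₀ b₁ b₂

  cases : Goal
  cases with D₂ ℤₚ.≟ 0ℤ | a₀ ℤₚ.≟ 0ℤ | b₀ ℤₚ.≟ 0ℤ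
  ... | no  D₂≢0 | _        | _        = nontrivial D₂≢0
  ... | yes D₂≡0 | no  a₀≢0 | _        = proportional D₂≡0 a₀≢0
  ... | yes D₂≡0 | yes _    | no  b₀≢0 = proportional′ D₂≡0 b₀≢0
  ... | yes _    | yes a₀≡0 | yes b₀≡0 = first-zero a₀≡0 b₀≡0

-- Up to the factor `d`, all coordinates other than `i₀` are fixed multiples of the first, so the
-- points lie in a plane with coordinates `x` and `y` at `i₀`. A relation between three points in
-- these two coordinates extends to the others, because `d` can be cancelled.
plane⇒dependent : ∀ {k} d (p : Vector ℤ k) i₀ → d ≢ 0ℤ → (v : Vector (Vector ℤ (suc k)) 3) →
  (∀ l i → i ≢ i₀ → d ℤ.* v l (Fin.suc i) ≡ v l 0F ℤ.* p i) → ¬ LinearlyIndependentℤ v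
plane⇒dependent d p i₀ d≢0 v on-plane
  with three-in-plane (λ l → v l 0F) (λ l → v l (Fin.suc i₀))
... | c , (l , cl≢0) , zero-x , zero-y₀ = relation⇒dependent v c l cl≢0 zero-sum
  where
  open ℤ-Solver.+-*-Solver
  zero-y : ∀ i → i ≢ i₀ → ℤ-sum (λ l → c l ℤ.* v l (Fin.suc i)) ≡ 0ℤ
  zero-y i i≢i₀ = ℤₚ.*-cancelˡ-≡ d _ 0ℤ {{ℤ.≢-nonZero d≢0}} (begin
    d ℤ.* (c₀ ℤ.* y₀ ℤ.+ (c₁ ℤ.* y₁ ℤ.+ (c₂ ℤ.* y₂ ℤ.+ 0ℤ)))
      ≡⟨ solve 7 (λ d c₀ y₀ c₁ y₁ c₂ y₂ →
           d :* (c₀ :* y₀ :+ (c₁ :* y₁ :+ (c₂ :* y₂ :+ con 0ℤ)))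
           := c₀ :* (d :* y₀) :+ (c₁ :* (d :* y₁) :+ c₂ :* (d :* y₂))) refl d c₀ y₀ c₁ y₁ c₂ y₂ ⟩
    c₀ ℤ.* (d ℤ.* y₀) ℤ.+ (c₁ ℤ.* (d ℤ.* y₁) ℤ.+ c₂ ℤ.* (d ℤ.* y₂))
      ≡⟨ cong₂ ℤ._+_ (cong (c₀ ℤ.*_) (on-plane _ i i≢i₀))
          (cong₂ ℤ._+_ (cong (c₁ ℤ.*_) (on-plane _ i i≢i₀)) (cong (c₂ ℤ.*_) (on-plane _ i i≢i₀))) ⟩
    c₀ ℤ.* (x₀ ℤ.* p i) ℤ.+ (c₁ ℤ.* (x₁ ℤ.* p i) ℤ.+ c₂ ℤ.* (x₂ ℤ.* p i))
      ≡⟨ solve 7 (λ p c₀ x₀ c₁ x₁ c₂ x₂ →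
           c₀ :* (x₀ :* p) :+ (c₁ :* (x₁ :* p) :+ c₂ :* (x₂ :* p))
           := p :* (c₀ :* x₀ :+ (c₁ :* x₁ :+ (c₂ :* x₂ :+ con 0ℤ)))) refl (p i) c₀ x₀ c₁ x₁ c₂ x₂ ⟩
    p i ℤ.* ℤ-sum (λ l → c l ℤ.* v l 0F)
      ≡⟨ cong (p i ℤ.*_) zero-x ⟩
    p i ℤ.* 0ℤ
      ≡⟨ trans (ℤₚ.*-zeroʳ (p i)) (sym (ℤₚ.*-zeroʳ d)) ⟩
    d ℤ.* 0ℤ ∎)
    where
    open ≡-Reasoning
    l₁ = 1F
    l₂ = 2F
    c₀ = c 0F
    c₁ = c l₁
    c₂ = c l₂
    x₀ = v 0F 0F
    x₁ = v l₁ 0F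
    x₂ = v l₂ 0F
    y₀ = v 0F (Fin.suc i)
    y₁ = v l₁ (Fin.suc i)
    y₂ = v l₂ (Fin.suc i)
  zero-sum : ∀ i → ℤ-sum (λ l → c l ℤ.* v l i) ≡ 0ℤ
  zero-sum 0F = zero-x
  zero-sum (Fin.suc i) with i Finₚ.≟ i₀
  ... | yes refl = zero-y₀
  ... | no i≢i₀  = zero-y i i≢i₀

n!≥1 : ∀ n → 1 ℕ.≤ n !
n!≥1 zero    = ℕₚ.≤-refl
n!≥1 (suc n) = ℕₚ.≤-trans (n!≥1 n) (ℕₚ.m≤m+n (n !) (n ℕ.* n !))

n!≥n : ∀ n → n ℕ.≤ n !
n!≥n zero    = ℕ.z≤n
n!≥n (suc n) = subst (ℕ._≤ suc n !) (ℕₚ.*-identityʳ (suc n)) (ℕₚ.*-monoʳ-≤ (suc n) (n!≥1 n))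

-- The approximants

d ratio : ℕ → ℤ
d m     = + (2 ℕ.^ (m !))
ratio m = + (2 ℕ.^ (m ℕ.* m !))

d-suc : ∀ m → d (suc m) ≡ d m ℤ.* ratio m
d-suc m = trans (cong +_ (ℕₚ.^-distribˡ-+-* 2 (m !) (m ℕ.* m !))) (ℤₚ.pos-* (2 ℕ.^ (m !)) (2 ℕ.^ (m ℕ.* m !)))

d≢0 : ∀ m → d m ≢ 0ℤ
d≢0 m d≡0 = ℕₚ.<⇒≢ (ℕₚ.m^n>0 2 (m !)) (sym (ℤₚ.+-injective d≡0))

0≤δ : ∀ {n} (i j : Fin n) → 0ℤ ℤ.≤ δ i j
0≤δ 0F    0F    = ℤ.+≤+ ℕ.z≤n
0≤δ 0F    (Fin.suc _) = ℤₚ.≤-refl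
0≤δ (Fin.suc _) 0F    = ℤₚ.≤-refl
0≤δ (Fin.suc i) (Fin.suc j) = 0≤δ i j

δ≤1 : ∀ {n} (i j : Fin n) → δ i j ℤ.≤ 1ℤ
δ≤1 0F    0F    = ℤₚ.≤-refl
δ≤1 0F    (Fin.suc _) = ℤ.+≤+ ℕ.z≤n
δ≤1 (Fin.suc _) 0F    = ℤ.+≤+ ℕ.z≤n
δ≤1 (Fin.suc i) (Fin.suc j) = δ≤1 i j

d-cancelˡ : ∀ m {x y} → d m ℤ.* x ≡ d m ℤ.* y → x ≡ y
d-cancelˡ m = ℤₚ.*-cancelˡ-≡ (d m) _ _ {{ℤ.≢-nonZero (d≢0 m)}}

d-cancelʳ : ∀ m {x y} → x ℤ.* d m ≡ y ℤ.* d m → x ≡ y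
d-cancelʳ m = ℤₚ.*-cancelʳ-≡ _ _ (d m) {{ℤ.≢-nonZero (d≢0 m)}}

module Approximants (k : ℕ) .{{_ : ℕ.NonZero k}} where

  -- The partial sums of the ζᵢ over the denominators up to 2 ^ (m !),
  -- and their numerators over the common denominator 2 ^ (m !).
  σ : ℕ → Fin k → ℚ
  σ zero    i = 0ℚ
  σ (suc m) i = σ m i ℚ.+ toℚ (δ (m mod k) i) ℚ.* ½^ (suc m !)

  p : ℕ → Fin k → ℤ
  p zero    i = 0ℤ
  p (suc m) i = ratio m ℤ.* p m i ℤ.+ δ (m mod k) i

  -- Multiplying the recurrence of `σ` by `d (suc m)`, which is `d m` times `ratio m`, cancels the
  -- power of `½` in the new term and leaves the integer `δ`.
  p≡dσ : ∀ m i → toℚ (p m i) ≡ toℚ (d m) ℚ.* σ m i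
  p≡dσ zero i = refl
  p≡dσ (suc m) i = begin
    toℚ (ratio m ℤ.* p m i ℤ.+ e)
      ≡⟨ trans (toℚ-homo-+ (ratio m ℤ.* p m i) e) (cong (ℚ._+ toℚ e) (toℚ-homo-* (ratio m) (p m i))) ⟩
    r ℚ.* toℚ (p m i) ℚ.+ toℚ e
      ≡⟨ cong₂ (λ x y → r ℚ.* x ℚ.+ y) (p≡dσ m i)
          (trans (sym (ℚₚ.*-identityˡ (toℚ e))) (cong (ℚ._* toℚ e) (sym (2^*½^ (suc m !))))) ⟩
    r ℚ.* (toℚ (d m) ℚ.* σ m i) ℚ.+ (toℚ (d (suc m)) ℚ.* h) ℚ.* toℚ e
      ≡⟨ cong (λ x → r ℚ.* (toℚ (d m) ℚ.* σ m i) ℚ.+ (x ℚ.* h) ℚ.* toℚ e) d-suc′ ⟩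
    r ℚ.* (toℚ (d m) ℚ.* σ m i) ℚ.+ ((toℚ (d m) ℚ.* r) ℚ.* h) ℚ.* toℚ e
      ≡⟨ solve 5 (λ r d s h e → r :* (d :* s) :+ ((d :* r) :* h) :* e := (d :* r) :* (s :+ e :* h))
           refl r (toℚ (d m)) (σ m i) h (toℚ e) ⟩
    (toℚ (d m) ℚ.* r) ℚ.* (σ m i ℚ.+ toℚ e ℚ.* h)
      ≡⟨ cong (ℚ._* (σ m i ℚ.+ toℚ e ℚ.* h)) (sym d-suc′) ⟩
    toℚ (d (suc m)) ℚ.* σ (suc m) i ∎
    where
    open ≡-Reasoning
    open Q using (solve; con; _:+_; _:*_; _:-_; _:=_)
    e = δ (m mod k) i
    r = toℚ (ratio m)
    h = ½^ (suc m !)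
    d-suc′ : toℚ (d (suc m)) ≡ toℚ (d m) ℚ.* r
    d-suc′ = trans (cong toℚ (d-suc m)) (toℚ-homo-* (d m) (ratio m))

  -- This is the source of the exceptional coordinate: the new denominator is `q n j` with
  -- `m + 1 = (n - 1) k + j`, so it enters only coordinate `j - 1 = m mod k`.
  σ-skip : ∀ m i → m mod k ≢ i → σ (suc m) i ≡ σ m i
  σ-skip m i m≢i = trans
    (cong (λ e → σ m i ℚ.+ toℚ e ℚ.* ½^ (suc m !)) (δ-≢ m≢i))
    (trans (cong (σ m i ℚ.+_) (ℚₚ.*-zeroˡ (½^ (suc m !)))) (ℚₚ.+-identityʳ (σ m i)))

  private
    0≤step : ∀ m i → 0ℚ ℚ.≤ toℚ (δ (m mod k) i) ℚ.* ½^ (suc m !)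
    0≤step m i = Q.*-nonNeg (toℚ-mono-≤ (0≤δ (m mod k) i)) (½^-nonNeg (suc m !))

    step≤ : ∀ m i → toℚ (δ (m mod k) i) ℚ.* ½^ (suc m !) ℚ.≤ ½^ (suc m !)
    step≤ m i = subst (toℚ (δ (m mod k) i) ℚ.* ½^ (suc m !) ℚ.≤_) (ℚₚ.*-identityˡ (½^ (suc m !)))
      (Q.*-mono-≤ (toℚ-mono-≤ (0≤δ (m mod k) i)) (½^-nonNeg (suc m !))
        (toℚ-mono-≤ (δ≤1 (m mod k) i)) ℚₚ.≤-refl)

    halves : ∀ m → ½^ (suc (suc m) !) ℚ.≤ ½ ℚ.* ½^ (suc m !)
    halves m = ½^-antitone {suc (suc m !)} {suc (suc m) !}
      (subst (ℕ._≤ suc (suc m) !) (ℕₚ.+-comm (suc m !) 1)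
        (ℕₚ.+-monoʳ-≤ (suc m !) (ℕₚ.*-mono-≤ {1} {suc m} (ℕ.s≤s ℕ.z≤n) (n!≥1 (suc m)))))

  σ-mono : ∀ m r i → σ m i ℚ.≤ σ (r ℕ.+ m) i
  σ-mono m zero    i = ℚₚ.≤-refl
  σ-mono m (suc r) i = ℚₚ.≤-trans (σ-mono m r i)
    (subst (ℚ._≤ σ (suc r ℕ.+ m) i) (ℚₚ.+-identityʳ (σ (r ℕ.+ m) i))
      (ℚₚ.+-monoʳ-≤ (σ (r ℕ.+ m) i) (0≤step (r ℕ.+ m) i)))

  -- The new terms, bounded by `½^ (suc n !)` whichever coordinate they fall in, at least halve from
  -- each to the next, so they add up to at most twice the first bound.
  σ-tail : ∀ m r i → σ (r ℕ.+ m) i ℚ.≤ σ m i ℚ.+ toℚ (+ 2) ℚ.* ½^ (suc m !)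
  σ-tail m r i = Q.by-slack
    (Q.slack (proj₁ (halving-tail (λ n → σ n i) (λ n → ½^ (suc n !)) m
        (λ n _ → Q.∣∣≤-resp
          (solve 2 (λ s e → e := (s :+ e) :- s) refl (σ n i) (toℚ (δ (n mod k) i) ℚ.* ½^ (suc n !)))
          ℚₚ.≤-refl (step≤ n i , ℚₚ.≤-trans (Q.neg-antimono-≤ (0≤step n i)) (½^-nonNeg (suc n !))))
        (λ n _ → halves n) r))
      Q.⊕ Q.0≤fromℚ (toℚ (+ 2)) Q.⊛ ½^-nonNeg (suc (r ℕ.+ m) !))
    (solve 4 (λ a b e f → ((con (toℚ (+ 2)) :* e :- con (toℚ (+ 2)) :* f) :- (a :- b)) :+ con (toℚ (+ 2)) :* f
        := (b :+ con (toℚ (+ 2)) :* e) :- a) refl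
      (σ (r ℕ.+ m) i) (σ m i) (½^ (suc m !)) (½^ (suc (r ℕ.+ m) !)))
    where
    open Q using (solve; con; _:+_; _:*_; _:-_; _:=_)

  σ-mono-≤ : ∀ {m n} → m ℕ.≤ n → ∀ i → σ m i ℚ.≤ σ n i
  σ-mono-≤ {m} {n} m≤n i = subst (λ j → σ m i ℚ.≤ σ j i) (ℕₚ.m∸n+n≡m m≤n) (σ-mono m (n ∸ m) i)

  σ-tail-≤ : ∀ {m n} → m ℕ.≤ n → ∀ i → σ n i ℚ.≤ σ m i ℚ.+ toℚ (+ 2) ℚ.* ½^ (suc m !)
  σ-tail-≤ {m} {n} m≤n i =
    subst (λ j → σ j i ℚ.≤ σ m i ℚ.+ toℚ (+ 2) ℚ.* ½^ (suc m !)) (ℕₚ.m∸n+n≡m m≤n) (σ-tail m (n ∸ m) i)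

-- Exponentials and logarithms

record Exponential (R : OrderedRing) : Set where
  open OrderedRing R
  field
    exp        : Carrier → Carrier
    exp-cong   : ∀ {x y} → x ≈ y → exp x ≈ exp y
    exp-mono   : ∀ {x y} → x ≤ y → exp x ≤ exp y
    exp-nonNeg : ∀ x → 0# ≤ exp x
    exp-+      : ∀ x y → exp (x + y) ≈ exp x * exp y
    exp-0      : exp (fromℚ 0ℚ) ≈ fromℚ 1ℚ
    exp-near-0 : ∀ {x} → 0# ≤ x → x ≤ fromℚ ½ → exp x ≤ fromℚ 1ℚ + fromℚ (toℚ (+ 2)) * x
    log2       : Carrier
    exp-log2   : exp log2 ≈ fromℚ (toℚ (+ 2))

module RationalEmbedding (R : OrderedRing) where
  open OrderedRingProperties R public

  two three four eight : ℚ
  two   = toℚ (+ 2)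
  three = toℚ (+ 3)
  four  = toℚ (+ 4)
  eight = toℚ (+ 8)

  fromℤ : ℤ → Carrier
  fromℤ z = fromℚ (toℚ z)

  fromℕ : ℕ → Carrier
  fromℕ n = fromℤ (+ n)

  fromℤ-cong : ∀ {p q} → p ≡ q → fromℤ p ≈ fromℤ q
  fromℤ-cong refl = ≈-refl

  fromℤ-homo-+ : ∀ x y → fromℤ (x ℤ.+ y) ≈ fromℤ x + fromℤ y
  fromℤ-homo-+ x y = ≈-trans (fromℚ-cong (toℚ-homo-+ x y)) (fromℚ-homo-+ (toℚ x) (toℚ y))

  fromℤ-homo-* : ∀ x y → fromℤ (x ℤ.* y) ≈ fromℤ x * fromℤ y
  fromℤ-homo-* x y = ≈-trans (fromℚ-cong (toℚ-homo-* x y)) (fromℚ-homo-* (toℚ x) (toℚ y))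

  fromℕ-homo-* : ∀ m n → fromℕ (m ℕ.* n) ≈ fromℕ m * fromℕ n
  fromℕ-homo-* m n = ≈-trans (fromℚ-cong (toℚ-pos-* m n)) (fromℚ-homo-* (toℚ (+ m)) (toℚ (+ n)))

  fromℤ-homo-neg : ∀ x → fromℤ (ℤ.- x) ≈ - fromℤ x
  fromℤ-homo-neg x = ≈-trans (fromℚ-cong (toℚ-homo-neg x)) (fromℚ-homo-- (toℚ x))

  fromℤ-homo-- : ∀ x y → fromℤ (x ℤ.- y) ≈ fromℤ x - fromℤ y
  fromℤ-homo-- x y = ≈-trans (fromℤ-homo-+ x (ℤ.- y)) (+-cong ≈-refl (fromℤ-homo-neg y))

  fromℤ-mono : ∀ {x y} → x ℤ.≤ y → fromℤ x ≤ fromℤ y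
  fromℤ-mono x≤y = fromℚ-mono (toℚ-mono-≤ x≤y)

  fromℕ-mono : ∀ {m n} → m ℕ.≤ n → fromℕ m ≤ fromℕ n
  fromℕ-mono m≤n = fromℤ-mono (ℤ.+≤+ m≤n)

  fromℕ-nonNeg : ∀ n → 0# ≤ fromℕ n
  fromℕ-nonNeg n = ≤-resp fromℚ-homo-0 ≈-refl (fromℕ-mono {0} {n} ℕ.z≤n)

  fromℤ-small : ∀ z → ∣ fromℤ z ∣≤ fromℚ ½ → z ≡ 0ℤ
  fromℤ-small z (z≤½ , -z≤½) = ℤₚ.≤-antisym (≤0 z z≤½)
    (subst (ℤ._≤ z) refl (subst (0ℤ ℤ.≤_) (ℤₚ.neg-involutive z) (ℤₚ.neg-mono-≤ -z≤0)))
    where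
    ≤0 : ∀ z → fromℤ z ≤ fromℚ ½ → z ℤ.≤ 0ℤ
    ≤0 z z≤½ with z ℤₚ.≤? 0ℤ
    ... | yes z≤0 = z≤0
    ... | no  z≰0 = contradiction
      (fromℚ-cancel {1ℚ} {½} (≤-trans (fromℤ-mono {1ℤ} {z} (ℤₚ.i<j⇒suc[i]≤j (ℤₚ.≰⇒> z≰0))) z≤½)) 1≰½
      where
      1≰½ : ¬ (1ℚ ℚ.≤ ½)
      1≰½ (ℚ.*≤* (ℤ.+≤+ (ℕ.s≤s ())))
    -z≤0 : ℤ.- z ℤ.≤ 0ℤ
    -z≤0 = ≤0 (ℤ.- z) (≤-resp (≈-sym (fromℤ-homo-neg z)) ≈-refl -z≤½)

  fromℤ-cancel : ∀ {x y} → fromℤ x ≤ fromℤ y → x ℤ.≤ y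
  fromℤ-cancel {x} {y} x≤y with x ℤₚ.≤? y
  ... | yes le = le
  ... | no  x≰y = contradiction (fromℚ-cancel {1ℚ} {0ℚ} (by-slack
      (slack (≤-trans (fromℤ-mono (ℤₚ.i<j⇒suc[i]≤j (ℤₚ.≰⇒> x≰y))) x≤y))
      (≈-trans (+-cong ≈-refl (-‿cong (fromℤ-homo-+ 1ℤ y)))
        (solve 1 (λ y → y :- (con 1ℚ :+ y) := con 0ℚ :- con 1ℚ) ≈-refl (fromℤ y)))))
    λ { (ℚ.*≤* (ℤ.+≤+ ())) }

  ∣fromℤ∣≤fromℕ : ∀ {x n} → ∣ fromℤ x ∣≤ fromℕ n → ℤ.∣ x ∣ ℕ.≤ n
  ∣fromℤ∣≤fromℕ {+ x}      (x≤n , _)  = ℤₚ.drop‿+≤+ (fromℤ-cancel x≤n)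
  ∣fromℤ∣≤fromℕ { -[1+ x ]} (_ , -x≤n) =
    ℤₚ.drop‿+≤+ (fromℤ-cancel (≤-resp (≈-sym (fromℤ-homo-neg -[1+ x ])) ≈-refl -x≤n))

  η : ℕ → Carrier
  η n = fromℚ (1ℤ ℚ./ suc n)

  η-inverse : ∀ n → η n * fromℕ (suc n) ≈ fromℚ 1ℚ
  η-inverse n = ≈-trans (≈-sym (fromℚ-homo-* (1ℤ ℚ./ suc n) (toℚ (+ suc n)))) (fromℚ-cong (1/n*n≡1 (suc n)))

  0≤η : ∀ n → 0# ≤ η n
  0≤η n = 0≤fromℚ (1ℤ ℚ./ suc n) {{ℚₚ.normalize-nonNeg 1 (suc n)}}

  η≤1 : ∀ n → η n ≤ fromℚ 1ℚ
  η≤1 n = ≤-resp (solve 1 (λ x → x :* con 1ℚ := x) ≈-refl (η n)) (η-inverse n)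
    (*-monoʳ-≤ (0≤η n) (fromℕ-mono {1} {suc n} (ℕ.s≤s ℕ.z≤n)))

  -- The successor of the index is `(C + 1)(N + 1)`, so multiplication by `C + 1` leaves
  -- `1 / (N + 1)`.
  η-product : ∀ C N → η (N ℕ.+ C ℕ.* suc N) * fromℕ (suc C) ≈ η N
  η-product C N = ≈-trans (solve 1 (λ x → x := x :* con 1ℚ) ≈-refl (η n * fromℕ (suc C)))
    (≈-trans (*-cong ≈-refl (≈-sym (η-inverse N)))
      (≈-trans (solve 4 (λ x c v s → x :* c :* (v :* s) := x :* (c :* s) :* v) ≈-refl
          (η n) (fromℕ (suc C)) (η N) (fromℕ (suc N)))
        (≈-trans (*-cong (*-cong ≈-refl (≈-sym (fromℕ-homo-* (suc C) (suc N)))) ≈-refl)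
          (≈-trans (*-cong (η-inverse n) ≈-refl) (solve 1 (λ x → con 1ℚ :* x := x) ≈-refl (η N))))))
    where
    n = N ℕ.+ C ℕ.* suc N

  ≤-limit-multiple : ∀ {x y} c n₀ → (∀ n → n₀ ℕ.≤ n → x ≤ y + η n * c) → x ≤ y
  ≤-limit-multiple {x} {y} c n₀ bound = let C , c≤C = archimedean c in ≤-limit λ N →
    -- The summand `C` absorbs the factor `c`, and `n₀` pushes `n` into the range where the
    -- hypothesis holds.
    let B = C ℕ.+ n₀
        n = N ℕ.+ B ℕ.* suc N
        n₀≤n = ℕₚ.≤-trans (ℕₚ.m≤n+m n₀ C) (ℕₚ.≤-trans (ℕₚ.≤-trans (ℕₚ.≤-reflexive (sym (ℕₚ.*-identityʳ B)))
                 (ℕₚ.*-monoʳ-≤ B (ℕ.s≤s ℕ.z≤n))) (ℕₚ.m≤n+m (B ℕ.* suc N) N))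
        c≤B = ≤-trans c≤C (fromℕ-mono (ℕₚ.≤-trans (ℕₚ.m≤m+n C n₀) (ℕₚ.n≤1+n B)))
    in ≤-trans (bound n n₀≤n) (+-mono-≤ (≤-refl {y}) (≤-resp ≈-refl (η-product B N) (*-monoʳ-≤ (0≤η n) c≤B)))

module ExponentialProperties (R : OrderedRing) (X : Exponential R) where
  open RationalEmbedding R public
  open Exponential X public

  exp-inverse : ∀ x → exp (- x) * exp x ≈ fromℚ 1ℚ
  exp-inverse x = ≈-trans (≈-sym (exp-+ (- x) x))
    (≈-trans (exp-cong (solve 1 (λ x → (:- x) :+ x := con 0ℚ) ≈-refl x)) exp-0)

  exp-multiple : ∀ n → exp (fromℕ n * log2) ≈ fromℕ (2 ℕ.^ n)
  exp-multiple zero = ≈-trans (exp-cong (solve 1 (λ x → con 0ℚ :* x := con 0ℚ) ≈-refl log2)) exp-0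
  exp-multiple (suc n) = ≈-trans
    (exp-cong (≈-trans (*-cong (fromℤ-homo-+ 1ℤ (+ n)) ≈-refl)
      (solve 2 (λ n x → (con 1ℚ :+ n) :* x := x :+ n :* x) ≈-refl (fromℕ n) log2)))
    (≈-trans (exp-+ log2 (fromℕ n * log2))
      (≈-trans (*-cong exp-log2 (exp-multiple n))
        (≈-trans (≈-sym (fromℤ-homo-* (+ 2) (+ (2 ℕ.^ n)))) (fromℤ-cong (sym (ℤₚ.pos-* 2 (2 ℕ.^ n)))))))

  exp-neg-multiple : ∀ n → exp (- (fromℕ n * log2)) ≈ fromℚ (½^ n)
  exp-neg-multiple n = ≈-trans (solve 1 (λ e → e := e :* con 1ℚ) ≈-refl e)
    (≈-trans (*-cong ≈-refl (≈-sym 2h≈1))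
      (≈-trans (solve 3 (λ e t h → e :* (t :* h) := (e :* t) :* h) ≈-refl e (fromℕ (2 ℕ.^ n)) h)
        (≈-trans (*-cong (≈-trans (*-cong ≈-refl (≈-sym (exp-multiple n))) (exp-inverse (fromℕ n * log2))) ≈-refl)
          (solve 1 (λ h → con 1ℚ :* h := h) ≈-refl h))))
    where
    e = exp (- (fromℕ n * log2))
    h = fromℚ (½^ n)
    2h≈1 : fromℕ (2 ℕ.^ n) * h ≈ fromℚ 1ℚ
    2h≈1 = ≈-trans (≈-sym (fromℚ-homo-* (toℚ (+ (2 ℕ.^ n))) (½^ n))) (fromℚ-cong (2^*½^ n))

  exp-≤½ : ∀ {x} → x ≤ - log2 → exp x ≤ fromℚ ½
  exp-≤½ x≤ = ≤-resp ≈-refl (≈-trans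
    (exp-cong (solve 1 (λ x → :- x := :- (con 1ℚ :* x)) ≈-refl log2)) (exp-neg-multiple 1)) (exp-mono x≤)

  exp-≤¼ : ∀ {x} → x ≤ - (fromℚ two * log2) → exp x ≤ fromℚ (½ ℚ.* ½)
  exp-≤¼ x≤ = ≤-resp ≈-refl (exp-neg-multiple 2) (exp-mono x≤)

  -- If `log 2 ≤ ½`, the linear bound near 0 gives `2 ≤ 1 + 2 log 2`, hence `log 2 ≥ ½` in this case
  -- too.
  log2≥½ : fromℚ ½ ≤ log2
  log2≥½ with ≤-total (fromℚ ½) log2
  ... | inj₁ ½≤ = ½≤
  ... | inj₂ log2≤½ = by-slack (0≤fromℚ ½ ⊛ slack (≤-resp exp-log2 ≈-refl (exp-near-0 0≤log2 log2≤½)))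
    (solve 1 (λ x → con ½ :* ((con 1ℚ :+ con two :* x) :- con two) := x :- con ½) ≈-refl log2)
    where
    0≤log2 : 0# ≤ log2
    0≤log2 with ≤-total 0# log2
    ... | inj₁ 0≤ = 0≤
    ... | inj₂ ≤0 = contradiction
      (fromℚ-cancel {two} {1ℚ} (≤-resp exp-log2 exp-0 (exp-mono (≤-resp ≈-refl (≈-sym fromℚ-homo-0) ≤0))))
      λ { (ℚ.*≤* (ℤ.+≤+ (ℕ.s≤s ()))) }

  0≤log2 : 0# ≤ log2
  0≤log2 = ≤-trans (0≤fromℚ ½) log2≥½

  -- A m is the logarithm of the denominator 2 ^ (m !).
  A : ℕ → Carrier
  A m = fromℕ (m !) * log2

  exp-A : ∀ m → exp (A m) ≈ fromℤ (d m)
  exp-A m = exp-multiple (m !)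

  A-suc : ∀ m → A (suc m) ≈ fromℕ (suc m) * A m
  A-suc m = ≈-trans (*-cong (fromℕ-homo-* (suc m) (m !)) ≈-refl)
    (*-assoc (fromℕ (suc m)) (fromℕ (m !)) log2)

  0≤A : ∀ m → 0# ≤ A m
  0≤A m = fromℕ-nonNeg (m !) ⊛ 0≤log2

  A-grows : ∀ c m → c ℕ.≤ suc m → fromℕ c * A m ≤ A (suc m)
  A-grows c m c≤ = ≤-resp ≈-refl (≈-sym (A-suc m))
    (by-slack (slack (fromℕ-mono c≤) ⊛ 0≤A m)
      (solve 3 (λ s c a → (s :- c) :* a := s :* a :- c :* a) ≈-refl (fromℕ (suc m)) (fromℕ c) (A m)))

  log2≤A : ∀ m → log2 ≤ A m
  log2≤A m = by-slack (slack (fromℕ-mono (n!≥1 m)) ⊛ 0≤log2)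
    (solve 2 (λ f x → (f :- con 1ℚ) :* x := f :* x :- x) ≈-refl (fromℕ (m !)) log2)

  -- With `x ≤ n` and `m = 2 n + 1 + M`, the bounds `m ! ≥ m` and `log 2 ≥ ½` give `A m ≥ n + ½`.
  -- The shift by `M` keeps the index in the range of any later largeness condition.
  A-unbounded : ∀ x M → ∃[ r ] x < A (suc (r ℕ.+ M))
  A-unbounded x M = let n , x≤n = archimedean x in n ℕ.+ n , x<A n x≤n
    where
    x<A : ∀ n → x ≤ fromℕ n → x < A (suc (n ℕ.+ n ℕ.+ M))
    x<A n x≤n A≤x = contradiction (fromℚ-cancel {½} {0ℚ} (by-slack
        (slack A≤x ⊕ slack x≤n ⊕ fromℕ-nonNeg (m !) ⊛ slack log2≥½
          ⊕ 0≤fromℚ ½ ⊛ slack (fromℕ-mono (ℕₚ.≤-trans (ℕ.s≤s (ℕₚ.m≤m+n (n ℕ.+ n) M)) (n!≥n m))))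
        (≈-trans (+-cong ≈-refl (*-cong ≈-refl (+-cong ≈-refl (-‿cong
            (≈-trans (fromℤ-homo-+ 1ℤ (+ (n ℕ.+ n))) (+-cong ≈-refl (fromℤ-homo-+ (+ n) (+ n))))))))
          (solve 4 (λ x n f g → (x :- f :* g) :+ (n :- x) :+ f :* (g :- con ½)
              :+ con ½ :* (f :- (con 1ℚ :+ (n :+ n))) := con 0ℚ :- con ½) ≈-refl x (fromℕ n) (fromℕ (m !)) log2))))
      λ { (ℚ.*≤* (ℤ.+≤+ ())) }
      where
      m = suc (n ℕ.+ n ℕ.+ M)

module LastIndex (lem : ExcludedMiddle 0ℓ) where
  -- Applied to `P` of the form "a multiple of `A` is at most `H`", this locates the scale `m` to
  -- which a given `l` belongs.
  last : ∀ (P : ℕ → Set) M r → P M → ¬ P (r ℕ.+ M) → ∃[ n ] (P (n ℕ.+ M) × ¬ P (suc (n ℕ.+ M)))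
  last P M zero    PM ¬P = contradiction PM ¬P
  last P M (suc r) PM ¬P with lem {P (r ℕ.+ M)}
  ... | yes Pr = r , Pr , ¬P
  ... | no ¬Pr = last P M r PM ¬Pr

-- Monotonicity and logarithms from the functional equation and completeness

record ExponentialFunction (R : OrderedRing) : Set where
  open OrderedRing R
  field
    exp        : Carrier → Carrier
    exp-cong   : ∀ {x y} → x ≈ y → exp x ≈ exp y
    exp-+      : ∀ x y → exp (x + y) ≈ exp x * exp y
    exp-0      : exp (fromℚ 0ℚ) ≈ fromℚ 1ℚ
    exp-≥      : ∀ {x} → 0# ≤ x → fromℚ 1ℚ + x ≤ exp x
    exp-near-0 : ∀ {x} → 0# ≤ x → x ≤ fromℚ ½ → exp x ≤ fromℚ 1ℚ + fromℚ (toℚ (+ 2)) * x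

-- Completeness in the form delivered by bisection. `P` need not be downward closed: the point found
-- merely lies in arbitrarily short brackets whose lower end satisfies `P` and whose upper end does
-- not. It provides both logarithms and successive minima.
Cuts : OrderedRing → Set₁
Cuts R = ∀ (P : ℚ → Set) a b → a ℚ.≤ b → P a → ¬ P b → Σ Carrier λ l →
  ∀ n → ∃[ p ] ∃[ q ] (P p × ¬ P q × fromℚ p ≤ l × l ≤ fromℚ q × q ℚ.≤ p ℚ.+ (1ℤ ℚ./ suc n))
  where open OrderedRing R

module Logarithm (R : OrderedRing) (F : ExponentialFunction R) where
  open RationalEmbedding R
  open ExponentialFunction F

  exp-inverse : ∀ x → exp (- x) * exp x ≈ fromℚ 1ℚ
  exp-inverse x = ≈-trans (≈-sym (exp-+ (- x) x))
    (≈-trans (exp-cong (solve 1 (λ x → (:- x) :+ x := con 0ℚ) ≈-refl x)) exp-0)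

  square-nonNeg : ∀ x → 0# ≤ x * x
  square-nonNeg x with ≤-total 0# x
  ... | inj₁ 0≤x = 0≤x ⊛ 0≤x
  ... | inj₂ x≤0 = ≤-resp ≈-refl (solve 1 (λ x → (:- x) :* (:- x) := x :* x) ≈-refl x) (0≤-x ⊛ 0≤-x)
    where
    0≤-x : 0# ≤ - x
    0≤-x = by-slack (slack x≤0) (≈-trans (+-cong (≈-sym fromℚ-homo-0) ≈-refl)
      (≈-trans (solve 1 (λ x → con 0ℚ :- x := :- x :- con 0ℚ) ≈-refl x) (+-cong ≈-refl (-‿cong fromℚ-homo-0))))

  exp-nonNeg : ∀ x → 0# ≤ exp x
  exp-nonNeg x = ≤-resp ≈-refl (≈-trans (≈-sym (exp-+ h h))
    (exp-cong (solve 1 (λ x → con ½ :* x :+ con ½ :* x := x) ≈-refl x))) (square-nonNeg (exp h))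
    where
    h = fromℚ ½ * x

  exp-mono : ∀ {x y} → x ≤ y → exp x ≤ exp y
  exp-mono {x} {y} x≤y = by-slack (exp-nonNeg x ⊛ (slack (exp-≥ (slack x≤y)) ⊕ slack x≤y))
    (≈-trans (solve 3 (λ e x d → e :* ((d :- (con 1ℚ :+ x)) :+ x) := e :* d :- e) ≈-refl (exp x) (y - x) (exp (y - x)))
      (+-cong (≈-trans (≈-sym (exp-+ x (y - x))) (exp-cong (solve 2 (λ x y → x :+ (y :- x) := y) ≈-refl x y))) ≈-refl))

  -- If `y ≤ x`, then `1 + (x - y) ≤ exp (x - y) = exp x * exp (- y)`, and `exp x ≤ exp y` makes the
  -- right side at most 1.
  exp-reflects-≤ : ∀ {x y} → exp x ≤ exp y → x ≤ y
  exp-reflects-≤ {x} {y} ex≤ey with ≤-total x y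
  ... | inj₁ x≤y = x≤y
  ... | inj₂ y≤x = by-slack (slack (exp-≥ (slack y≤x)) ⊕ exp-nonNeg (- y) ⊛ slack ex≤ey)
    (≈-trans (+-cong (+-cong exp-difference ≈-refl) ≈-refl)
      (≈-trans (solve 5 (λ e f g x y → (e :* f :- (con 1ℚ :+ (x :- y))) :+ f :* (g :- e) := (f :* g :- con 1ℚ) :+ (y :- x)) ≈-refl
          (exp x) (exp (- y)) (exp y) x y)
        (≈-trans (+-cong (+-cong (exp-inverse y) ≈-refl) ≈-refl) (solve 2 (λ x y → (con 1ℚ :- con 1ℚ) :+ (y :- x) := y :- x) ≈-refl x y))))
    where
    exp-difference : exp (x - y) ≈ exp x * exp (- y)
    exp-difference = exp-+ x (- y)

  exp-reflects-≈ : ∀ {x y} → exp x ≈ exp y → x ≈ y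
  exp-reflects-≈ ex≈ey = ≤-antisym (exp-reflects-≤ (≤-reflexive ex≈ey)) (exp-reflects-≤ (≤-reflexive (≈-sym ex≈ey)))

  exp-≤1 : ∀ {x} → x ≤ fromℚ 0ℚ → exp x ≤ fromℚ 1ℚ
  exp-≤1 x≤0 = ≤-resp ≈-refl exp-0 (exp-mono x≤0)

  1≤exp : ∀ {x} → 0# ≤ x → fromℚ 1ℚ ≤ exp x
  1≤exp 0≤x = ≤-resp exp-0 ≈-refl (exp-mono (≤-resp (≈-sym fromℚ-homo-0) ≈-refl 0≤x))

  exp-exceeds : ∀ y → ∃[ n ] (∀ {l} → fromℕ n < l → y < exp l × fromℚ 1ℚ < exp l)
  exp-exceeds y = let n , y≤n = archimedean y in n , λ {l} n<l →
    let 1+l≤el = slack (exp-≥ (≤-trans (fromℕ-nonNeg n) (<⇒≤ n<l)))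
    in (λ el≤y → n<l (by-slack (1+l≤el ⊕ slack el≤y ⊕ slack y≤n ⊕ 0≤fromℚ 1ℚ)
          (solve 4 (λ e l y n → (e :- (con 1ℚ :+ l)) :+ (y :- e) :+ (n :- y) :+ con 1ℚ := n :- l) ≈-refl (exp l) l y (fromℕ n))))
     , (λ el≤1 → n<l (by-slack (1+l≤el ⊕ slack el≤1 ⊕ fromℕ-nonNeg n)
          (solve 3 (λ e l n → (e :- (con 1ℚ :+ l)) :+ (con 1ℚ :- e) :+ n := n :- l) ≈-refl (exp l) l (fromℕ n))))

  -- On a bracket [p , q] of length at most 1 / (n + 1) with exp p ≤ Q the
  -- exponential varies by at most 2 Q / (n + 1).
  logarithm : Cuts R → ∀ Q → fromℚ 1ℚ ≤ Q → Σ Carrier λ l → exp l ≈ Q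
  logarithm cuts Q 1≤Q =
    let b , Q≤b = archimedean Q
        l , bracket = cuts (λ r → exp (fromℚ r) ≤ Q) 0ℚ (toℚ (+ b)) (0≤toℚ b)
          (≤-resp (≈-sym exp-0) ≈-refl 1≤Q) (exceeds b Q≤b)
    in l , ≤-antisym (proj₁ (near l bracket)) (proj₂ (near l bracket))
    where
    exceeds : ∀ b → Q ≤ fromℕ b → ¬ (exp (fromℕ b) ≤ Q)
    exceeds b Q≤b eb≤Q = contradiction (fromℚ-cancel {1ℚ} {0ℚ} (by-slack
        (slack (exp-≥ (fromℕ-nonNeg b)) ⊕ slack eb≤Q ⊕ slack Q≤b)
        (solve 3 (λ e b q → (e :- (con 1ℚ :+ b)) :+ (q :- e) :+ (b :- q) := con 0ℚ :- con 1ℚ) ≈-refl (exp (fromℕ b)) (fromℕ b) Q)))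
      λ { (ℚ.*≤* (ℤ.+≤+ ())) }
    c : Carrier
    c = fromℚ two * Q
    near : ∀ l → (∀ n → ∃[ p ] ∃[ q ] (exp (fromℚ p) ≤ Q × ¬ (exp (fromℚ q) ≤ Q) × fromℚ p ≤ l × l ≤ fromℚ q
      × q ℚ.≤ p ℚ.+ (1ℤ ℚ./ suc n))) → exp l ≤ Q × Q ≤ exp l
    -- Brackets are used from `n = 1` on, where their width is at most `½`, the range of
    -- `exp-near-0`.
    near l bracket = ≤-limit-multiple c 1 above , ≤-limit-multiple c 1 below
      where
      variation : ∀ n p q → 1 ℕ.≤ n → exp (fromℚ p) ≤ Q → fromℚ p ≤ fromℚ q → q ℚ.≤ p ℚ.+ (1ℤ ℚ./ suc n) →
                  exp (fromℚ q) ≤ exp (fromℚ p) + η n * c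
      variation n p q 1≤n ep≤Q p≤q q≤p+η =
        by-slack (exp-nonNeg (fromℚ p) ⊛ slack (exp-near-0 (slack p≤q) (≤-trans q-p≤η η≤½))
            ⊕ 0≤fromℚ two ⊛ (exp-nonNeg (fromℚ p) ⊛ slack q-p≤η) ⊕ 0≤fromℚ two ⊛ (0≤η n ⊛ slack ep≤Q))
          (≈-trans (solve 5 (λ e d x h Q → e :* ((con 1ℚ :+ con two :* x) :- d) :+ con two :* (e :* (h :- x)) :+ con two :* (h :* (Q :- e))
              := (e :+ h :* (con two :* Q)) :- e :* d) ≈-refl (exp (fromℚ p)) (exp (fromℚ q - fromℚ p)) (fromℚ q - fromℚ p) (η n) Q)
            (+-cong ≈-refl (-‿cong (≈-trans (≈-sym (exp-+ (fromℚ p) (fromℚ q - fromℚ p)))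
              (exp-cong (solve 2 (λ x y → x :+ (y :- x) := y) ≈-refl (fromℚ p) (fromℚ q)))))))
        where
        q-p≤η : fromℚ q - fromℚ p ≤ η n
        q-p≤η = by-slack (slack (≤-resp ≈-refl (fromℚ-homo-+ p (1ℤ ℚ./ suc n)) (fromℚ-mono q≤p+η)))
          (solve 3 (λ p q h → (p :+ h) :- q := h :- (q :- p)) ≈-refl (fromℚ p) (fromℚ q) (η n))
        η≤½ : η n ≤ fromℚ ½
        η≤½ = by-slack (0≤fromℚ ½ ⊛ (0≤η n ⊛ slack (fromℕ-mono (ℕ.s≤s 1≤n)) ⊕ slack (≤-reflexive (η-inverse n))))
          (solve 2 (λ h s → con ½ :* (h :* (s :- con two) :+ (con 1ℚ :- h :* s)) := con ½ :- h) ≈-refl (η n) (fromℕ (suc n)))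
      above : ∀ n → 1 ℕ.≤ n → exp l ≤ Q + η n * c
      above n 1≤n = let p , q , ep≤Q , _ , p≤l , l≤q , q≤p+η = bracket n in
        ≤-trans (exp-mono l≤q) (≤-trans (variation n p q 1≤n ep≤Q (≤-trans p≤l l≤q) q≤p+η) (+-mono-≤ ep≤Q ≤-refl))
      below : ∀ n → 1 ℕ.≤ n → Q ≤ exp l + η n * c
      below n 1≤n = let p , q , ep≤Q , ¬eq≤Q , p≤l , l≤q , q≤p+η = bracket n in
        ≤-trans (<⇒≤ ¬eq≤Q) (≤-trans (variation n p q 1≤n ep≤Q (≤-trans p≤l l≤q) q≤p+η) (+-mono-≤ (exp-mono p≤l) ≤-refl))

  exponential : Cuts R → Exponential R
  exponential cuts = record
    { exp = exp ; exp-cong = exp-cong ; exp-mono = exp-mono ; exp-nonNeg = exp-nonNeg ; exp-+ = exp-+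
    ; exp-0 = exp-0 ; exp-near-0 = exp-near-0
    ; log2 = proj₁ log2 ; exp-log2 = proj₂ log2 }
    where
    log2 = logarithm cuts (fromℚ two) (fromℚ-mono (toℚ-mono-≤ {1ℤ} {+ 2} (ℤ.+≤+ (ℕ.s≤s ℕ.z≤n))))

-- The value of `θ` at which the exponents `1 + θ` and `- κ + θ` are opposite, so that the two
-- bounds have product 1.
τℚ : (k : ℕ) .{{_ : ℕ.NonZero k}} → ℚ
τℚ k = ½ ℚ.* ((1ℤ ℚ./ k) ℚ.- 1ℚ)

-- Uniformity on boxes of integer points, and common denominators

uniform-ℤ : (P : ℤ → ℕ → Set) → (∀ x {m n} → m ℕ.≤ n → P x m → P x n) → (∀ x → ∃[ n ] P x n) →
            ∀ B → ∃[ n ] (∀ x → ℤ.∣ x ∣ ℕ.≤ B → P x n)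
uniform-ℤ P up ex zero = let n , Pn = ex 0ℤ in n , λ { (+ zero) _ → Pn }
uniform-ℤ P up ex (suc B) =
  let n₀ , P₀ = uniform-ℤ P up ex B
      n₁ , P₁ = ex (+ suc B)
      n₂ , P₂ = ex -[1+ B ]
  in n₀ ℕ.⊔ (n₁ ℕ.⊔ n₂) , λ x ∣x∣≤ → case x (ℕₚ.m≤n⇒m<n∨m≡n ∣x∣≤)
       (up x (ℕₚ.m≤m⊔n n₀ _) ∘ P₀ x)
       (up (+ suc B) (ℕₚ.≤-trans (ℕₚ.m≤m⊔n n₁ n₂) (ℕₚ.m≤n⊔m n₀ _)) P₁)
       (up -[1+ B ] (ℕₚ.≤-trans (ℕₚ.m≤n⊔m n₁ n₂) (ℕₚ.m≤n⊔m n₀ _)) P₂)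
  where
  case : ∀ {n} x → ℤ.∣ x ∣ ℕ.< suc B ⊎ ℤ.∣ x ∣ ≡ suc B →
         (ℤ.∣ x ∣ ℕ.≤ B → P x n) → P (+ suc B) n → P -[1+ B ] n → P x n
  case x        (inj₁ (ℕ.s≤s le)) small _ _ = small le
  case (+ _)    (inj₂ refl)       _ pos _   = pos
  case -[1+ _ ] (inj₂ refl)       _ _ neg   = neg

-- A box holds finitely many points, so the maximum of their indices serves for all; the induction
-- is on the dimension. Vectors are functions, and the first hypothesis on `P` lets a vector be
-- replaced by its reassembly from head and tail.
uniform : ∀ {d} (P : Vector ℤ d → ℕ → Set) → (∀ {v w} n → (∀ i → v i ≡ w i) → P v n → P w n) →
          (∀ v {m n} → m ℕ.≤ n → P v m → P v n) → (∀ v → ∃[ n ] P v n) →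
          ∀ B → ∃[ n ] (∀ v → (∀ i → ℤ.∣ v i ∣ ℕ.≤ B) → P v n)
uniform {zero} P resp up ex B = let n , Pn = ex [] in n , λ v _ → resp n (λ ()) Pn
uniform {suc d} P resp up ex B =
  let n , Pn = uniform-ℤ (λ x n → ∀ v → (∀ i → ℤ.∣ v i ∣ ℕ.≤ B) → P (x ∷ v) n)
        (λ x m≤n Pm v v≤ → up (x ∷ v) m≤n (Pm v v≤))
        (λ x → uniform (λ v → P (x ∷ v)) (λ n eq → resp n λ { 0F → refl ; (Fin.suc i) → eq i })
          (λ v → up (x ∷ v)) (λ v → ex (x ∷ v)) B) B
  in n , λ v v≤ → resp n (λ { 0F → refl ; (Fin.suc i) → refl })
       (Pn (v 0F) (v≤ 0F) (v ∘ Fin.suc) (v≤ ∘ Fin.suc))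

↧*p≡↥p : ∀ p → toℚ (ℚ.↧ p) ℚ.* p ≡ toℚ (ℚ.↥ p)
↧*p≡↥p p@record{} = trans (cong (toℚ (ℚ.↧ p) ℚ.*_) (sym (ℚₚ.fromℚᵘ-toℚᵘ p)))
  (trans (sym (fromℚᵘ-homo-* (mkℚᵘ (ℚ.↧ p) 0) (ℚ.toℚᵘ p)))
    (ℚₚ.fromℚᵘ-cong {mkℚᵘ (ℚ.↧ p) 0 ℚᵘ.* ℚ.toℚᵘ p} {mkℚᵘ (ℚ.↥ p) 0}
      (*≡* (trans (ℤₚ.*-identityʳ (ℚ.↧ p ℤ.* ℚ.↥ p)) (trans (ℤₚ.*-comm (ℚ.↧ p) (ℚ.↥ p))
        (cong (ℚ.↥ p ℤ.*_) (sym (ℤₚ.*-identityˡ (ℚ.↧ p)))))))))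

common-denominator : ∀ {n} (c : Vector ℚ n) →
  ∃[ D ] Σ (Vector ℤ n) λ C → ∀ i → toℚ (+ suc D) ℚ.* c i ≡ toℚ (C i)
common-denominator {zero}  c = 0 , [] , λ ()
common-denominator {suc n} c with c 0F in c₀≡ | common-denominator (c ∘ Fin.suc)
... | c₀ | D , C , DC = ℕ.pred (suc e ℕ.* suc D) , (ℚ.↥ c₀ ℤ.* + suc D ∷ λ i → ℚ.↧ c₀ ℤ.* C i) , λ
  { 0F → begin
      toℚ (+ (suc e ℕ.* suc D)) ℚ.* c 0F  ≡⟨ cong₂ ℚ._*_ split c₀≡ ⟩
      (a ℚ.* b) ℚ.* c₀                         ≡⟨ solveℚ 3 (λ a b c → (a :*′ b) :*′ c :=′ (a :*′ c) :*′ b) refl a b c₀ ⟩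
      (a ℚ.* c₀) ℚ.* b                         ≡⟨ cong (ℚ._* b) (↧*p≡↥p c₀) ⟩
      toℚ (ℚ.↥ c₀) ℚ.* b                       ≡⟨ sym (toℚ-homo-* (ℚ.↥ c₀) (+ suc D)) ⟩
      toℚ (ℚ.↥ c₀ ℤ.* + suc D)                 ∎
  ; (Fin.suc i) → begin
      toℚ (+ (suc e ℕ.* suc D)) ℚ.* c (Fin.suc i)  ≡⟨ cong (ℚ._* c (Fin.suc i)) split ⟩
      (a ℚ.* b) ℚ.* c (Fin.suc i)                 ≡⟨ ℚₚ.*-assoc a b (c (Fin.suc i)) ⟩
      a ℚ.* (b ℚ.* c (Fin.suc i))                 ≡⟨ cong (a ℚ.*_) (DC i) ⟩
      a ℚ.* toℚ (C i)                             ≡⟨ sym (toℚ-homo-* (ℚ.↧ c₀) (C i)) ⟩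
      toℚ (ℚ.↧ c₀ ℤ.* C i)                        ∎ }
  where
  open ≡-Reasoning
  open Q.Solver using () renaming (solve to solveℚ; _:*_ to _:*′_; _:=_ to _:=′_)
  e = ℚ.denominator-1 c₀
  a = toℚ (ℚ.↧ c₀)
  b = toℚ (+ suc D)
  split : toℚ (+ (suc e ℕ.* suc D)) ≡ a ℚ.* b
  split = toℚ-pos-* (suc e) (suc D)

-- Successive minima

record Setting : Set₁ where
  field
    R   : OrderedRing
    X   : Exponential R
    k-1 : ℕ

  k : ℕ
  k = suc k-1

  open OrderedRing R using (Carrier; _≤_; fromℚ)
  field
    -- The estimates see `ζ` only through these two-sided bounds by partial sums.
    ζ       : Vector Carrier k
    ζ-lower : ∀ m i → fromℚ (Approximants.σ k m i) ≤ ζ i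
    ζ-upper : ∀ m i → ζ i ≤ fromℚ (Approximants.σ k m i ℚ.+ toℚ (+ 2) ℚ.* ½^ (suc m !))
    lem     : ExcludedMiddle 0ℓ

module Approximation (setting : Setting) where
  open Setting setting using (R; X; k; ζ; ζ-lower; ζ-upper; lem)
  open ExponentialProperties R X public
  open Approximants k public
  open LastIndex lem
  open ℤ-Solver.+-*-Solver using ()
    renaming (solve to solveℤ; _:=_ to _:=′_; _:+_ to _:+′_; _:*_ to _:*′_; _:-_ to _:-′_; con to con′)

  κ : Carrier
  κ = fromℚ (1ℤ ℚ./ k)

  -- The system of the theorem with `l = log Q`, so that a power of `Q` is `exp` of a multiple of
  -- `l`.
  Solution : Carrier → Carrier → Vector ℤ (suc k) → Set
  Solution l θ w =
      ∣ fromℤ (w 0F) ∣≤ exp ((fromℚ 1ℚ + θ) * l)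
    × (∀ i → ∣ ζ i * fromℤ (w 0F) - fromℤ (w (Fin.suc i)) ∣≤ exp ((- κ + θ) * l))

  IndependentSolutions : ℕ → Carrier → Carrier → Set
  IndependentSolutions j l θ =
    Σ (Vector (Vector ℤ (suc k)) j) λ v → LinearlyIndependentℤ v × (∀ i → Solution l θ (v i))

  solution-mono : ∀ {l θ θ′} w → 0# ≤ l → θ ≤ θ′ → Solution l θ w → Solution l θ′ w
  solution-mono {l} {θ} {θ′} w 0≤l θ≤θ′ (bx , by) =
      ∣∣≤-resp ≈-refl (exp-mono (mono (fromℚ 1ℚ))) bx
    , λ i → ∣∣≤-resp ≈-refl (exp-mono (mono (- κ))) (by i)
    where
    mono : ∀ c → (c + θ) * l ≤ (c + θ′) * l
    mono c = by-slack (slack θ≤θ′ ⊛ 0≤l)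
      (solve 4 (λ c θ θ′ l → (θ′ :- θ) :* l := (c :+ θ′) :* l :- (c :+ θ) :* l) ≈-refl c θ θ′ l)

  independent-mono : ∀ {j l θ θ′} → 0# ≤ l → θ ≤ θ′ →
                     IndependentSolutions j l θ → IndependentSolutions j l θ′
  independent-mono 0≤l θ≤θ′ (v , ind , sol) = v , ind , λ i → solution-mono (v i) 0≤l θ≤θ′ (sol i)

  fewer-solutions : ∀ {i j l θ} → i ℕ.≤ j → IndependentSolutions j l θ → IndependentSolutions i l θ
  fewer-solutions {i} {j} {l} {θ} i≤j sols =
    drop (j ℕ.∸ i) (subst (λ n → IndependentSolutions n l θ) (sym (ℕₚ.m∸n+n≡m i≤j)) sols)
    where
    drop : ∀ r → IndependentSolutions (r ℕ.+ i) l θ → IndependentSolutions i l θ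
    drop zero    sols             = sols
    drop (suc r) (v , ind , sol) = drop r (v ∘ Fin.suc , tail-independent v ind , sol ∘ Fin.suc)

  error : ℕ → Fin k → Carrier
  error m i = ζ i * fromℤ (d m) - fromℤ (p m i)

  private
    fromℤ-p : ∀ m i → fromℤ (p m i) ≈ fromℤ (d m) * fromℚ (σ m i)
    fromℤ-p m i = ≈-trans (fromℚ-cong (p≡dσ m i)) (fromℚ-homo-* (toℚ (d m)) (σ m i))

    fromℤ-d-nonNeg : ∀ m → 0# ≤ fromℤ (d m)
    fromℤ-d-nonNeg m = fromℕ-nonNeg (2 ℕ.^ (m !))

  ∣d∣≤ : ∀ m → ∣ fromℤ (d m) ∣≤ exp (A m)
  ∣d∣≤ m = ≤-reflexive (≈-sym (exp-A m))
    , ≤-trans (≤-resp ≈-refl (solve 0 (:- con 0ℚ := con 0ℚ) ≈-refl)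
          (neg-antimono-≤ (≤-resp (≈-sym fromℚ-homo-0) ≈-refl (fromℤ-d-nonNeg m))))
        (≤-resp (≈-sym fromℚ-homo-0) ≈-refl (exp-nonNeg (A m)))

  -- The exponent is the logarithm of `2 d m / d n`. The index `n` is `m + 1` in general and `m + 2`
  -- in the coordinates that stage `m` leaves unchanged.
  error≤ : ∀ m n i → ζ i ≤ fromℚ (σ m i ℚ.+ toℚ (+ 2) ℚ.* ½^ (n !)) →
           ∣ error m i ∣≤ exp (A m + log2 - A n)
  error≤ m n i upper =
      by-slack (fromℤ-d-nonNeg m ⊛ slack upper) (≈-trans
        (*-cong ≈-refl (+-cong (≈-trans (fromℚ-homo-+ (σ m i) (two ℚ.* ½^ (n !)))
          (+-cong ≈-refl (fromℚ-homo-* two (½^ (n !))))) ≈-refl))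
        (≈-trans (solve 5 (λ D s t h z → D :* ((s :+ t :* h) :- z) := D :* t :* h :- (z :* D :- D :* s))
          ≈-refl (fromℤ (d m)) (fromℚ (σ m i)) (fromℚ two) (fromℚ (½^ (n !))) (ζ i))
        (+-cong (≈-sym exp≈) (-‿cong (+-cong ≈-refl (-‿cong (≈-sym (fromℤ-p m i))))))))
    , by-slack (exp-nonNeg (A m + log2 - A n) ⊕ fromℤ-d-nonNeg m ⊛ slack (ζ-lower m i)) (≈-trans
        (solve 4 (λ e D z s → e :+ D :* (z :- s) := e :- (:- (z :* D :- D :* s))) ≈-refl
          (exp (A m + log2 - A n)) (fromℤ (d m)) (ζ i) (fromℚ (σ m i)))
        (+-cong ≈-refl (-‿cong (-‿cong (+-cong ≈-refl (-‿cong (≈-sym (fromℤ-p m i))))))))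
    where
    exp≈ : exp (A m + log2 - A n) ≈ fromℤ (d m) * fromℚ two * fromℚ (½^ (n !))
    exp≈ = ≈-trans (exp-+ (A m + log2) (- A n))
      (*-cong (≈-trans (exp-+ (A m) log2) (*-cong (exp-A m) exp-log2)) (exp-neg-multiple (n !)))

  error≤next : ∀ m i → ∣ error m i ∣≤ exp (A m + log2 - A (suc m))
  error≤next m i = error≤ m (suc m) i (ζ-upper m i)

  error≤afternext : ∀ m i → i ≢ m mod k → ∣ error m i ∣≤ exp (A m + log2 - A (suc (suc m)))
  error≤afternext m i i≢m = error≤ m (suc (suc m)) i
    (subst (λ s → ζ i ≤ fromℚ (s ℚ.+ toℚ (+ 2) ℚ.* ½^ (suc (suc m) !)))
      (σ-skip m i (i≢m ∘ sym)) (ζ-upper (suc m) i))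

  -- The minor d yᵢ - x pᵢ is an integer of absolute value at most ½.
  proportional : ∀ {l θ s} w m i → Solution l θ w → ∣ error m i ∣≤ exp s →
    (fromℚ 1ℚ + θ) * l + s ≤ - (fromℚ two * log2) →
    A m + (- κ + θ) * l ≤ - (fromℚ two * log2) →
    d m ℤ.* w (Fin.suc i) ≡ w 0F ℤ.* p m i
  proportional {l} {θ} {s} w m i (bx , by) be small₁ small₂ =
    ℤₚ.i-j≡0⇒i≡j _ _ (fromℤ-small D
      (∣∣≤-resp (≈-sym D≈) (≤-resp (+-cong (exp-+ _ _) (exp-+ _ _))
          (solve 0 (con (½ ℚ.* ½) :+ con (½ ℚ.* ½) := con ½) ≈-refl)
          (+-mono-≤ (exp-≤¼ small₁) (exp-≤¼ small₂)))
        (∣x+y∣≤ (∣x*y∣≤ bx be) (∣x*y∣≤ (∣d∣≤ m) (∣-x∣≤ (by i))))))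
    where
    x = w 0F
    y = w (Fin.suc i)
    D = d m ℤ.* y ℤ.- x ℤ.* p m i
    D≈ : fromℤ D ≈ fromℤ x * error m i + fromℤ (d m) * (- (ζ i * fromℤ x - fromℤ y))
    D≈ = ≈-trans (fromℤ-homo-- (d m ℤ.* y) (x ℤ.* p m i))
      (≈-trans (+-cong (fromℤ-homo-* (d m) y) (-‿cong (fromℤ-homo-* x (p m i))))
        (solve 5 (λ d y x p z → d :* y :- x :* p := x :* (z :* d :- p) :+ d :* (:- (z :* x :- y))) ≈-refl
          (fromℤ (d m)) (fromℤ y) (fromℤ x) (fromℤ (p m i)) (ζ i)))

  approximant : ℕ → Vector ℤ (suc k)
  approximant m = d m ∷ p m

  approximant-solves : ∀ {l θ} m → A m ≤ (fromℚ 1ℚ + θ) * l →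
    A m + log2 - A (suc m) ≤ (- κ + θ) * l → Solution l θ (approximant m)
  approximant-solves m ≤₁ ≤₂ =
      ∣∣≤-resp ≈-refl (exp-mono ≤₁) (∣d∣≤ m)
    , λ i → ∣∣≤-resp ≈-refl (exp-mono ≤₂) (error≤next m i)

  approximant-independent : ∀ m → LinearlyIndependentℤ {suc k} {1} (approximant m ∷ [])
  approximant-independent m c zero-sum 0F =
    d-cancelʳ m
      (trans (sym (ℤₚ.+-identityʳ _)) (zero-sum 0F))

  -- The determinant of dₘ, pₘ and their successors in the coordinate
  -- that changes is dₘ.
  consecutive-independent : ∀ m → LinearlyIndependentℤ {suc k} {2} (approximant m ∷ approximant (suc m) ∷ [])
  consecutive-independent m c zero-sum = λ { 0F → c₀≡0 ; 1F → c₁≡0 }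
    where
    i₀ = m mod k
    c₀ = c 0F
    c₁ = c 1F
    u = c₀ ℤ.+ ratio m ℤ.* c₁
    u≡0 : u ≡ 0ℤ
    u≡0 = d-cancelʳ m (trans
      (solveℤ 4 (λ c₀ c₁ d r → (c₀ :+′ r :*′ c₁) :*′ d :=′ c₀ :*′ d :+′ (c₁ :*′ (d :*′ r) :+′ con′ 0ℤ)) refl c₀ c₁ (d m) (ratio m))
      (trans (cong (λ e → c₀ ℤ.* d m ℤ.+ (c₁ ℤ.* e ℤ.+ 0ℤ)) (sym (d-suc m))) (zero-sum 0F)))
    c₁≡0 : c₁ ≡ 0ℤ
    c₁≡0 = trans (sym (ℤₚ.+-identityˡ c₁)) (trans (cong (λ e → e ℤ.* p m i₀ ℤ.+ c₁) (sym u≡0)) (trans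
      (solveℤ 4 (λ c₀ c₁ p r → (c₀ :+′ r :*′ c₁) :*′ p :+′ c₁
          :=′ c₀ :*′ p :+′ (c₁ :*′ (r :*′ p :+′ con′ 1ℤ) :+′ con′ 0ℤ)) refl c₀ c₁ (p m i₀) (ratio m))
      (trans (cong (λ e → c₀ ℤ.* p m i₀ ℤ.+ (c₁ ℤ.* (ratio m ℤ.* p m i₀ ℤ.+ e) ℤ.+ 0ℤ)) (sym (δ-refl i₀)))
        (zero-sum (Fin.suc i₀)))))
    c₀≡0 : c₀ ≡ 0ℤ
    c₀≡0 = trans (sym (ℤₚ.+-identityʳ c₀))
      (trans (cong (λ e → c₀ ℤ.+ e) (sym (trans (cong (ratio m ℤ.*_) c₁≡0) (ℤₚ.*-zeroʳ (ratio m))))) u≡0)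

  -- Substituting `d y = x p` for both points turns `d (x′ y - x y′)` into 0, and a point with
  -- `x = 0` has `d y = 0`.
  proportional⇒dependent : ∀ m (v : Vector (Vector ℤ (suc k)) 2) →
    (∀ l i → d m ℤ.* v l (Fin.suc i) ≡ v l 0F ℤ.* p m i) → ¬ LinearlyIndependentℤ v
  proportional⇒dependent m v prop = minors-vanish⇒dependent v minors zero-x
    where
    x  = v 0F 0F
    x′ = v 1F 0F
    swap : ∀ a b c → a ℤ.* (b ℤ.* c) ≡ b ℤ.* (a ℤ.* c)
    swap = solveℤ 3 (λ a b c → a :*′ (b :*′ c) :=′ b :*′ (a :*′ c)) refl
    minors : ∀ i → x′ ℤ.* v 0F (Fin.suc i) ≡ x ℤ.* v 1F (Fin.suc i)
    minors i = d-cancelˡ m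
      (trans (swap (d m) x′ _) (trans (cong (x′ ℤ.*_) (prop _ i)) (trans (swap x′ x (p m i))
        (trans (cong (x ℤ.*_) (sym (prop _ i))) (swap x (d m) _)))))
    zero-x : x ≡ 0ℤ → ∀ i → v 0F (Fin.suc i) ≡ 0ℤ
    zero-x x≡0 i = d-cancelˡ m
      (trans (prop _ i) (trans (cong (ℤ._* p m i) x≡0) (trans (ℤₚ.*-zeroˡ (p m i)) (sym (ℤₚ.*-zeroʳ (d m))))))

  -- In the coordinate `m mod k` the two relations read `d y = x p` and `d r y = x (r p + 1)`, where
  -- `r` is `ratio m`; `r` times the first subtracted from the second leaves `x = 0`.
  doubly-proportional⇒zero : ∀ m (w : Vector ℤ (suc k)) →
    (∀ i → d m ℤ.* w (Fin.suc i) ≡ w 0F ℤ.* p m i) →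
    (∀ i → d (suc m) ℤ.* w (Fin.suc i) ≡ w 0F ℤ.* p (suc m) i) → ∀ i → w i ≡ 0ℤ
  doubly-proportional⇒zero m w prop prop′ = λ
    { 0F    → x≡0
    ; (Fin.suc i) → d-cancelˡ m
        (trans (prop i) (trans (cong (ℤ._* p m i) x≡0) (trans (ℤₚ.*-zeroˡ (p m i)) (sym (ℤₚ.*-zeroʳ (d m)))))) }
    where
    i₀ = m mod k
    x = w 0F
    y = w (Fin.suc i₀)
    x≡0 : x ≡ 0ℤ
    x≡0 = trans (solveℤ 3 (λ x r p → x :=′ x :*′ (r :*′ p :+′ con′ 1ℤ) :-′ r :*′ (x :*′ p)) refl x (ratio m) (p m i₀))
      (ℤₚ.i≡j⇒i-j≡0 (trans
        (trans (cong (λ e → x ℤ.* (ratio m ℤ.* p m i₀ ℤ.+ e)) (sym (δ-refl i₀))) (sym (prop′ i₀)))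
        (trans (cong (ℤ._* y) (d-suc m))
          (trans (solveℤ 3 (λ d r y → d :*′ r :*′ y :=′ r :*′ (d :*′ y)) refl (d m) (ratio m) y)
            (cong (ratio m ℤ.*_) (prop i₀))))))

  τ : Carrier
  τ = fromℚ (τℚ k)

  private
    τ≈ : τ ≈ fromℚ ½ * (κ + - fromℚ 1ℚ)
    τ≈ = ≈-trans (fromℚ-homo-* ½ ((1ℤ ℚ./ k) ℚ.- 1ℚ)) (*-cong ≈-refl
      (≈-trans (fromℚ-homo-+ (1ℤ ℚ./ k) (ℚ.- 1ℚ)) (+-cong ≈-refl (fromℚ-homo-- 1ℚ))))

    -- At θ = τ + e the two exponents are ±(1 + κ) l / 2, up to e l.
    exponent₁ : ∀ e l → (fromℚ 1ℚ + (τ + e)) * l ≈ fromℚ ½ * ((fromℚ 1ℚ + κ) * l) + e * l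
    exponent₁ e l = ≈-trans (*-cong (+-cong ≈-refl (+-cong τ≈ ≈-refl)) ≈-refl)
      (solve 3 (λ κ e l → (con 1ℚ :+ (con ½ :* (κ :- con 1ℚ) :+ e)) :* l
        := con ½ :* ((con 1ℚ :+ κ) :* l) :+ e :* l) ≈-refl κ e l)

    exponent₂ : ∀ e l → (- κ + (τ + e)) * l ≈ - (fromℚ ½ * ((fromℚ 1ℚ + κ) * l)) + e * l
    exponent₂ e l = ≈-trans (*-cong (+-cong ≈-refl (+-cong τ≈ ≈-refl)) ≈-refl)
      (solve 3 (λ κ e l → (:- κ :+ (con ½ :* (κ :- con 1ℚ) :+ e)) :* l
        := :- (con ½ :* ((con 1ℚ :+ κ) :* l)) :+ e :* l) ≈-refl κ e l)

    0≤κ : 0# ≤ κ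
    0≤κ = 0≤fromℚ (1ℤ ℚ./ k) {{ℚₚ.normalize-nonNeg 1 k}}

    κ≤1 : κ ≤ fromℚ 1ℚ
    κ≤1 = fromℚ-mono (subst₂ ℚ._≤_ (ℚₚ.*-identityʳ (1ℤ ℚ./ k)) (1/n*n≡1 k)
      (Q.*-monoʳ-≤ {z = 1ℤ ℚ./ k} (ℚₚ.nonNegative⁻¹ (1ℤ ℚ./ k) {{ℚₚ.normalize-nonNeg 1 k}})
        (toℚ-mono-≤ {1ℤ} {+ k} (ℤ.+≤+ (ℕ.>-nonZero⁻¹ k)))))

    coordinates-small⇒0 : ∀ {l θ} (w : Vector ℤ (suc k)) → Solution l θ w → w 0F ≡ 0ℤ →
      (- κ + θ) * l ≤ - log2 → ∀ i → w (Fin.suc i) ≡ 0ℤ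
    coordinates-small⇒0 w (_ , by) x≡0 small i = fromℤ-small y
      (∣∣≤-resp (≈-trans (-‿cong (+-cong (*-cong ≈-refl (fromℤ-cong x≡0)) ≈-refl))
          (solve 2 (λ z y → :- (z :* con 0ℚ :- y) := y) ≈-refl (ζ i) (fromℤ y)))
        (exp-≤½ small) (∣-x∣≤ (by i)))
      where
      y = w (Fin.suc i)

  -- The first bound has exponent `- ε l`, so `|x| ≤ ½` and `x = 0`; the second then forces every
  -- `y` to vanish in the same way.
  no-solution-below-−1 : ∀ {l ε} → 0# ≤ l → log2 ≤ ε * l → ¬ IndependentSolutions 1 l (fromℤ -1ℤ - ε)
  no-solution-below-−1 {l} {ε} 0≤l log2≤εl (v , ind , sol) = zero-dependent v
    (λ { 0F → x≡0 ; (Fin.suc i) → coordinates-small⇒0 w (sol 0F) x≡0 small i }) ind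
    where
    w = v 0F
    x≡0 : w 0F ≡ 0ℤ
    x≡0 = fromℤ-small (w 0F) (∣∣≤-resp ≈-refl (exp-≤½ (by-slack (slack log2≤εl)
      (solve 3 (λ e l x → e :* l :- x := :- x :- (con 1ℚ :+ (con (toℚ -1ℤ) :- e)) :* l) ≈-refl ε l log2)))
      (proj₁ (sol 0F)))
    small : (- κ + (fromℤ -1ℤ - ε)) * l ≤ - log2
    small = by-slack (slack log2≤εl ⊕ (0≤fromℚ 1ℚ ⊕ 0≤κ) ⊛ 0≤l)
      (solve 4 (λ e l x κ → (e :* l :- x) :+ (con 1ℚ :+ κ) :* l
        := :- x :- (:- κ :+ (con (toℚ -1ℤ) :- e)) :* l) ≈-refl ε l log2 κ)

  -- The integer `n` stands for an upper bound of `1 / ε` in a ring without division, and measures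
  -- how large `l` and `m` have to be.
  module Perturbation (n : ℕ) (ε : Carrier) (0≤ε : 0# ≤ ε) (1≤nε : fromℚ 1ℚ ≤ fromℕ n * ε) where

    N : Carrier
    N = fromℕ n

    0≤N : 0# ≤ N
    0≤N = fromℕ-nonNeg n

    log2≤εl : ∀ {l} → N * log2 ≤ l → log2 ≤ ε * l
    log2≤εl {l} ≤l = by-slack (0≤ε ⊛ slack ≤l ⊕ slack 1≤nε ⊛ 0≤log2)
      (solve 4 (λ e l n x → e :* (l :- n :* x) :+ (n :* e :- con 1ℚ) :* x := e :* l :- x) ≈-refl ε l N log2)

    private
      0≤l : ∀ {l} → N * log2 ≤ l → 0# ≤ l
      0≤l ≤l = ≤-trans (0≤N ⊛ 0≤log2) ≤l

      0≤H : ∀ {l} → 0# ≤ l → 0# ≤ (fromℚ 1ℚ + κ) * l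
      0≤H 0≤l = (0≤fromℚ 1ℚ ⊕ 0≤κ) ⊛ 0≤l

    -- The 2 × 2 minors of two solutions at τ - ε are at most 2 exp (- 2 ε l).
    no-pair-below-τ : ∀ l → N * log2 ≤ l → ¬ IndependentSolutions 2 l (τ - ε)
    no-pair-below-τ l ≤l (v , ind , sol) = minors-vanish⇒dependent v minors
      (λ x≡0 → coordinates-small⇒0 (v 0F) (sol 0F) x≡0
        (≤-resp (≈-sym (exponent₂ (- ε) l)) ≈-refl (by-slack
          (slack (log2≤εl ≤l) ⊕ 0≤fromℚ ½ ⊛ 0≤H (0≤l ≤l))
          (solve 4 (λ e l x H → (e :* l :- x) :+ con ½ :* H := :- x :- (:- (con ½ :* H) :+ (:- e) :* l))
            ≈-refl ε l log2 ((fromℚ 1ℚ + κ) * l))))) ind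
      where
      w  = v 0F
      w′ = v 1F
      x  = w 0F
      x′ = w′ 0F
      product≤¼ : exp ((fromℚ 1ℚ + (τ - ε)) * l) * exp ((- κ + (τ - ε)) * l) ≤ fromℚ (½ ℚ.* ½)
      product≤¼ = ≤-resp (exp-+ _ _) ≈-refl (exp-≤¼ (≤-resp
        (≈-sym (+-cong (exponent₁ (- ε) l) (exponent₂ (- ε) l))) ≈-refl
        (by-slack (0≤fromℚ two ⊛ slack (log2≤εl ≤l))
          (solve 4 (λ e l x H → con two :* (e :* l :- x)
            := :- (con two :* x) :- ((con ½ :* H :+ (:- e) :* l) :+ (:- (con ½ :* H) :+ (:- e) :* l)))
            ≈-refl ε l log2 ((fromℚ 1ℚ + κ) * l)))))
      minors : ∀ i → x′ ℤ.* w (Fin.suc i) ≡ x ℤ.* w′ (Fin.suc i)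
      minors i = ℤₚ.i-j≡0⇒i≡j _ _ (fromℤ-small D
        (∣∣≤-resp (≈-sym D≈) (≤-resp ≈-refl (solve 0 (con (½ ℚ.* ½) :+ con (½ ℚ.* ½) := con ½) ≈-refl)
            (+-mono-≤ product≤¼ product≤¼))
          (∣x+y∣≤ (∣x*y∣≤ (proj₁ (sol 0F)) (proj₂ (sol 1F) i))
            (∣x*y∣≤ (proj₁ (sol 1F)) (∣-x∣≤ (proj₂ (sol 0F) i))))))
        where
        y  = w (Fin.suc i)
        y′ = w′ (Fin.suc i)
        D  = x′ ℤ.* y ℤ.- x ℤ.* y′
        D≈ : fromℤ D ≈ fromℤ x * (ζ i * fromℤ x′ - fromℤ y′) + fromℤ x′ * (- (ζ i * fromℤ x - fromℤ y))
        D≈ = ≈-trans (fromℤ-homo-- (x′ ℤ.* y) (x ℤ.* y′))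
          (≈-trans (+-cong (fromℤ-homo-* x′ y) (-‿cong (fromℤ-homo-* x y′)))
            (solve 5 (λ x′ y x y′ z → x′ :* y :- x :* y′ := x :* (z :* x′ :- y′) :+ x′ :* (:- (z :* x :- y)))
              ≈-refl (fromℤ x′) (fromℤ y) (fromℤ x) (fromℤ y′) (ζ i)))

    -- The summand `8 n` pays for `ε`: together with `A (suc m) ≤ H ≤ 2 l` it gives `l ≥ 4 n A m`,
    -- hence `ε l ≥ 4 A m`. The summand 8 keeps consecutive logarithms apart by a factor 8 whatever
    -- `n` is.
    growth : ∀ m → 8 ℕ.* n ℕ.+ 8 ℕ.≤ suc m → (fromℚ eight * N + fromℚ eight) * A m ≤ A (suc m)
    growth m large = ≤-resp (*-cong (≈-trans (fromℤ-homo-+ (+ (8 ℕ.* n)) (+ 8))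
        (+-cong (fromℕ-homo-* 8 n) ≈-refl)) ≈-refl)
      ≈-refl (A-grows (8 ℕ.* n ℕ.+ 8) m large)

    module Scale (m : ℕ) (large : 8 ℕ.* n ℕ.+ 8 ℕ.≤ suc m) (l : Carrier) (0≤l : 0# ≤ l) where

      -- The difference of the exponents of the two bounds, the same for all `θ`; below, `a`, `b`,
      -- `c` are the logarithms of three consecutive denominators against which it is measured.
      H : Carrier
      H = (fromℚ 1ℚ + κ) * l

      8A≤A′ : fromℚ eight * A m ≤ A (suc m)
      8A≤A′ = by-slack (slack (growth m large) ⊕ 0≤fromℚ eight ⊛ 0≤N ⊛ 0≤A m)
        (solve 3 (λ a b n → (b :- (con eight :* n :+ con eight) :* a) :+ con eight :* n :* a := b :- con eight :* a)
          ≈-refl (A m) (A (suc m)) N)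

      H≤2l : H ≤ fromℚ two * l
      H≤2l = by-slack (slack κ≤1 ⊛ 0≤l)
        (solve 2 (λ κ l → (con 1ℚ :- κ) :* l := con two :* l :- (con 1ℚ :+ κ) :* l) ≈-refl κ l)

      4A≤εl : A (suc m) ≤ H → fromℚ four * A m ≤ ε * l
      4A≤εl A′≤H = by-slack
        (0≤fromℚ ½ ⊛ 0≤ε ⊛ slack (≤-trans A′≤H H≤2l) ⊕ 0≤fromℚ ½ ⊛ 0≤ε ⊛ slack (growth m large)
          ⊕ 0≤fromℚ four ⊛ (slack 1≤nε ⊛ 0≤A m) ⊕ 0≤fromℚ four ⊛ 0≤ε ⊛ 0≤A m)
        (solve 5 (λ e l a b n →
          con ½ :* e :* (con two :* l :- b) :+ con ½ :* e :* (b :- (con eight :* n :+ con eight) :* a)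
            :+ con four :* ((n :* e :- con 1ℚ) :* a) :+ con four :* e :* a := e :* l :- con four :* a)
          ≈-refl ε l (A m) (A (suc m)) N)

      private
        Λ = log2
        a = A m
        b = A (suc m)
        c = A (suc (suc m))

      -- At `H = b` and `θ = -1 + ε` the exponents are `ε l` and `ε l - b`, and `ε l ≥ 4 a` leaves
      -- room for `a` in the first and for `a + log 2` in the second.
      solution-near-−1 : b ≤ H → H ≤ b → IndependentSolutions 1 l (fromℤ -1ℤ + ε)
      solution-near-−1 b≤H H≤b = approximant m ∷ [] , approximant-independent m , λ { 0F →
        approximant-solves m
          (by-slack (slack (4A≤εl b≤H) ⊕ 0≤fromℚ three ⊛ 0≤A m)
            (solve 3 (λ e l a → (e :* l :- con four :* a) :+ con three :* a
              := (con 1ℚ :+ (con (toℚ -1ℤ) :+ e)) :* l :- a) ≈-refl ε l a))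
          (by-slack (slack (4A≤εl b≤H) ⊕ 0≤fromℚ two ⊛ 0≤A m ⊕ slack (log2≤A m) ⊕ slack H≤b)
            (solve 6 (λ e l a b x κ → (e :* l :- con four :* a) :+ con two :* a :+ (a :- x)
                :+ (b :- (con 1ℚ :+ κ) :* l)
              := (:- κ :+ (con (toℚ -1ℤ) :+ e)) :* l :- (a :+ x :- b)) ≈-refl ε l a b Λ κ)) }

      private
        -- Here `t` is the logarithm of the denominator that governs the error: `b` if all
        -- coordinates are considered, `c` if `m mod k` is left out.
        small₁ : ∀ t → b ≤ H → H ≤ t → (fromℚ 1ℚ + (κ - ε)) * l + (a + Λ - t) ≤ - (fromℚ two * Λ)
        small₁ t b≤H H≤t = by-slack (slack (4A≤εl b≤H) ⊕ 0≤fromℚ three ⊛ slack (log2≤A m) ⊕ slack H≤t)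
          (solve 6 (λ e l a t x κ → (e :* l :- con four :* a) :+ con three :* (a :- x) :+ (t :- (con 1ℚ :+ κ) :* l)
            := :- (con two :* x) :- ((con 1ℚ :+ (κ :- e)) :* l :+ (a :+ x :- t))) ≈-refl ε l a t Λ κ)

        small₂ : b ≤ H → a + (- κ + (κ - ε)) * l ≤ - (fromℚ two * Λ)
        small₂ b≤H = by-slack (slack (4A≤εl b≤H) ⊕ 0≤fromℚ two ⊛ slack (log2≤A m) ⊕ 0≤A m)
          (solve 5 (λ e l a x κ → (e :* l :- con four :* a) :+ con two :* (a :- x) :+ a
            := :- (con two :* x) :- (a :+ (:- κ :+ (κ :- e)) :* l)) ≈-refl ε l a Λ κ)

      no-pair-below-κ : b ≤ H → H ≤ b → ¬ IndependentSolutions 2 l (κ - ε)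
      no-pair-below-κ b≤H H≤b (v , ind , sol) = proportional⇒dependent m v
        (λ j i → proportional (v j) m i (sol j) (error≤next m i) (small₁ b b≤H H≤b) (small₂ b≤H)) ind

      -- Away from the coordinate `m mod k` the error is governed by `c`, which permits the whole
      -- range `b ≤ H ≤ c`. For consecutive `m` these ranges abut, so they cover all large `l`.
      no-triple-below-κ : b ≤ H → H ≤ c → ¬ IndependentSolutions 3 l (κ - ε)
      no-triple-below-κ b≤H H≤c (v , ind , sol) = plane⇒dependent (d m) (p m) (m mod k) (d≢0 m) v
        (λ j i i≢m → proportional (v j) m i (sol j) (error≤afternext m i i≢m) (small₁ c b≤H H≤c) (small₂ b≤H)) ind

      -- Near `τ` the exponents are `H / 2` and `- H / 2`, up to `ε l`. The `m`-th approximant meets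
      -- the first bound once `2 a ≤ H` and the second until about `H = 2 b`; these windows too abut
      -- as `m` varies.
      solution-near-τ : fromℚ two * a ≤ H → H ≤ fromℚ two * b → IndependentSolutions 1 l (τ + ε)
      solution-near-τ 2a≤H H≤2b = approximant m ∷ [] , approximant-independent m , λ { 0F →
        approximant-solves m
          (≤-resp ≈-refl (≈-sym (exponent₁ ε l)) (by-slack (0≤fromℚ ½ ⊛ slack 2a≤H ⊕ 0≤ε ⊛ 0≤l)
            (solve 4 (λ e l a h → con ½ :* (h :- con two :* a) :+ e :* l := (con ½ :* h :+ e :* l) :- a)
              ≈-refl ε l a H)))
          (≤-resp ≈-refl (≈-sym (exponent₂ ε l)) error-small) }
        where
        error-small : a + Λ - b ≤ - (fromℚ ½ * H) + ε * l
        -- If `2 a ≤ ε l`, then `ε l` absorbs `a + log 2`, and `H ≤ 2 b` does the rest. Otherwise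
        -- `l ≤ n ε l ≤ 2 n a`, so `H / 2 ≤ l` is small compared with `b`.
        error-small = [ if-small , if-large ]′ (≤-total (fromℚ two * a) (ε * l))
          where
          if-small : fromℚ two * a ≤ ε * l → a + Λ - b ≤ - (fromℚ ½ * H) + ε * l
          if-small 2a≤εl = by-slack (slack 2a≤εl ⊕ slack (log2≤A m) ⊕ 0≤fromℚ ½ ⊛ slack H≤2b)
            (solve 6 (λ e l a b x h → (e :* l :- con two :* a) :+ (a :- x) :+ con ½ :* (con two :* b :- h)
              := (:- (con ½ :* h) :+ e :* l) :- (a :+ x :- b)) ≈-refl ε l a b Λ H)
          if-large : ε * l ≤ fromℚ two * a → a + Λ - b ≤ - (fromℚ ½ * H) + ε * l
          if-large εl≤2a = by-slack
            (slack (growth m large) ⊕ (0≤fromℚ (toℚ (+ 6)) ⊛ 0≤N ⊕ 0≤fromℚ (toℚ (+ 6))) ⊛ 0≤A m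
              ⊕ slack (log2≤A m) ⊕ 0≤N ⊛ slack εl≤2a ⊕ slack 1≤nε ⊛ 0≤l
              ⊕ 0≤fromℚ ½ ⊛ slack H≤2l ⊕ 0≤ε ⊛ 0≤l)
            (solve 7 (λ e l a b x h n →
              (b :- (con eight :* n :+ con eight) :* a) :+ (con (toℚ (+ 6)) :* n :+ con (toℚ (+ 6))) :* a
                :+ (a :- x) :+ n :* (con two :* a :- e :* l) :+ (n :* e :- con 1ℚ) :* l
                :+ con ½ :* (con two :* l :- h) :+ e :* l
              := (:- (con ½ :* h) :+ e :* l) :- (a :+ x :- b)) ≈-refl ε l a b Λ H N)

      module AtCrossing (2b≤H : fromℚ two * b ≤ H) (H≤2b : H ≤ fromℚ two * b) where

        private
          b≤H : b ≤ H
          b≤H = by-slack (slack 2b≤H ⊕ 0≤A (suc m)) (solve 2 (λ b h → (h :- con two :* b) :+ b := h :- b) ≈-refl b H)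

          8b≤c : fromℚ eight * b ≤ c
          8b≤c = A-grows 8 (suc m) (ℕₚ.≤-trans (ℕₚ.m≤n+m 8 (8 ℕ.* n)) (ℕₚ.≤-trans large (ℕₚ.n≤1+n (suc m))))

        pair-near-τ : IndependentSolutions 2 l (τ + ε)
        pair-near-τ = approximant m ∷ approximant (suc m) ∷ [] , consecutive-independent m , λ
          { 0F → approximant-solves m
              (≤-resp ≈-refl (≈-sym (exponent₁ ε l)) (by-slack
                (0≤fromℚ ½ ⊛ slack 2b≤H ⊕ slack 8A≤A′ ⊕ 0≤fromℚ (toℚ (+ 7)) ⊛ 0≤A m ⊕ 0≤ε ⊛ 0≤l)
                (solve 5 (λ e l a b h → con ½ :* (h :- con two :* b) :+ (b :- con eight :* a)
                    :+ con (toℚ (+ 7)) :* a :+ e :* l := (con ½ :* h :+ e :* l) :- a) ≈-refl ε l a b H)))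
              (≤-resp ≈-refl (≈-sym (exponent₂ ε l)) (by-slack
                (slack (4A≤εl b≤H) ⊕ 0≤fromℚ two ⊛ 0≤A m ⊕ slack (log2≤A m) ⊕ 0≤fromℚ ½ ⊛ slack H≤2b)
                (solve 6 (λ e l a b x h → (e :* l :- con four :* a) :+ con two :* a :+ (a :- x)
                    :+ con ½ :* (con two :* b :- h)
                  := (:- (con ½ :* h) :+ e :* l) :- (a :+ x :- b)) ≈-refl ε l a b Λ H)))
          ; 1F → approximant-solves (suc m)
              (≤-resp ≈-refl (≈-sym (exponent₁ ε l)) (by-slack (0≤fromℚ ½ ⊛ slack 2b≤H ⊕ 0≤ε ⊛ 0≤l)
                (solve 4 (λ e l b h → con ½ :* (h :- con two :* b) :+ e :* l := (con ½ :* h :+ e :* l) :- b)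
                  ≈-refl ε l b H)))
              (≤-resp ≈-refl (≈-sym (exponent₂ ε l)) (by-slack
                (slack 8b≤c ⊕ 0≤fromℚ (toℚ (+ 5)) ⊛ 0≤A (suc m) ⊕ slack (log2≤A (suc m))
                  ⊕ 0≤ε ⊛ 0≤l ⊕ 0≤fromℚ ½ ⊛ slack H≤2b)
                (solve 6 (λ e l b c x h → (c :- con eight :* b) :+ con (toℚ (+ 5)) :* b :+ (b :- x)
                    :+ e :* l :+ con ½ :* (con two :* b :- h)
                  := (:- (con ½ :* h) :+ e :* l) :- (b :+ x :- c)) ≈-refl ε l b c Λ H))) }

        -- A solution would be proportional to both of the independent approximants `m` and `m + 1`,
        -- hence zero. The critical contributions to the minors have exponents `a + log 2 - ε l` and
        -- `- ε l`, and are small only because of the loss `ε`.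
        no-solution-below-τ : ¬ IndependentSolutions 1 l (τ - ε)
        no-solution-below-τ (v , ind , sol) = zero-dependent v
          (doubly-proportional⇒zero m w
            (λ i → proportional w m i (sol 0F) (error≤next m i)
              (≤-resp (+-cong (≈-sym (exponent₁ (- ε) l)) ≈-refl) ≈-refl (by-slack
                (slack (4A≤εl b≤H) ⊕ 0≤fromℚ three ⊛ slack (log2≤A m) ⊕ 0≤fromℚ ½ ⊛ slack H≤2b)
                (solve 6 (λ e l a b x h → (e :* l :- con four :* a) :+ con three :* (a :- x)
                    :+ con ½ :* (con two :* b :- h)
                  := :- (con two :* x) :- ((con ½ :* h :+ (:- e) :* l) :+ (a :+ x :- b))) ≈-refl ε l a b Λ H)))
              (≤-resp (+-cong ≈-refl (≈-sym (exponent₂ (- ε) l))) ≈-refl (by-slack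
                (slack (4A≤εl b≤H) ⊕ 0≤fromℚ two ⊛ slack (log2≤A m) ⊕ 0≤A m
                  ⊕ 0≤fromℚ ½ ⊛ slack 2b≤H ⊕ 0≤A (suc m))
                (solve 6 (λ e l a b x h → (e :* l :- con four :* a) :+ con two :* (a :- x) :+ a
                    :+ con ½ :* (h :- con two :* b) :+ b
                  := :- (con two :* x) :- (a :+ (:- (con ½ :* h) :+ (:- e) :* l))) ≈-refl ε l a b Λ H))))
            (λ i → proportional w (suc m) i (sol 0F) (error≤next (suc m) i)
              (≤-resp (+-cong (≈-sym (exponent₁ (- ε) l)) ≈-refl) ≈-refl (by-slack
                (slack 8b≤c ⊕ 0≤fromℚ three ⊛ 0≤A (suc m) ⊕ 0≤fromℚ three ⊛ slack (log2≤A (suc m))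
                  ⊕ 0≤ε ⊛ 0≤l ⊕ 0≤fromℚ ½ ⊛ slack H≤2b)
                (solve 6 (λ e l b c x h → (c :- con eight :* b) :+ con three :* b :+ con three :* (b :- x)
                    :+ e :* l :+ con ½ :* (con two :* b :- h)
                  := :- (con two :* x) :- ((con ½ :* h :+ (:- e) :* l) :+ (b :+ x :- c))) ≈-refl ε l b c Λ H)))
              (≤-resp (+-cong ≈-refl (≈-sym (exponent₂ (- ε) l))) ≈-refl (by-slack
                (slack (4A≤εl b≤H) ⊕ 0≤fromℚ two ⊛ slack (log2≤A m) ⊕ 0≤fromℚ two ⊛ 0≤A m
                  ⊕ 0≤fromℚ ½ ⊛ slack 2b≤H)
                (solve 6 (λ e l a b x h → (e :* l :- con four :* a) :+ con two :* (a :- x)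
                    :+ con two :* a :+ con ½ :* (h :- con two :* b)
                  := :- (con two :* x) :- (b :+ (:- (con ½ :* h) :+ (:- e) :* l))) ≈-refl ε l a b Λ H))))) ind
          where
          w = v 0F

  private
    κℚ ρℚ : ℚ
    κℚ = 1ℤ ℚ./ k

    1+κ-positive : ℚ.Positive (1ℚ ℚ.+ κℚ)
    1+κ-positive = ℚₚ.pos+nonNeg⇒pos 1ℚ κℚ {{ℚₚ.normalize-nonNeg 1 k}}

    ρℚ = (ℚ.1/ (1ℚ ℚ.+ κℚ)) {{ℚₚ.pos⇒nonZero (1ℚ ℚ.+ κℚ) {{1+κ-positive}}}}

    ρ : Carrier
    ρ = fromℚ ρℚ

    0≤ρ : 0# ≤ ρ
    0≤ρ = 0≤fromℚ ρℚ {{ℚₚ.pos⇒nonNeg ρℚ {{ℚₚ.1/pos⇒pos (1ℚ ℚ.+ κℚ) {{1+κ-positive}}}}}}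

    [1+κ]ρ≈1 : (fromℚ 1ℚ + κ) * ρ ≈ fromℚ 1ℚ
    [1+κ]ρ≈1 = ≈-trans (*-cong (≈-sym (fromℚ-homo-+ 1ℚ κℚ)) ≈-refl) (≈-trans (≈-sym (fromℚ-homo-* (1ℚ ℚ.+ κℚ) ρℚ))
      (fromℚ-cong (ℚₚ.*-inverseʳ (1ℚ ℚ.+ κℚ) {{ℚₚ.pos⇒nonZero (1ℚ ℚ.+ κℚ) {{1+κ-positive}}}})))

    -- The choice `l = ρ x` realises a prescribed value `x` of `H`. The reciprocal of `1 + κ` is
    -- taken in the rationals, since the ring has no division.
    H≈ : ∀ x → (fromℚ 1ℚ + κ) * (ρ * x) ≈ x
    H≈ x = ≈-trans (≈-sym (*-assoc _ ρ x)) (≈-trans (*-cong [1+κ]ρ≈1 ≈-refl)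
      (solve 1 (λ x → con 1ℚ :* x := x) ≈-refl x))

  ∣0∣≤ : ∀ {x} → 0# ≤ x → ∣ fromℚ 0ℚ ∣≤ x
  ∣0∣≤ {x} 0≤x = by-slack 0≤x (solve 1 (λ x → x := x :- con 0ℚ) ≈-refl x)
    , by-slack 0≤x (solve 1 (λ x → x := x :- (:- con 0ℚ)) ≈-refl x)

  -- The two-sided bound at stage 0, where the partial sum is 0 and twice `½^ (1 !)` is 1.
  ∣ζ∣≤1 : ∀ i → ∣ ζ i ∣≤ fromℚ 1ℚ
  ∣ζ∣≤1 i = ≤-resp ≈-refl (fromℚ-cong refl) (ζ-upper 0 i)
    , ≤-trans (neg-antimono-≤ (ζ-lower 0 i)) (proj₂ (∣0∣≤ (0≤fromℚ 1ℚ)))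

  -- At `θ = κ` the second bound is `exp 0 = 1` and the first is at least 1, so all `k + 1` unit
  -- points qualify.
  standard-solutions : ∀ {j l} → j ℕ.≤ suc k → 0# ≤ l → IndependentSolutions j l κ
  standard-solutions {j} {l} j≤ 0≤l = fewer-solutions j≤ (δ , standard-basis-independent , solves)
    where
    1≤exp : ∀ {x} → 0# ≤ x → fromℚ 1ℚ ≤ exp x
    1≤exp 0≤x = ≤-resp exp-0 ≈-refl (exp-mono (≤-resp (≈-sym fromℚ-homo-0) ≈-refl 0≤x))
    0≤[1+κ]l : 0# ≤ (fromℚ 1ℚ + κ) * l
    0≤[1+κ]l = (0≤fromℚ 1ℚ ⊕ 0≤κ) ⊛ 0≤l
    0≤0l : 0# ≤ (- κ + κ) * l
    0≤0l = ≤-reflexive (≈-trans (≈-sym fromℚ-homo-0)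
      (solve 2 (λ κ l → con 0ℚ := (:- κ :+ κ) :* l) ≈-refl κ l))
    -1≤1 : - fromℚ 1ℚ ≤ fromℚ 1ℚ
    -1≤1 = by-slack (0≤fromℚ two) (solve 0 (con two := con 1ℚ :- (:- con 1ℚ)) ≈-refl)
    ∣δ∣≤1 : ∀ {n} (i j : Fin n) → ∣ fromℤ (δ i j) ∣≤ fromℚ 1ℚ
    ∣δ∣≤1 i j = fromℤ-mono (δ≤1 i j)
      , ≤-trans (neg-antimono-≤ (fromℤ-mono (0≤δ i j))) (proj₂ (∣0∣≤ (0≤fromℚ 1ℚ)))
    solves : ∀ j → Solution l κ (δ j)
    solves 0F = (1≤exp 0≤[1+κ]l , ≤-trans -1≤1 (1≤exp 0≤[1+κ]l))
      , λ i → ∣∣≤-resp (solve 1 (λ z → z := z :* con 1ℚ :- con 0ℚ) ≈-refl (ζ i)) (1≤exp 0≤0l) (∣ζ∣≤1 i)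
    solves (Fin.suc j) = ∣0∣≤ (exp-nonNeg _)
      , λ i → ∣∣≤-resp (solve 2 (λ z y → :- y := z :* con 0ℚ :- y) ≈-refl (ζ i) (fromℤ (δ j i)))
          (1≤exp 0≤0l) (∣-x∣≤ (∣δ∣≤1 j i))

  module Thresholds (n : ℕ) (ε : Carrier) (0≤ε : 0# ≤ ε) (1≤nε : fromℚ 1ℚ ≤ fromℕ n * ε) where
    open Perturbation n ε 0≤ε 1≤nε public

    M : ℕ
    M = 8 ℕ.* n ℕ.+ 8

    private
      large : ∀ r → M ℕ.≤ suc (r ℕ.+ M)
      large r = ℕₚ.≤-trans (ℕₚ.m≤n+m M r) (ℕₚ.n≤1+n (r ℕ.+ M))

      l≤H : ∀ {l} → 0# ≤ l → l ≤ (fromℚ 1ℚ + κ) * l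
      l≤H {l} 0≤l = by-slack (0≤κ ⊛ 0≤l)
        (solve 2 (λ κ l → κ :* l := (con 1ℚ :+ κ) :* l :- l) ≈-refl κ l)

    -- The scale is the last `m` from `M` on with `2 A m ≤ H`; being last, it also satisfies
    -- `H ≤ 2 A (suc m)`.
    eventually-near-τ : ∀ l → fromℚ two * A M ≤ l → IndependentSolutions 1 l (τ + ε)
    eventually-near-τ l ≤l =
      let 0≤l = ≤-trans (0≤fromℚ two ⊛ 0≤A M) ≤l
          r , H<A = A-unbounded ((fromℚ 1ℚ + κ) * l) M
          s , P , ¬P = last (λ j → fromℚ two * A j ≤ (fromℚ 1ℚ + κ) * l) M (suc r)
            (≤-trans ≤l (l≤H 0≤l)) (λ 2A≤H → H<A (≤-trans (by-slack (0≤A (suc (r ℕ.+ M)))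
              (solve 1 (λ a → a := con two :* a :- a) ≈-refl (A (suc (r ℕ.+ M))))) 2A≤H))
      in Scale.solution-near-τ (s ℕ.+ M) (large s) l 0≤l P (<⇒≤ ¬P)

    eventually-no-triple : ∀ l → A (suc M) ≤ l → ¬ IndependentSolutions 3 l (κ - ε)
    eventually-no-triple l ≤l =
      let 0≤l = ≤-trans (0≤A (suc M)) ≤l
          r , H<A = A-unbounded ((fromℚ 1ℚ + κ) * l) M
          s , P , ¬P = last (λ j → A (suc j) ≤ (fromℚ 1ℚ + κ) * l) M r (≤-trans ≤l (l≤H 0≤l)) H<A
      in Scale.no-triple-below-κ (s ℕ.+ M) (large s) l 0≤l P (<⇒≤ ¬P)

    private
      -- Since `1 + κ ≤ 2`, `x` is at most `2 ρ x`; hence a threshold `2 L` for `x` puts `l = ρ x`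
      -- beyond `L`.
      L<ρb : ∀ {L x} m → M ℕ.≤ suc m → fromℚ two * L < A (suc m) → A (suc m) ≤ x → L < ρ * x
      L<ρb {L} {x} m large′ 2L<b b≤x ρx≤L = 2L<b (≤-trans (≤-resp ≈-refl (≈-sym (H≈ x)) b≤x)
        (≤-trans (Scale.H≤2l m large′ (ρ * x) (0≤ρ ⊛ ≤-trans (0≤A (suc m)) b≤x))
          (*-monoʳ-≤ (0≤fromℚ two) ρx≤L)))

    often-near-−1 : ∀ L → ∃[ l ] (L < l × IndependentSolutions 1 l (fromℤ -1ℤ + ε)
                                       × ¬ IndependentSolutions 2 l (κ - ε))
    often-near-−1 L =
      let r , 2L<b = A-unbounded (fromℚ two * L) M
          m = r ℕ.+ M
          b = A (suc m)
          H≤b = ≤-reflexive (H≈ b)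
          b≤H = ≤-reflexive (≈-sym (H≈ b))
          0≤l = 0≤ρ ⊛ 0≤A (suc m)
      in ρ * b , L<ρb m (large r) 2L<b ≤-refl
       , Scale.solution-near-−1 m (large r) (ρ * b) 0≤l b≤H H≤b
       , Scale.no-pair-below-κ m (large r) (ρ * b) 0≤l b≤H H≤b

    often-crossing : ∀ L → ∃[ l ] (L < l × IndependentSolutions 2 l (τ + ε)
                                        × ¬ IndependentSolutions 1 l (τ - ε))
    often-crossing L =
      let r , 2L<b = A-unbounded (fromℚ two * L) M
          m = r ℕ.+ M
          b = fromℚ two * A (suc m)
          H≤b = ≤-reflexive (H≈ b)
          b≤H = ≤-reflexive (≈-sym (H≈ b))
          0≤l = 0≤ρ ⊛ (0≤fromℚ two ⊛ 0≤A (suc m))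
      in ρ * b , L<ρb m (large r) 2L<b (by-slack (0≤A (suc m))
           (solve 1 (λ a → a := con two :* a :- a) ≈-refl (A (suc m))))
       , Scale.AtCrossing.pair-near-τ m (large r) (ρ * b) 0≤l b≤H H≤b
       , Scale.AtCrossing.no-solution-below-τ m (large r) (ρ * b) 0≤l b≤H H≤b

  -- Attainment of the successive minima

  exp-right-continuous : ∀ {x s l} → 0# ≤ l → (∀ n → x ≤ exp (s + η n * l)) → x ≤ exp s
  exp-right-continuous {x} {s} {l} 0≤l bound = let n₀ , 2l≤n₀ = archimedean (fromℚ two * l) in
    ≤-limit-multiple (exp s * (fromℚ two * l)) n₀ λ n n₀≤n →
      -- `n ≥ 2 l` brings `η n * l` into the range where `exp-near-0` bounds the growth of `exp`
      -- linearly.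
      let ul≤½ = by-slack (0≤fromℚ ½ ⊛ (0≤η n ⊛ slack (≤-trans 2l≤n₀ (fromℕ-mono (ℕₚ.≤-trans n₀≤n (ℕₚ.n≤1+n n))))
                    ⊕ slack (≤-reflexive (η-inverse n))))
                  (solve 3 (λ η l s → con ½ :* (η :* (s :- con two :* l) :+ (con 1ℚ :- η :* s)) := con ½ :- η :* l)
                    ≈-refl (η n) l (fromℕ (suc n)))
      in ≤-trans (bound n) (≤-resp (≈-sym (exp-+ s (η n * l)))
           (solve 3 (λ e η l → e :* (con 1ℚ :+ con two :* (η :* l)) := e :+ η :* (e :* (con two :* l))) ≈-refl (exp s) (η n) l)
           (*-monoʳ-≤ (exp-nonNeg s) (exp-near-0 (0≤η n ⊛ 0≤l) ul≤½)))

  solution-closed : ∀ {l θ} w → 0# ≤ l → (∀ n → Solution l (θ + η n) w) → Solution l θ w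
  solution-closed {l} {θ} w 0≤l sols =
      (limit (λ n → proj₁ (proj₁ (sols n))) , limit (λ n → proj₂ (proj₁ (sols n))))
    , λ i → limit (λ n → proj₁ (proj₂ (sols n) i)) , limit (λ n → proj₂ (proj₂ (sols n) i))
    where
    limit : ∀ {x c} → (∀ n → x ≤ exp ((c + (θ + η n)) * l)) → x ≤ exp ((c + θ) * l)
    limit {c = c} bound = exp-right-continuous 0≤l λ n → ≤-resp ≈-refl
      (exp-cong (solve 4 (λ c θ η l → (c :+ (θ :+ η)) :* l := (c :+ θ) :* l :+ η :* l) ≈-refl c θ (η n) l)) (bound n)

  solution-cong : ∀ {l θ w w′} → (∀ i → w i ≡ w′ i) → Solution l θ w → Solution l θ w′
  solution-cong {w = w} {w′} w≗w′ (bx , by) =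
      ∣∣≤-resp (fromℤ-cong (w≗w′ 0F)) ≤-refl bx
    , λ i → ∣∣≤-resp (+-cong (*-cong ≈-refl (fromℤ-cong (w≗w′ 0F))) (-‿cong (fromℤ-cong (w≗w′ (Fin.suc i))))) ≤-refl (by i)

  -- From `|y| ≤ |ζ x| + |ζ x - y|` and `|ζ| ≤ 1`, the sum of the two bounds serves for every
  -- coordinate.
  solutions-bounded : ∀ l θ → ∃[ B ] (∀ w → Solution l θ w → ∀ i → ℤ.∣ w i ∣ ℕ.≤ B)
  solutions-bounded l θ = B , bounded
    where
    e₁ = exp ((fromℚ 1ℚ + θ) * l)
    e₂ = exp ((- κ + θ) * l)
    B = proj₁ (archimedean (e₁ + e₂))
    e≤B = proj₂ (archimedean (e₁ + e₂))
    bounded : ∀ w → Solution l θ w → ∀ i → ℤ.∣ w i ∣ ℕ.≤ B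
    bounded w (bx , by) 0F = ∣fromℤ∣≤fromℕ {w 0F} (∣∣≤-resp ≈-refl
      (≤-trans (by-slack (exp-nonNeg ((- κ + θ) * l)) (solve 2 (λ e f → f := (e :+ f) :- e) ≈-refl e₁ e₂)) e≤B) bx)
    bounded w (bx , by) (Fin.suc i) = ∣fromℤ∣≤fromℕ {w (Fin.suc i)} (∣∣≤-resp
      (solve 3 (λ z x y → z :* x :+ :- (z :* x :- y) := y) ≈-refl (ζ i) (fromℤ (w 0F)) (fromℤ (w (Fin.suc i))))
      (≤-resp (+-cong (solve 1 (λ e → e := con 1ℚ :* e) ≈-refl e₁) ≈-refl) ≈-refl e≤B)
      (∣x+y∣≤ (∣x*y∣≤ (∣ζ∣≤1 i) bx) (∣-x∣≤ (by i))))

  -- There are finitely many integer points in a box, so for small enough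
  -- η every solution at θ + η in the box is a solution at θ.
  independent-closed : ∀ {j l θ} → 0# ≤ l → (∀ n → IndependentSolutions j l (θ + η n)) → IndependentSolutions j l θ
  independent-closed {j} {l} {θ} 0≤l sols =
    -- A box for `θ + 1` contains the solutions at `θ + η n` for every `n`, because `η n ≤ 1`.
    let B , bounded = solutions-bounded l (θ + fromℚ 1ℚ)
        n , stable  = uniform Stable stable-cong stable-mono eventually-stable B
        v , ind , sol = sols n
    in v , ind , λ i → stable (v i) (bounded (v i) (solution-mono (v i) 0≤l (+-mono-≤ ≤-refl (η≤1 n)) (sol i))) (sol i)
    where
    Stable : Vector ℤ (suc k) → ℕ → Set
    Stable w n = Solution l (θ + η n) w → Solution l θ w
    stable-cong : ∀ {w w′} n → (∀ i → w i ≡ w′ i) → Stable w n → Stable w′ n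
    stable-cong {w} {w′} n eq stable sol = solution-cong {w = w} {w′} eq (stable (solution-cong {w = w′} {w} (sym ∘ eq) sol))
    η-antitone : ∀ {m n} → m ℕ.≤ n → η n ≤ η m
    η-antitone {m} {n} m≤n = by-slack
      (0≤η m ⊛ (0≤η n ⊛ slack (fromℕ-mono (ℕ.s≤s m≤n))))
      (≈-trans (solve 4 (λ a b x y → a :* (b :* (y :- x)) := a :* (b :* y) :- b :* (a :* x)) ≈-refl
          (η m) (η n) (fromℕ (suc m)) (fromℕ (suc n)))
        (≈-trans (+-cong (*-cong ≈-refl (η-inverse n)) (-‿cong (*-cong ≈-refl (η-inverse m))))
          (solve 2 (λ a b → a :* con 1ℚ :- b :* con 1ℚ := a :- b) ≈-refl (η m) (η n))))
    stable-mono : ∀ w {m n} → m ℕ.≤ n → Stable w m → Stable w n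
    stable-mono w m≤n stable sol = stable (solution-mono w 0≤l (+-mono-≤ ≤-refl (η-antitone m≤n)) sol)
    -- If no index were stable, `w` would be a solution at every `θ + η n`, hence at `θ` by
    -- closedness, and index 0 would be stable after all.
    eventually-stable : ∀ w → ∃[ n ] Stable w n
    eventually-stable w = decidable-stable lem λ none → none (0 , λ _ → solution-closed w 0≤l λ n →
      decidable-stable lem λ ¬sol → none (n , λ sol → contradiction sol ¬sol))

  -- Linear independence over the rationals

  private
    open RawMonoidDefs (CommutativeRing.+-rawMonoid commutativeRing) using (sum)

    ∣C∣-sum : ∀ {n} → Vector ℤ n → ℕ
    ∣C∣-sum {zero}  C = 0
    ∣C∣-sum {suc n} C = ℤ.∣ C 0F ∣ ℕ.+ ∣C∣-sum (C ∘ Fin.suc)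

    ∣fromℤ∣≤ : ∀ z → ∣ fromℤ z ∣≤ fromℕ ℤ.∣ z ∣
    ∣fromℤ∣≤ (+ n) = ≤-refl , by-slack (0≤fromℚ two ⊛ fromℕ-nonNeg n)
      (solve 1 (λ n → con two :* n := n :- :- n) ≈-refl (fromℕ n))
    ∣fromℤ∣≤ -[1+ n ] = fromℤ-mono { -[1+ n ]} {+ suc n} ℤ.-≤+ , ≤-reflexive (≈-sym (fromℤ-homo-neg -[1+ n ]))

    combination-error : ∀ {n} (C q : Vector ℤ n) (z : Vector Carrier n) D e →
      (∀ i → ∣ z i * D - fromℤ (q i) ∣≤ e) →
      ∣ sum (λ i → fromℤ (C i) * z i) * D - fromℤ (ℤ-sum (λ i → C i ℤ.* q i)) ∣≤ fromℕ (∣C∣-sum C) * e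
    combination-error {zero} C q z D e _ = ≤-reflexive
        (≈-trans (+-cong (*-cong (≈-sym fromℚ-homo-0) ≈-refl) ≈-refl)
          (solve 2 (λ D e → con 0ℚ :* D :- con 0ℚ := con 0ℚ :* e) ≈-refl D e))
      , ≤-reflexive (≈-trans (-‿cong (+-cong (*-cong (≈-sym fromℚ-homo-0) ≈-refl) ≈-refl))
          (solve 2 (λ D e → :- (con 0ℚ :* D :- con 0ℚ) := con 0ℚ :* e) ≈-refl D e))
    combination-error {suc n} C q z D e bound = ∣∣≤-resp
      (≈-trans (solve 6 (λ c z D q s S → c :* (z :* D :- q) :+ (s :* D :- S) := (c :* z :+ s) :* D :- (c :* q :+ S)) ≈-refl
          (fromℤ (C 0F)) (z 0F) D (fromℤ (q 0F)) s (fromℤ S))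
        (+-cong ≈-refl (-‿cong (≈-sym (≈-trans (fromℤ-homo-+ (C 0F ℤ.* q 0F) S)
          (+-cong (fromℤ-homo-* (C 0F) (q 0F)) ≈-refl))))))
      (≤-reflexive (≈-trans (solve 3 (λ a b e → a :* e :+ b :* e := (a :+ b) :* e) ≈-refl
          (fromℕ ℤ.∣ C 0F ∣) (fromℕ (∣C∣-sum (C ∘ Fin.suc))) e)
        (*-cong (≈-sym (fromℤ-homo-+ (+ ℤ.∣ C 0F ∣) (+ ∣C∣-sum (C ∘ Fin.suc)))) ≈-refl)))
      (∣x+y∣≤ (∣x*y∣≤ (∣fromℤ∣≤ (C 0F)) (bound 0F))
        (combination-error (C ∘ Fin.suc) (q ∘ Fin.suc) (z ∘ Fin.suc) D e (bound ∘ Fin.suc)))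
      where
      s = sum (λ i → fromℤ (C (Fin.suc i)) * z (Fin.suc i))
      S = ℤ-sum (λ i → C (Fin.suc i) ℤ.* q (Fin.suc i))

    scaled-sum : ∀ {n} D (c : Vector ℚ n) (C : Vector ℤ n) (z : Vector Carrier n) →
      (∀ i → D ℚ.* c i ≡ toℚ (C i)) →
      fromℚ D * sum (λ i → fromℚ (c i) * z i) ≈ sum (λ i → fromℤ (C i) * z i)
    scaled-sum {zero}  D c C z DC = zeroʳ (fromℚ D)
    scaled-sum {suc n} D c C z DC = ≈-trans
      (solve 4 (λ D c z s → D :* (c :* z :+ s) := (D :* c) :* z :+ D :* s) ≈-refl (fromℚ D) (fromℚ (c 0F)) (z 0F)
        (sum (λ i → fromℚ (c (Fin.suc i)) * z (Fin.suc i))))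
      (+-cong (*-cong (≈-trans (≈-sym (fromℚ-homo-* D (c 0F))) (fromℚ-cong (DC 0F))) ≈-refl)
        (scaled-sum D (c ∘ Fin.suc) (C ∘ Fin.suc) (z ∘ Fin.suc) (DC ∘ Fin.suc)))

    ℤ-sum-recurrence : ∀ {n} (C q e : Vector ℤ n) r →
      ℤ-sum (λ i → C i ℤ.* (r ℤ.* q i ℤ.+ e i)) ≡ r ℤ.* ℤ-sum (λ i → C i ℤ.* q i) ℤ.+ ℤ-sum (λ i → C i ℤ.* e i)
    ℤ-sum-recurrence {zero}  C q e r = sym (trans (ℤₚ.+-identityʳ (r ℤ.* 0ℤ)) (ℤₚ.*-zeroʳ r))
    ℤ-sum-recurrence {suc n} C q e r = trans
      (cong (λ t → C 0F ℤ.* (r ℤ.* q 0F ℤ.+ e 0F) ℤ.+ t) (ℤ-sum-recurrence (C ∘ Fin.suc) (q ∘ Fin.suc) (e ∘ Fin.suc) r))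
      (solveℤ 6 (λ c r q e S T → c :*′ (r :*′ q :+′ e) :+′ (r :*′ S :+′ T) :=′ r :*′ (c :*′ q :+′ S) :+′ (c :*′ e :+′ T)) refl
        (C 0F) r (q 0F) (e 0F) (ℤ-sum (λ i → C (Fin.suc i) ℤ.* q (Fin.suc i))) (ℤ-sum (λ i → C (Fin.suc i) ℤ.* e (Fin.suc i))))

    -- The integers C₀ dₘ + Σ Cᵢ pₘᵢ tend to 0, hence vanish from some m
    -- on, and consecutive ones differ by a multiple and C at m mod k.
    integer-relation : ∀ C₀ (C : Vector ℤ k) → fromℤ C₀ * fromℚ 1ℚ + sum (λ i → fromℤ (C i) * ζ i) ≈ 0# →
      C₀ ≡ 0ℤ × (∀ i → C i ≡ 0ℤ)
    integer-relation C₀ C relation = C₀≡0 , C≡0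
      where
      S = ∣C∣-sum C
      Z : ℕ → ℤ
      Z m = C₀ ℤ.* d m ℤ.+ ℤ-sum (λ i → C i ℤ.* p m i)
      s = sum (λ i → fromℤ (C i) * ζ i)
      Z≈ : ∀ m → - (s * fromℤ (d m) - fromℤ (ℤ-sum (λ i → C i ℤ.* p m i))) ≈ fromℤ (Z m)
      Z≈ m = ≈-trans (solve 4 (λ s D T c → :- (s :* D :- T) := (c :* D :+ T) :- (c :* con 1ℚ :+ s) :* D) ≈-refl
          s (fromℤ (d m)) (fromℤ (ℤ-sum (λ i → C i ℤ.* p m i))) (fromℤ C₀))
        (≈-trans (+-cong ≈-refl (-‿cong (*-cong (≈-trans relation (≈-sym fromℚ-homo-0)) ≈-refl)))
          (≈-trans (solve 2 (λ x D → x :- con 0ℚ :* D := x) ≈-refl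
              (fromℤ C₀ * fromℤ (d m) + fromℤ (ℤ-sum (λ i → C i ℤ.* p m i))) (fromℤ (d m)))
            (≈-sym (≈-trans (fromℤ-homo-+ (C₀ ℤ.* d m) _) (+-cong (fromℤ-homo-* C₀ (d m)) ≈-refl)))))
      S½^≤½ : fromℕ S * fromℚ (½^ (suc S)) ≤ fromℚ ½
      S½^≤½ = by-slack (0≤fromℚ ½ ⊛ (slack (fromℕ-mono (ℕₚ.<⇒≤ (n<2^n S))) ⊛ 0≤h))
        (≈-trans (≈-trans (solve 3 (λ s t h → con ½ :* ((t :- s) :* h) := con ½ :* (t :* h) :- s :* (con ½ :* h)) ≈-refl
            (fromℕ S) (fromℕ (2 ℕ.^ S)) h)
          (+-cong (*-cong ≈-refl (≈-trans (≈-sym (fromℚ-homo-* (toℚ (+ (2 ℕ.^ S))) (½^ S))) (fromℚ-cong (2^*½^ S))))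
            (-‿cong (*-cong ≈-refl (≈-sym (fromℚ-homo-* ½ (½^ S)))))))
          (+-cong (solve 0 (con ½ :* con 1ℚ := con ½) ≈-refl) ≈-refl))
        where
        h = fromℚ (½^ S)
        0≤h : 0# ≤ h
        0≤h = ≤-resp fromℚ-homo-0 ≈-refl (fromℚ-mono (½^-nonNeg S))
      -- With `A (suc m) ≥ (S + 3) A m` each error is at most `½^ (suc S)`. Weighted by `S`, the sum
      -- of the `|Cᵢ|`, it is still at most `½` because `S ≤ 2 ^ S`.
      exponent≤ : ∀ m → S ℕ.+ 3 ℕ.≤ suc m → A m + log2 - A (suc m) ≤ - (fromℕ (suc S) * log2)
      exponent≤ m large = by-slack
        (slack (≤-resp (*-cong (fromℤ-homo-+ (+ S) (+ 3)) ≈-refl) ≈-refl (A-grows (S ℕ.+ 3) m large))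
          ⊕ (fromℕ-nonNeg S ⊕ 0≤fromℚ two) ⊛ slack (log2≤A m))
        (≈-trans (solve 4 (λ s a b x → (b :- (s :+ con three) :* a) :+ (s :+ con two) :* (a :- x)
            := :- ((con 1ℚ :+ s) :* x) :- (a :+ x :- b)) ≈-refl (fromℕ S) (A m) (A (suc m)) log2)
          (+-cong (-‿cong (*-cong (≈-sym (fromℤ-homo-+ 1ℤ (+ S))) ≈-refl)) ≈-refl))
      Z≡0 : ∀ m → S ℕ.+ 3 ℕ.≤ suc m → Z m ≡ 0ℤ
      Z≡0 m large = fromℤ-small (Z m) (∣∣≤-resp (Z≈ m)
        (≤-trans (*-monoʳ-≤ (fromℕ-nonNeg S) (≤-resp ≈-refl (exp-neg-multiple (suc S)) (exp-mono (exponent≤ m large)))) S½^≤½)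
        (∣-x∣≤ (combination-error C (p m) ζ (fromℤ (d m)) _ (error≤next m))))
      Z-suc : ∀ m → Z (suc m) ≡ ratio m ℤ.* Z m ℤ.+ C (m mod k)
      Z-suc m = trans (cong₂ ℤ._+_ (cong (C₀ ℤ.*_) (d-suc m))
          (trans (ℤ-sum-recurrence C (p m) (δ (m mod k)) (ratio m))
            (cong (λ t → ratio m ℤ.* ℤ-sum (λ i → C i ℤ.* p m i) ℤ.+ t)
              (trans (ℤ-sum-cong (λ i → cong (C i ℤ.*_) (δ-sym (m mod k) i))) (ℤ-sum-δ C (m mod k))))))
        (solveℤ 5 (λ c d r T e → c :*′ (d :*′ r) :+′ (r :*′ T :+′ e) :=′ r :*′ (c :*′ d :+′ T) :+′ e) refl
          C₀ (d m) (ratio m) (ℤ-sum (λ i → C i ℤ.* p m i)) (C (m mod k)))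
      C≡0 : ∀ i → C i ≡ 0ℤ
      C≡0 i = subst (λ j → C j ≡ 0ℤ) m≡i (trans (sym (trans (Z-suc m)
          (trans (cong (λ z → ratio m ℤ.* z ℤ.+ C (m mod k)) (Z≡0 m (ℕₚ.≤-trans large (ℕₚ.n≤1+n m))))
            (trans (cong (ℤ._+ C (m mod k)) (ℤₚ.*-zeroʳ (ratio m))) (ℤₚ.+-identityˡ (C (m mod k)))))))
          (Z≡0 (suc m) (ℕₚ.≤-trans large (ℕₚ.≤-trans (ℕₚ.n≤1+n m) (ℕₚ.n≤1+n (suc m))))))
        where
        -- A stage that is late enough and has residue `i` modulo `k`, so that the step from it
        -- introduces `C i`.
        m = toℕ i ℕ.+ (S ℕ.+ 3) ℕ.* k
        large : S ℕ.+ 3 ℕ.≤ m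
        large = ℕₚ.≤-trans (ℕₚ.≤-trans (ℕₚ.≤-reflexive (sym (ℕₚ.*-identityʳ (S ℕ.+ 3))))
          (ℕₚ.*-monoʳ-≤ (S ℕ.+ 3) (ℕ.>-nonZero⁻¹ k))) (ℕₚ.m≤n+m ((S ℕ.+ 3) ℕ.* k) (toℕ i))
        m≡i : m mod k ≡ i
        m≡i = Finₚ.toℕ-injective (trans (Finₚ.toℕ-fromℕ< _)
          (trans ([m+kn]%n≡m%n (toℕ i) (S ℕ.+ 3) k) (m<n⇒m%n≡m (Finₚ.toℕ<n i))))
      C₀≡0 : C₀ ≡ 0ℤ
      C₀≡0 = d-cancelʳ m (trans (sym (trans
          (cong (λ t → C₀ ℤ.* d m ℤ.+ t) (trans (ℤ-sum-cong (λ i → trans (cong (ℤ._* p m i) (C≡0 i)) (sym (ℤₚ.*-zeroʳ 0ℤ)))) (ℤ-sum-*0 {k} (λ _ → 0ℤ))))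
          (ℤₚ.+-identityʳ (C₀ ℤ.* d m)))) (Z≡0 m (ℕₚ.n≤1+n m)))
        where
        m = S ℕ.+ 3

  independent-over-ℚ : (c : Vector ℚ (suc k)) →
    sum (λ i → fromℚ (c i) * (fromℚ 1ℚ ∷ ζ) i) ≈ 0# → ∀ i → c i ≡ 0ℚ
  independent-over-ℚ c relation =
    let D , C , DC = common-denominator c
        C₀≡0 , C≡0 = integer-relation (C 0F) (C ∘ Fin.suc)
          (≈-trans (≈-sym (scaled-sum (toℚ (+ suc D)) c C (fromℚ 1ℚ ∷ ζ) DC))
            (≈-trans (*-cong ≈-refl relation) (zeroʳ (fromℚ (toℚ (+ suc D))))))
    in λ { 0F    → cancel D C DC 0F C₀≡0
         ; (Fin.suc i) → cancel D C DC (Fin.suc i) (C≡0 i) }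
    where
    Dp≡0⇒p≡0 : ∀ D q → toℚ (+ suc D) ℚ.* q ≡ 0ℚ → q ≡ 0ℚ
    Dp≡0⇒p≡0 D q Dq≡0 = trans (sym (ℚₚ.*-identityˡ q)) (trans
      (cong (ℚ._* q) (sym (1/n*n≡1 (suc D)))) (trans (ℚₚ.*-assoc (1ℤ ℚ./ suc D) (toℚ (+ suc D)) q)
      (trans (cong ((1ℤ ℚ./ suc D) ℚ.*_) Dq≡0) (ℚₚ.*-zeroʳ (1ℤ ℚ./ suc D)))))
    cancel : ∀ D (C : Vector ℤ (suc k)) → (∀ i → toℚ (+ suc D) ℚ.* c i ≡ toℚ (C i)) → ∀ i → C i ≡ 0ℤ → c i ≡ 0ℚ
    cancel D C DC i Ci≡0 = Dp≡0⇒p≡0 D (c i) (trans (DC i) (cong toℚ Ci≡0))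

  -- Positivity together with a natural number bounding the reciprocal. It is required of `ε`, and
  -- also of `l = log Q`.
  Tolerance : Carrier → Set
  Tolerance ε = 0# ≤ ε × (∃[ n ] fromℚ 1ℚ ≤ fromℕ n * ε)

  log2-multiple : ∀ {l} → Tolerance l → ∃[ n ] log2 ≤ fromℕ n * l
  log2-multiple {l} (_ , n , 1≤nl) = let C , log2≤C = archimedean log2 in C ℕ.* n
    , by-slack (slack log2≤C ⊕ fromℕ-nonNeg C ⊛ slack 1≤nl)
        (≈-trans (solve 4 (λ C n l x → (C :- x) :+ C :* (n :* l :- con 1ℚ) := (C :* n) :* l :- x) ≈-refl
            (fromℕ C) (fromℕ n) l log2)
          (+-cong (*-cong (≈-sym (fromℕ-homo-* C n)) ≈-refl) ≈-refl))

  -- For Q = exp l this minimum is ψⱼ(Q).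
  minimum-exists : Cuts R → ∀ {j l} → 1 ℕ.≤ j → j ℕ.≤ suc k → Tolerance l →
    Σ Carrier λ ψ → IndependentSolutions j l ψ × (∀ θ → IndependentSolutions j l θ → ψ ≤ θ)
  minimum-exists cuts {j} {l} 1≤j j≤ tolerance@(0≤l , _) =
    let ψ , bracket = cuts (λ r → ¬ IndependentSolutions j l (fromℚ r)) a (1ℤ ℚ./ k) a≤κ none (λ none → none standard)
    in ψ
     -- The upper ends of the brackets admit solutions and exceed `ψ` by at most `η n`, so `ψ + η n`
     -- admits solutions for every `n`.
     , independent-closed 0≤l (λ n → let p , q , _ , some , p≤ψ , _ , q≤p+η = bracket n in
         independent-mono 0≤l (≤-trans (fromℚ-mono q≤p+η)
           (≤-resp (≈-sym (fromℚ-homo-+ p (1ℤ ℚ./ suc n))) ≈-refl (+-mono-≤ p≤ψ ≤-refl))) (decidable-stable lem some))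
     , λ θ sols → ≤-limit λ n → let p , q , none , _ , _ , ψ≤q , q≤p+η = bracket n in
         ≤-trans ψ≤q (≤-trans (≤-resp ≈-refl (fromℚ-homo-+ p (1ℤ ℚ./ suc n)) (fromℚ-mono q≤p+η))
           (+-mono-≤ (<⇒≤ λ θ≤p → none (independent-mono 0≤l θ≤p sols)) ≤-refl))
    where
    n = proj₁ (log2-multiple tolerance)
    a : ℚ
    -- As `n l ≥ log 2`, the bound `no-solution-below-−1` applies with `n` in the role of `ε`, so
    -- the bisection may start at `-1 - n`.
    a = toℚ -1ℤ ℚ.- toℚ (+ n)
    a≈ : fromℚ a ≈ fromℤ -1ℤ - fromℕ n
    a≈ = ≈-trans (fromℚ-homo-+ (toℚ -1ℤ) (ℚ.- toℚ (+ n))) (+-cong ≈-refl (fromℚ-homo-- (toℚ (+ n))))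
    standard : IndependentSolutions j l κ
    standard = standard-solutions j≤ 0≤l
    none : ¬ IndependentSolutions j l (fromℚ a)
    none sols = no-solution-below-−1 0≤l (proj₂ (log2-multiple tolerance))
      (fewer-solutions 1≤j (independent-mono 0≤l (≤-reflexive a≈) sols))
    a≤κ : a ℚ.≤ 1ℤ ℚ./ k
    a≤κ = [ id , (λ κ≤a → contradiction (independent-mono 0≤l (fromℚ-mono κ≤a) standard) none) ]′
      (ℚₚ.≤-total a (1ℤ ℚ./ k))

  -- Lower and upper limits

  Eventually Often : (Carrier → Set) → Set
  -- `0 ≤ L` ensures `exp L ≥ 1`, so that the corresponding threshold for `Q` stays in the range
  -- `Q > 1`.
  Eventually P = ∃[ L ] (0# ≤ L × (∀ l → L ≤ l → P l))
  Often P = ∀ L → ∃[ l ] (L < l × P l)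

  liminf limsup : ℕ → Carrier
  -- A default outside the range of indices.
  liminf 0             = fromℤ -1ℤ
  liminf 1             = fromℤ -1ℤ
  liminf 2             = τ
  liminf (suc (suc (suc _))) = κ
  -- The claimed equality is built into the table of values; its content lies in the four families
  -- of bounds that follow.
  limsup j = liminf (suc j)

  private
    larger : ∀ {c ε} → 0# ≤ ε → c ≤ c + ε
    larger {c} {ε} 0≤ε = by-slack 0≤ε (solve 2 (λ c e → e := (c :+ e) :- c) ≈-refl c ε)

  eventually-above-liminf : ∀ j → 1 ℕ.≤ j → ∀ {ε} → Tolerance ε →
    Eventually λ l → ¬ IndependentSolutions j l (liminf j - ε)
  eventually-above-liminf 1 _ {ε} (0≤ε , n , 1≤nε) =
    fromℕ n * log2 , 0≤N , λ l ≤l → no-solution-below-−1 (≤-trans 0≤N ≤l) (Thresholds.log2≤εl n ε 0≤ε 1≤nε ≤l)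
    where 0≤N = fromℕ-nonNeg n ⊛ 0≤log2
  eventually-above-liminf 2 _ {ε} (0≤ε , n , 1≤nε) =
    fromℕ n * log2 , fromℕ-nonNeg n ⊛ 0≤log2 , Thresholds.no-pair-below-τ n ε 0≤ε 1≤nε
  eventually-above-liminf (suc (suc (suc j))) _ {ε} (0≤ε , n , 1≤nε) =
    A (suc M) , 0≤A (suc M) , λ l ≤l sols →
      Thresholds.eventually-no-triple n ε 0≤ε 1≤nε l ≤l (fewer-solutions (ℕ.s≤s (ℕ.s≤s (ℕ.s≤s ℕ.z≤n))) sols)
    where M = Thresholds.M n ε 0≤ε 1≤nε

  often-below-liminf : ∀ j → 1 ℕ.≤ j → j ℕ.≤ suc k → ∀ {ε} → Tolerance ε →
    Often λ l → IndependentSolutions j l (liminf j + ε)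
  often-below-liminf 1 _ _ {ε} (0≤ε , n , 1≤nε) L =
    let l , L<l , sols , _ = Thresholds.often-near-−1 n ε 0≤ε 1≤nε L in l , L<l , sols
  often-below-liminf 2 _ _ {ε} (0≤ε , n , 1≤nε) L =
    let l , L<l , sols , _ = Thresholds.often-crossing n ε 0≤ε 1≤nε L in l , L<l , sols
  often-below-liminf (suc (suc (suc j))) _ j≤ {ε} (0≤ε , _) L =
    let n , L≤n = archimedean L
        0≤l = fromℕ-nonNeg (suc n)
    in fromℕ (suc n)
     , (λ l≤L → ℕₚ.<⇒≱ (ℕₚ.n<1+n n) (ℤₚ.drop‿+≤+ (fromℤ-cancel {+ suc n} {+ n} (≤-trans l≤L L≤n))))
     , independent-mono 0≤l (larger 0≤ε) (standard-solutions j≤ 0≤l)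

  eventually-below-limsup : ∀ j → 1 ℕ.≤ j → j ℕ.≤ suc k → ∀ {ε} → Tolerance ε →
    Eventually λ l → IndependentSolutions j l (limsup j + ε)
  eventually-below-limsup 1 _ _ {ε} (0≤ε , n , 1≤nε) =
    fromℚ two * A M , 0≤fromℚ two ⊛ 0≤A M , Thresholds.eventually-near-τ n ε 0≤ε 1≤nε
    where M = Thresholds.M n ε 0≤ε 1≤nε
  eventually-below-limsup (suc (suc j)) _ j≤ (0≤ε , _) =
    0# , ≤-refl , λ l 0≤l → independent-mono 0≤l (larger 0≤ε) (standard-solutions j≤ 0≤l)

  often-above-limsup : ∀ j → 1 ℕ.≤ j → ∀ {ε} → Tolerance ε →
    Often λ l → ¬ IndependentSolutions j l (limsup j - ε)
  often-above-limsup 1 _ {ε} (0≤ε , n , 1≤nε) L =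
    let l , L<l , _ , none = Thresholds.often-crossing n ε 0≤ε 1≤nε L in l , L<l , none
  often-above-limsup (suc (suc j)) _ {ε} (0≤ε , n , 1≤nε) L =
    let l , L<l , _ , none = Thresholds.often-near-−1 n ε 0≤ε 1≤nε L
    in l , L<l , λ sols → none (fewer-solutions (ℕ.s≤s (ℕ.s≤s ℕ.z≤n)) sols)

-- The rational exponential series

module PartialSums where
  open Q

  2ℚ : ℚ
  2ℚ = toℚ (+ 2)

  ∑ : (ℕ → ℚ) → ℕ → ℚ
  ∑ f zero    = 0ℚ
  ∑ f (suc n) = ∑ f n + f n

  ∑-cong : ∀ {f g} n → (∀ i → i ℕ.< n → f i ≡ g i) → ∑ f n ≡ ∑ g n
  ∑-cong zero    eq = refl
  ∑-cong (suc n) eq = cong₂ _+_ (∑-cong n λ i i<n → eq i (ℕₚ.<-trans i<n (ℕₚ.n<1+n n))) (eq n (ℕₚ.n<1+n n))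

  ∑-shift : ∀ f n → ∑ f (suc n) ≡ f 0 + ∑ (f ∘ suc) n
  ∑-shift f zero    = ℚₚ.+-comm 0ℚ (f 0)
  ∑-shift f (suc n) = trans (cong (_+ f (suc n)) (∑-shift f n)) (ℚₚ.+-assoc (f 0) (∑ (f ∘ suc) n) (f (suc n)))

  ∑-+ : ∀ f g n → ∑ (λ i → f i + g i) n ≡ ∑ f n + ∑ g n
  ∑-+ f g zero    = refl
  ∑-+ f g (suc n) = trans (cong (_+ (f n + g n)) (∑-+ f g n))
    (solve 4 (λ a b c d → (a :+ b) :+ (c :+ d) := (a :+ c) :+ (b :+ d)) refl (∑ f n) (∑ g n) (f n) (g n))

  ∑-*ˡ : ∀ c f n → ∑ (λ i → c * f i) n ≡ c * ∑ f n
  ∑-*ˡ c f zero    = sym (ℚₚ.*-zeroʳ c)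
  ∑-*ˡ c f (suc n) = trans (cong (_+ c * f n) (∑-*ˡ c f n)) (sym (ℚₚ.*-distribˡ-+ c (∑ f n) (f n)))

  ∑-*ʳ : ∀ c f n → ∑ (λ i → f i * c) n ≡ ∑ f n * c
  ∑-*ʳ c f n = trans (∑-cong n λ i _ → ℚₚ.*-comm (f i) c) (trans (∑-*ˡ c f n) (ℚₚ.*-comm c (∑ f n)))

  ∑-abs : ∀ {f g} n → (∀ i → i ℕ.< n → ∣ f i ∣≤ g i) → ∣ ∑ f n ∣≤ ∑ g n
  ∑-abs zero    bound = ≤-refl , ≤-refl
  ∑-abs (suc n) bound = ∣x+y∣≤ (∑-abs n λ i i<n → bound i (ℕₚ.<-trans i<n (ℕₚ.n<1+n n))) (bound n (ℕₚ.n<1+n n))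

  ∑-mono-length : ∀ {f} n r → (∀ i → 0ℚ ≤ f i) → ∑ f n ≤ ∑ f (r ℕ.+ n)
  ∑-mono-length n zero    0≤f = ≤-refl
  ∑-mono-length {f} n (suc r) 0≤f = ≤-trans (∑-mono-length n r 0≤f)
    (by-slack (0≤f (r ℕ.+ n)) (solve 2 (λ s t → t := (s :+ t) :- s) refl (∑ f (r ℕ.+ n)) (f (r ℕ.+ n))))

  u : ℕ → ℚ
  u n = 1ℤ ℚ./ suc n

  0≤u : ∀ n → 0ℚ ≤ u n
  0≤u n = 0≤fromℚ (u n) {{ℚₚ.normalize-nonNeg 1 (suc n)}}

  -- This is `p ^ i / i !`, given by the ratio of consecutive terms, on which both the tail bound
  -- and the product formula rest.
  term : ℚ → ℕ → ℚ
  term p zero    = 1ℚ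
  term p (suc i) = term p i * p * u i

  S : ℚ → ℕ → ℚ
  S p = ∑ (term p)

  [1+i]term : ∀ p i → toℚ (+ suc i) * term p (suc i) ≡ p * term p i
  [1+i]term p i = trans
    (solve 4 (λ n t p u → n :* (t :* p :* u) := (u :* n) :* (p :* t)) refl (toℚ (+ suc i)) (term p i) p (u i))
    (trans (cong (_* (p * term p i)) (1/n*n≡1 (suc i))) (ℚₚ.*-identityˡ (p * term p i)))

  ∣term∣≤ : ∀ {p K} → ∣ p ∣≤ K → ∀ i → ∣ term p i ∣≤ term K i
  ∣term∣≤ ∣p∣≤K zero    = ≤-refl , ≤-trans (fromℚ-mono (ℚₚ.nonPositive⁻¹ (ℚ.- 1ℚ))) (0≤fromℚ 1ℚ)
  ∣term∣≤ ∣p∣≤K (suc i) = ∣x*y∣≤ (∣x*y∣≤ (∣term∣≤ ∣p∣≤K i) ∣p∣≤K)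
    (≤-refl , ≤-trans (neg-antimono-≤ (0≤u i)) (0≤u i))

  0≤term : ∀ {K} → 0ℚ ≤ K → ∀ i → 0ℚ ≤ term K i
  0≤term 0≤K zero    = 0≤fromℚ 1ℚ
  0≤term 0≤K (suc i) = 0≤term 0≤K i ⊛ 0≤K ⊛ 0≤u i

  term-halves : ∀ {K} → 0ℚ ≤ K → ∀ i → 2ℚ * K ≤ toℚ (+ suc i) → term K (suc i) ≤ ½ * term K i
  term-halves {K} 0≤K i 2K≤ = by-slack
    (0≤fromℚ ½ ⊛ (0≤term 0≤K i ⊛ (0≤u i ⊛ slack 2K≤)))
    (trans (solve 4 (λ t u n K → con ½ :* (t :* (u :* (n :- con 2ℚ :* K)))
        := con ½ :* (t :* (u :* n)) :- t :* K :* u) refl (term K i) (u i) (toℚ (+ suc i)) K)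
      (cong (λ x → ½ * x - term K (suc i)) (trans (cong (term K i *_) (1/n*n≡1 (suc i))) (ℚₚ.*-identityʳ (term K i)))))

  tail-bound : ∀ {p K} N → 0ℚ ≤ K → 2ℚ * K ≤ toℚ (+ suc N) → ∣ p ∣≤ K →
               ∀ r → ∣ S p (r ℕ.+ N) - S p N ∣≤ (2ℚ * term K N)
  tail-bound {p} {K} N 0≤K 2K≤ ∣p∣≤K r = ∣∣≤-resp refl
    (by-slack (0≤fromℚ 2ℚ ⊛ 0≤term 0≤K (r ℕ.+ N))
      (solve 2 (λ a b → con 2ℚ :* b := con 2ℚ :* a :- (con 2ℚ :* a :- con 2ℚ :* b)) refl (term K N) (term K (r ℕ.+ N))))
    (halving-tail (S p) (term K) N
      (λ i _ → ∣∣≤-resp (solve 2 (λ s t → t := (s :+ t) :- s) refl (S p i) (term p i)) ≤-refl (∣term∣≤ ∣p∣≤K i))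
      (λ i N≤i → term-halves 0≤K i (≤-trans 2K≤ (toℚ-mono-≤ (ℤ.+≤+ (ℕ.s≤s N≤i))))) r)

  -- The exponent is split as `C + n`: `½^ C` absorbs `c ≤ C ≤ 2 ^ C`, and `½^ n ≤ 1 / (n + 1) ≤ ε`.
  ½^-small : ∀ c ε → 0ℚ ℚ.< ε → ∃[ j ] c * ½^ j ≤ ε
  ½^-small c ε 0<ε =
    let n , u≤ε = 1/n≤p ε 0<ε
        C , c≤C = archimedean c
    in C ℕ.+ n , ≤-trans (≤-resp (trans (ℚₚ.*-assoc c (½^ C) (½^ n)) (cong (c *_) (sym (½^-+ C n)))) (ℚₚ.*-identityˡ (½^ n))
         (≤-trans (≤-reflexive (ℚₚ.*-comm (c * ½^ C) (½^ n))) (≤-trans (*-monoʳ-≤ (½^-nonNeg n) (c½^C≤1 C c≤C)) (≤-reflexive (ℚₚ.*-comm (½^ n) 1ℚ)))))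
       (≤-trans (½^≤u n) u≤ε)
    where
    c½^C≤1 : ∀ C → c ≤ toℚ (+ C) → c * ½^ C ≤ 1ℚ
    c½^C≤1 C c≤C = by-slack (slack (≤-trans c≤C (toℚ-mono-≤ (ℤ.+≤+ (ℕₚ.≤-trans (ℕₚ.n≤1+n C) (n<2^n C))))) ⊛ ½^-nonNeg C)
      (trans (solve 3 (λ t c h → (t :- c) :* h := t :* h :- c :* h) refl (toℚ (+ (2 ℕ.^ C))) c (½^ C))
        (cong (_- c * ½^ C) (2^*½^ C)))
    ½^≤u : ∀ n → ½^ n ≤ u n
    ½^≤u n = by-slack (½^-nonNeg n ⊛ (0≤u n ⊛ slack (toℚ-mono-≤ (ℤ.+≤+ (n<2^n n)))))
      (trans (solve 4 (λ h u t n → h :* (u :* (t :- n)) := u :* (t :* h) :- h :* (u :* n)) refl (½^ n) (u n) (toℚ (+ (2 ℕ.^ n))) (toℚ (+ suc n)))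
        (cong₂ (λ x y → u n * x - ½^ n * y) (2^*½^ n) (1/n*n≡1 (suc n)) ⟨trans⟩
          solve 2 (λ u h → u :* con 1ℚ :- h :* con 1ℚ := u :- h) refl (u n) (½^ n)))
      where
      _⟨trans⟩_ : ∀ {A : Set} {x y z : A} → x ≡ y → y ≡ z → x ≡ z
      _⟨trans⟩_ = trans

  -- From index `2 K` on each term is at most half of its predecessor, so `j` further steps gain a
  -- factor `½^ j`.
  term-vanishes : ∀ K ε → 0ℚ ℚ.< ε →
    ∃[ N ] (2ℚ * toℚ (+ K) ≤ toℚ (+ suc N) × (2ℚ * term (toℚ (+ K)) N ≤ ε))
  term-vanishes K ε 0<ε = let j , c½^j≤ε = ½^-small (2ℚ * term κ N₀) ε 0<ε in
    j ℕ.+ N₀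
    , ≤-trans large (toℚ-mono-≤ (ℤ.+≤+ (ℕ.s≤s (ℕₚ.m≤n+m N₀ j))))
    , ≤-trans (*-monoʳ-≤ (0≤fromℚ 2ℚ) (term≤ j)) (≤-trans (≤-reflexive
        (solve 3 (λ h t a → t :* (h :* a) := (t :* a) :* h) refl (½^ j) 2ℚ (term κ N₀))) c½^j≤ε)
    where
    κ = toℚ (+ K)
    0≤κ : 0ℚ ≤ κ
    0≤κ = 0≤toℚ K
    N₀ = 2 ℕ.* K
    large : 2ℚ * κ ≤ toℚ (+ suc N₀)
    large = ≤-trans (≤-reflexive (trans (sym (toℚ-homo-* (+ 2) (+ K))) (cong toℚ (sym (ℤₚ.pos-* 2 K)))))
      (toℚ-mono-≤ (ℤ.+≤+ (ℕₚ.n≤1+n N₀)))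
    term≤ : ∀ j → term κ (j ℕ.+ N₀) ≤ ½^ j * term κ N₀
    term≤ zero    = ≤-reflexive (sym (ℚₚ.*-identityˡ (term κ N₀)))
    term≤ (suc j) = ≤-trans (term-halves 0≤κ (j ℕ.+ N₀) (≤-trans large (toℚ-mono-≤ (ℤ.+≤+ (ℕ.s≤s (ℕₚ.m≤n+m N₀ j))))))
      (≤-trans (*-monoʳ-≤ (0≤fromℚ ½) (term≤ j)) (≤-reflexive (sym (ℚₚ.*-assoc ½ (½^ j) (term κ N₀)))))

  -- The Cauchy product of the series of p and q is the series of p + q,
  -- because both sides satisfy (n + 1) cₙ₊₁ = (p + q) cₙ.
  convolution : ℚ → ℚ → ℕ → ℚ
  convolution p q n = ∑ (λ i → term p i * term q (n ∸ i)) (suc n)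

  convolution-recurrence : ∀ p q n → toℚ (+ suc n) * convolution p q (suc n) ≡ (p + q) * convolution p q n
  convolution-recurrence p q n = begin
    toℚ (+ suc n) * ∑ c (suc (suc n))
      ≡⟨ sym (∑-*ˡ (toℚ (+ suc n)) c (suc (suc n))) ⟩
    ∑ (λ i → toℚ (+ suc n) * c i) (suc (suc n))
      ≡⟨ ∑-cong (suc (suc n)) split ⟩
    ∑ (λ i → F i + G i) (suc (suc n))
      ≡⟨ ∑-+ F G (suc (suc n)) ⟩
    ∑ F (suc (suc n)) + ∑ G (suc (suc n))
      ≡⟨ cong₂ _+_ ∑F ∑G ⟩
    p * convolution p q n + q * convolution p q n
      ≡⟨ sym (ℚₚ.*-distribʳ-+ (convolution p q n) p q) ⟩
    (p + q) * convolution p q n ∎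
    where
    open ≡-Reasoning
    c F G : ℕ → ℚ
    c i = term p i * term q (suc n ∸ i)
    F i = (toℚ (+ i) * term p i) * term q (suc n ∸ i)
    G i = term p i * (toℚ (+ (suc n ∸ i)) * term q (suc n ∸ i))
    split : ∀ i → i ℕ.< suc (suc n) → toℚ (+ suc n) * c i ≡ F i + G i
    split i (ℕ.s≤s i≤1+n) = trans
      (cong (_* c i) (trans (cong (toℚ ∘ +_) (sym (ℕₚ.m+[n∸m]≡n i≤1+n))) (toℚ-homo-+ (+ i) (+ (suc n ∸ i)))))
      (solve 4 (λ a b s t → (a :+ b) :* (s :* t) := (a :* s) :* t :+ s :* (b :* t)) refl
        (toℚ (+ i)) (toℚ (+ (suc n ∸ i))) (term p i) (term q (suc n ∸ i)))
    ∑F : ∑ F (suc (suc n)) ≡ p * convolution p q n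
    ∑F = begin
      ∑ F (suc (suc n))
        ≡⟨ ∑-shift F (suc n) ⟩
      F 0 + ∑ (F ∘ suc) (suc n)
        ≡⟨ cong₂ _+_ (ℚₚ.*-zeroˡ (term q (suc n))) (∑-cong (suc n) λ i _ →
            trans (cong (_* term q (n ∸ i)) ([1+i]term p i)) (ℚₚ.*-assoc p (term p i) (term q (n ∸ i)))) ⟩
      0ℚ + ∑ (λ i → p * (term p i * term q (n ∸ i))) (suc n)
        ≡⟨ trans (ℚₚ.+-identityˡ _) (∑-*ˡ p _ (suc n)) ⟩
      p * convolution p q n ∎
    ∑G : ∑ G (suc (suc n)) ≡ q * convolution p q n
    ∑G = begin
      ∑ G (suc n) + term p (suc n) * (toℚ (+ (n ∸ n)) * term q (n ∸ n))
        ≡⟨ cong (λ x → ∑ G (suc n) + x) (trans (cong (λ m → term p (suc n) * (toℚ (+ m) * term q m)) (ℕₚ.n∸n≡0 n))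
             (ℚₚ.*-zeroʳ (term p (suc n)))) ⟩
      ∑ G (suc n) + 0ℚ
        ≡⟨ ℚₚ.+-identityʳ _ ⟩
      ∑ G (suc n)
        ≡⟨ ∑-cong (suc n) (λ { i (ℕ.s≤s i≤n) → trans
             (cong (λ m → term p i * (toℚ (+ m) * term q m)) (ℕₚ.+-∸-assoc 1 i≤n))
             (trans (cong (term p i *_) ([1+i]term q (n ∸ i)))
               (solve 3 (λ a b c → a :* (b :* c) := b :* (a :* c)) refl (term p i) q (term q (n ∸ i)))) }) ⟩
      ∑ (λ i → q * (term p i * term q (n ∸ i))) (suc n)
        ≡⟨ ∑-*ˡ q _ (suc n) ⟩
      q * convolution p q n ∎

  convolution≡term : ∀ p q n → convolution p q n ≡ term (p + q) n
  convolution≡term p q zero    = refl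
  convolution≡term p q (suc n) = begin
    convolution p q (suc n)
      ≡⟨ sym (ℚₚ.*-identityˡ _) ⟩
    1ℚ * convolution p q (suc n)
      ≡⟨ cong (_* convolution p q (suc n)) (sym (1/n*n≡1 (suc n))) ⟩
    (u n * toℚ (+ suc n)) * convolution p q (suc n)
      ≡⟨ ℚₚ.*-assoc (u n) (toℚ (+ suc n)) (convolution p q (suc n)) ⟩
    u n * (toℚ (+ suc n) * convolution p q (suc n))
      ≡⟨ cong (u n *_) (trans (convolution-recurrence p q n) (cong ((p + q) *_) (convolution≡term p q n))) ⟩
    u n * ((p + q) * term (p + q) n)
      ≡⟨ solve 3 (λ u s t → u :* (s :* t) := t :* s :* u) refl (u n) (p + q) (term (p + q) n) ⟩
    term (p + q) (suc n) ∎
    where open ≡-Reasoning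

  -- The double sum of `term p i * term q j` over `i + j < n`, summed by rows.
  triangle : ℚ → ℚ → ℕ → ℚ
  triangle p q n = ∑ (λ i → term p i * S q (n ∸ i)) n

  triangle≡S : ∀ p q n → triangle p q n ≡ S (p + q) n
  triangle≡S p q zero    = refl
  triangle≡S p q (suc n) = begin
    ∑ (λ i → term p i * S q (suc n ∸ i)) (suc n)
      ≡⟨ ∑-cong (suc n) (λ { i (ℕ.s≤s i≤n) → trans (cong (λ m → term p i * S q m) (ℕₚ.+-∸-assoc 1 i≤n))
           (ℚₚ.*-distribˡ-+ (term p i) (S q (n ∸ i)) (term q (n ∸ i))) }) ⟩
    ∑ (λ i → term p i * S q (n ∸ i) + term p i * term q (n ∸ i)) (suc n)
      ≡⟨ ∑-+ _ _ (suc n) ⟩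
    (triangle p q n + term p n * S q (n ∸ n)) + convolution p q n
      ≡⟨ cong₂ _+_ (trans (cong (λ m → triangle p q n + term p n * S q m) (ℕₚ.n∸n≡0 n))
           (trans (cong (λ x → triangle p q n + x) (ℚₚ.*-zeroʳ (term p n))) (ℚₚ.+-identityʳ (triangle p q n)))) (convolution≡term p q n) ⟩
    triangle p q n + term (p + q) n
      ≡⟨ cong (_+ term (p + q) n) (triangle≡S p q n) ⟩
    S (p + q) (suc n) ∎
    where open ≡-Reasoning

  -- The product of partial sums runs over a square and `S (p + q) n` over the triangle inside it;
  -- the right side collects the pairs with `i + j ≥ n`.
  product-error : ∀ p q n → S p n * S q n - S (p + q) n ≡ ∑ (λ i → term p i * (S q n - S q (n ∸ i))) n
  product-error p q n = begin
    S p n * S q n - S (p + q) n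
      ≡⟨ cong₂ (λ a b → a - b) (sym (∑-*ʳ (S q n) (term p) n)) (sym (triangle≡S p q n)) ⟩
    A - triangle p q n
      ≡⟨ cong (λ b → b - triangle p q n) (trans (∑-cong n λ i _ →
           solve 3 (λ t a b → t :* a := t :* (a :- b) :+ t :* b) refl (term p i) (S q n) (S q (n ∸ i))) (∑-+ _ _ n)) ⟩
    (D + triangle p q n) - triangle p q n
      ≡⟨ solve 2 (λ d t → (d :+ t) :- t := d) refl D (triangle p q n) ⟩
    D ∎
    where
    open ≡-Reasoning
    A = ∑ (λ i → term p i * S q n) n
    D = ∑ (λ i → term p i * (S q n - S q (n ∸ i))) n

  S-difference : ∀ {q K} → ∣ q ∣≤ K → ∀ m r → ∣ S q (r ℕ.+ m) - S q m ∣≤ (S K (r ℕ.+ m) - S K m)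
  S-difference {q} {K} ∣q∣≤K m zero = ∣∣≤-resp (sym (ℚₚ.+-inverseʳ (S q m))) (≤-reflexive (sym (ℚₚ.+-inverseʳ (S K m)))) (≤-refl {0ℚ} , ≤-refl)
  S-difference {q} {K} ∣q∣≤K m (suc r) = ∣∣≤-resp (rearrange q) (≤-reflexive (rearrange K))
    (∣x+y∣≤ (S-difference ∣q∣≤K m r) (∣term∣≤ ∣q∣≤K (r ℕ.+ m)))
    where
    rearrange : ∀ x → (S x (r ℕ.+ m) - S x m) + term x (r ℕ.+ m) ≡ S x (suc r ℕ.+ m) - S x m
    rearrange x = solve 3 (λ a b t → (a :- b) :+ t := (a :+ t) :- b) refl (S x (r ℕ.+ m)) (S x m) (term x (r ℕ.+ m))

  -- Termwise the error is dominated by the one for `p = q = K`. There the square of side `n` lies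
  -- inside the triangle of size `2 n`, whose sum is `S (K + K) (n + n)`; what remains is a section
  -- of a convergent series.
  ∣product-error∣≤ : ∀ {p q K} n → 0ℚ ≤ K → ∣ p ∣≤ K → ∣ q ∣≤ K →
    ∣ S p n * S q n - S (p + q) n ∣≤ (S (K + K) (n ℕ.+ n) - S (K + K) n)
  ∣product-error∣≤ {p} {q} {K} n 0≤K ∣p∣≤K ∣q∣≤K =
    subst₂ ∣_∣≤_ (sym (product-error p q n)) refl (∣∣≤-resp refl
      (≤-trans (≤-reflexive (sym (product-error K K n))) (+-mono-≤ square≤ ≤-refl))
      (∑-abs n λ i i<n → ∣x*y∣≤ (∣term∣≤ ∣p∣≤K i) (difference i i<n)))
    where
    difference : ∀ i → i ℕ.< n → ∣ S q n - S q (n ∸ i) ∣≤ (S K n - S K (n ∸ i))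
    difference i i<n = subst (λ m → ∣ S q m - S q (n ∸ i) ∣≤ (S K m - S K (n ∸ i)))
      (ℕₚ.m+[n∸m]≡n (ℕₚ.<⇒≤ i<n)) (S-difference ∣q∣≤K (n ∸ i) i)
    S-mono : ∀ {a b} → a ℕ.≤ b → S K a ≤ S K b
    S-mono {a} {b} a≤b = subst (λ m → S K a ≤ S K m) (ℕₚ.m∸n+n≡m a≤b) (∑-mono-length a (b ∸ a) (0≤term 0≤K))
    0≤S : ∀ m → 0ℚ ≤ S K m
    0≤S m = S-mono {0} {m} ℕ.z≤n
    square≤ : S K n * S K n ≤ S (K + K) (n ℕ.+ n)
    square≤ = ≤-trans (≤-reflexive (sym (∑-*ʳ (S K n) (term K) n)))
      (≤-trans (proj₁ (∑-abs n (λ i i<n → bound i i<n)))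
        (≤-trans (∑-mono-length n n (λ i → 0≤term 0≤K i ⊛ 0≤S (n ℕ.+ n ∸ i)))
          (≤-reflexive (triangle≡S K K (n ℕ.+ n)))))
      where
      bound : ∀ i → i ℕ.< n → ∣ term K i * S K n ∣≤ (term K i * S K (n ℕ.+ n ∸ i))
      bound i i<n = le , ≤-trans (neg-antimono-≤ 0≤tS) (≤-trans 0≤tS le)
        where
        0≤tS = 0≤term 0≤K i ⊛ 0≤S n
        le : term K i * S K n ≤ term K i * S K (n ℕ.+ n ∸ i)
        le = *-monoʳ-≤ (0≤term 0≤K i) (S-mono (subst (ℕ._≤ n ℕ.+ n ∸ i) (ℕₚ.m+n∸n≡m n i)
          (ℕₚ.∸-monoˡ-≤ i (ℕₚ.+-monoʳ-≤ n (ℕₚ.<⇒≤ i<n)))))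

  S≥1+p : ∀ {p} → 0ℚ ≤ p → ∀ n → 1ℚ + p ≤ S p (n ℕ.+ 2)
  S≥1+p {p} 0≤p n = ≤-trans (≤-reflexive
    (solve 1 (λ p → con 1ℚ :+ p := (con 0ℚ :+ con 1ℚ) :+ con 1ℚ :* p :* con 1ℚ) refl p))
    (∑-mono-length 2 n (0≤term 0≤p))

  S≤1+2p : ∀ {p} → 0ℚ ≤ p → p ≤ 1ℚ → ∀ n → S p (n ℕ.+ 1) ≤ 1ℚ + 2ℚ * p
  S≤1+2p {p} 0≤p p≤1 n = by-slack
    (slack (proj₁ (tail-bound {p} {p} 1 0≤p 2p≤2 (≤-refl , ≤-trans (neg-antimono-≤ 0≤p) 0≤p) n)))
    (solve 2 (λ s p → con 2ℚ :* (con 1ℚ :* p :* con 1ℚ) :- (s :- (con 0ℚ :+ con 1ℚ))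
      := (con 1ℚ :+ con 2ℚ :* p) :- s) refl (S p (n ℕ.+ 1)) p)
    where
    2p≤2 : 2ℚ * p ≤ 2ℚ
    2p≤2 = *-monoʳ-≤ {y = 1ℚ} (0≤fromℚ 2ℚ) p≤1

-- Null sequences of rationals

open Defs
open PartialSums
open Q using (solve; _:=_; _:+_; _:*_; _:-_; :-_; con; by-slack; slack; _⊕_; _⊛_; 0≤fromℚ)

∣∣≤⇒Q : ∀ {p q} → ℚ.∣ p ∣ ℚ.≤ q → Q.∣ p ∣≤ q
∣∣≤⇒Q {p} ∣p∣≤q = ℚₚ.≤-trans (p≤∣p∣ p) ∣p∣≤q , ℚₚ.≤-trans (subst (ℚ.- p ℚ.≤_) (ℚₚ.∣-p∣≡∣p∣ p) (p≤∣p∣ (ℚ.- p))) ∣p∣≤q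
  where
  p≤∣p∣ : ∀ p → p ℚ.≤ ℚ.∣ p ∣
  p≤∣p∣ p with ℚₚ.≤-total 0ℚ p
  ... | inj₁ 0≤p = ℚₚ.≤-reflexive (sym (ℚₚ.0≤p⇒∣p∣≡p 0≤p))
  ... | inj₂ p≤0 = ℚₚ.≤-trans p≤0 (ℚₚ.0≤∣p∣ p)

Q⇒∣∣≤ : ∀ {p q} → Q.∣ p ∣≤ q → ℚ.∣ p ∣ ℚ.≤ q
Q⇒∣∣≤ {p} {q} (p≤q , -p≤q) with ℚₚ.∣p∣≡p∨∣p∣≡-p p
... | inj₁ eq = subst (ℚ._≤ q) (sym eq) p≤q
... | inj₂ eq = subst (ℚ._≤ q) (sym eq) -p≤q

0<½* : ∀ {ε} → 0ℚ ℚ.< ε → 0ℚ ℚ.< ½ ℚ.* ε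
0<½* 0<ε = ℚₚ.*-monoʳ-<-pos ½ 0<ε

½+½≤ : ∀ ε → ½ ℚ.* ε ℚ.+ ½ ℚ.* ε ℚ.≤ ε
½+½≤ ε = ℚₚ.≤-reflexive (solve 1 (λ e → con ½ :* e :+ con ½ :* e := e) refl ε)

½*< : ∀ {ε} → 0ℚ ℚ.< ε → ½ ℚ.* ε ℚ.< ε
½*< {ε} 0<ε = subst₂ ℚ._<_ (ℚₚ.+-identityˡ (½ ℚ.* ε))
  (solve 1 (λ e → con ½ :* e :+ con ½ :* e := e) refl ε) (ℚₚ.+-monoˡ-< (½ ℚ.* ε) (0<½* 0<ε))

-- The weak inequality suits slack certificates; passing to the strict one in `_≈_` costs a factor
-- 2.
Null : (ℕ → ℚ) → Set
Null s = ∀ ε → 0ℚ ℚ.< ε → ∃[ N ] (∀ n → N ℕ.≤ n → Q.∣ s n ∣≤ ε)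

null⇒≈ : ∀ {x y} → Null (λ n → seq x n ℚ.- seq y n) → x ≈ y
null⇒≈ null ε 0<ε = let N , h = null (½ ℚ.* ε) (0<½* 0<ε) in
  N , λ n N≤n → ℚₚ.≤-<-trans (Q⇒∣∣≤ (h n N≤n)) (½*< 0<ε)

≈⇒null : ∀ {x y} → x ≈ y → Null (λ n → seq x n ℚ.- seq y n)
≈⇒null x≈y ε 0<ε = let N , h = x≈y ε 0<ε in N , λ n N≤n → ∣∣≤⇒Q (ℚₚ.<⇒≤ (h n N≤n))

null-resp : ∀ {s t} → (∀ n → s n ≡ t n) → Null s → Null t
null-resp eq null ε 0<ε = let N , h = null ε 0<ε in N , λ n N≤n → Q.∣∣≤-resp (eq n) ℚₚ.≤-refl (h n N≤n)

null-+ : ∀ {s t} → Null s → Null t → Null (λ n → s n ℚ.+ t n)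
null-+ {s} {t} null-s null-t ε 0<ε =
  let M , hs = null-s (½ ℚ.* ε) (0<½* 0<ε)
      N , ht = null-t (½ ℚ.* ε) (0<½* 0<ε)
  in M ℕ.⊔ N , λ n ≤n → Q.∣∣≤-resp refl (½+½≤ ε)
       (Q.∣x+y∣≤ (hs n (ℕₚ.m⊔n≤o⇒m≤o M N ≤n)) (ht n (ℕₚ.m⊔n≤o⇒n≤o M N ≤n)))

null-neg : ∀ {s} → Null s → Null (λ n → ℚ.- s n)
null-neg null ε 0<ε = let N , h = null ε 0<ε in N , λ n N≤n → Q.∣-x∣≤ (h n N≤n)

null-0 : Null (λ _ → 0ℚ)
null-0 ε 0<ε = 0 , λ _ _ → ℚₚ.<⇒≤ 0<ε , ℚₚ.<⇒≤ 0<ε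

Bounded : (ℕ → ℚ) → Set
Bounded s = ∃[ C ] ∃[ N ] (∀ n → N ℕ.≤ n → Q.∣ s n ∣≤ toℚ (+ C))

seq-bounded : ∀ x → Bounded (seq x)
seq-bounded x =
  let N , h = cauchy x 1ℚ (ℚₚ.positive⁻¹ 1ℚ)
      a = seq x N
      C , bound = Q.archimedean (1ℚ ℚ.+ ℚ.∣ a ∣)
  in C , N , λ n N≤n → Q.∣∣≤-resp (solve 2 (λ x a → (x :- a) :+ a := x) refl (seq x n) a) bound
       (Q.∣x+y∣≤ (∣∣≤⇒Q (ℚₚ.<⇒≤ (h n N N≤n ℕₚ.≤-refl))) (∣∣≤⇒Q {a} ℚₚ.≤-refl))

shrink : ∀ C ε → 0ℚ ℚ.< ε → ∃[ δ ] (0ℚ ℚ.< δ × toℚ (+ C) ℚ.* δ ℚ.≤ ε)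
shrink C ε 0<ε = η ℚ.* ε
  , subst (ℚ._< η ℚ.* ε) (ℚₚ.*-zeroʳ η) (ℚₚ.*-monoʳ-<-pos η {{ℚₚ.normalize-pos 1 (suc C)}} 0<ε)
  , Q.≤-resp (solve 3 (λ c u e → (u :* c) :* e := c :* (u :* e)) refl (toℚ (+ C)) η ε)
      (trans (cong (ℚ._* ε) (1/n*n≡1 (suc C))) (ℚₚ.*-identityˡ ε))
      (by-slack (0≤fromℚ η {{ℚₚ.normalize-nonNeg 1 (suc C)}} ⊛ slack (toℚ-mono-≤ {+ C} {+ suc C} (ℤ.+≤+ (ℕₚ.n≤1+n C))) ⊛ ℚₚ.<⇒≤ 0<ε)
        (solve 4 (λ u c d e → u :* (d :- c) :* e := (u :* d) :* e :- (u :* c) :* e) refl η (toℚ (+ C)) (toℚ (+ suc C)) ε))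
  where
  η = 1ℤ ℚ./ suc C

null-* : ∀ {s t} → Bounded s → Null t → Null (λ n → s n ℚ.* t n)
null-* (C , M , hs) null-t ε 0<ε =
  let δ , 0<δ , Cδ≤ε = shrink C ε 0<ε
      N , ht = null-t δ 0<δ
  in M ℕ.⊔ N , λ n ≤n → Q.∣∣≤-resp refl Cδ≤ε
       (Q.∣x*y∣≤ (hs n (ℕₚ.m⊔n≤o⇒m≤o M N ≤n)) (ht n (ℕₚ.m⊔n≤o⇒n≤o M N ≤n)))

pointwise⇒≈ : ∀ {x y} → (∀ n → seq x n ≡ seq y n) → x ≈ y
pointwise⇒≈ {x} {y} eq = null⇒≈ {x} {y} (null-resp
  (λ n → sym (trans (cong (ℚ._- seq y n) (eq n)) (ℚₚ.+-inverseʳ (seq y n)))) null-0)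

-- The ordered ring of reals

≈-refl : ∀ x → x ≈ x
≈-refl x = pointwise⇒≈ {x} {x} λ _ → refl

≈-sym : ∀ {x y} → x ≈ y → y ≈ x
≈-sym {x} {y} x≈y = null⇒≈ {y} {x} (null-resp
  (λ n → solve 2 (λ x y → :- (x :- y) := y :- x) refl (seq x n) (seq y n)) (null-neg (≈⇒null {x} {y} x≈y)))

≈-trans : ∀ {x y z} → x ≈ y → y ≈ z → x ≈ z
≈-trans {x} {y} {z} x≈y y≈z = null⇒≈ {x} {z} (null-resp
  (λ n → solve 3 (λ x y z → (x :- y) :+ (y :- z) := x :- z) refl (seq x n) (seq y n) (seq z n))
  (null-+ (≈⇒null {x} {y} x≈y) (≈⇒null {y} {z} y≈z)))

+-cong : ∀ {x y u v} → x ≈ y → u ≈ v → x + u ≈ y + v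
+-cong {x} {y} {u} {v} x≈y u≈v = null⇒≈ {x + u} {y + v} (null-resp
  (λ n → solve 4 (λ x y u v → (x :- y) :+ (u :- v) := (x :+ u) :- (y :+ v)) refl (seq x n) (seq y n) (seq u n) (seq v n))
  (null-+ (≈⇒null {x} {y} x≈y) (≈⇒null {u} {v} u≈v)))

neg-cong : ∀ {x y} → x ≈ y → - x ≈ - y
neg-cong {x} {y} x≈y = null⇒≈ { - x} { - y} (null-resp
  (λ n → solve 2 (λ x y → :- (x :- y) := (:- x) :- (:- y)) refl (seq x n) (seq y n)) (null-neg (≈⇒null {x} {y} x≈y)))

*-cong : ∀ {x y u v} → x ≈ y → u ≈ v → x * u ≈ y * v
*-cong {x} {y} {u} {v} x≈y u≈v = null⇒≈ {x * u} {y * v} (null-resp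
  (λ n → solve 4 (λ x y u v → x :* (u :- v) :+ v :* (x :- y) := x :* u :- y :* v) refl (seq x n) (seq y n) (seq u n) (seq v n))
  (null-+ (null-* (seq-bounded x) (≈⇒null {u} {v} u≈v)) (null-* (seq-bounded v) (≈⇒null {x} {y} x≈y))))

ℝ-commutativeRing : CommutativeRing 0ℓ 0ℓ
ℝ-commutativeRing = record
  { Carrier = ℝ ; _≈_ = _≈_ ; _+_ = _+_ ; _*_ = _*_ ; -_ = -_ ; 0# = 0ℝ ; 1# = 1ℝ
  ; isCommutativeRing = record
    { isRing = record
      { +-isAbelianGroup = record
        { isGroup = record
          { isMonoid = record
            { isSemigroup = record
              { isMagma = record
                { isEquivalence = record
                  { refl  = λ {x} → ≈-refl x
                  ; sym   = λ {x} {y} → ≈-sym {x} {y}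
                  ; trans = λ {x} {y} {z} → ≈-trans {x} {y} {z} }
                ; ∙-cong = λ {x} {y} {u} {v} → +-cong {x} {y} {u} {v} }
              ; assoc = λ x y z → pointwise⇒≈ {x + y + z} {x + (y + z)} λ n → ℚₚ.+-assoc (seq x n) (seq y n) (seq z n) }
            ; identity = (λ x → pointwise⇒≈ {0ℝ + x} {x} λ n → ℚₚ.+-identityˡ (seq x n))
                       , (λ x → pointwise⇒≈ {x + 0ℝ} {x} λ n → ℚₚ.+-identityʳ (seq x n)) }
          ; inverse = (λ x → pointwise⇒≈ { - x + x} {0ℝ} λ n → ℚₚ.+-inverseˡ (seq x n))
                    , (λ x → pointwise⇒≈ {x + - x} {0ℝ} λ n → ℚₚ.+-inverseʳ (seq x n))
          ; ⁻¹-cong = λ {x} {y} → neg-cong {x} {y} }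
        ; comm = λ x y → pointwise⇒≈ {x + y} {y + x} λ n → ℚₚ.+-comm (seq x n) (seq y n) }
      ; *-cong = λ {x} {y} {u} {v} → *-cong {x} {y} {u} {v}
      ; *-assoc = λ x y z → pointwise⇒≈ {x * y * z} {x * (y * z)} λ n → ℚₚ.*-assoc (seq x n) (seq y n) (seq z n)
      ; *-identity = (λ x → pointwise⇒≈ {1ℝ * x} {x} λ n → ℚₚ.*-identityˡ (seq x n))
                   , (λ x → pointwise⇒≈ {x * 1ℝ} {x} λ n → ℚₚ.*-identityʳ (seq x n))
      ; distrib = (λ x y z → pointwise⇒≈ {x * (y + z)} {x * y + x * z} λ n → ℚₚ.*-distribˡ-+ (seq x n) (seq y n) (seq z n))
                , (λ x y z → pointwise⇒≈ {(y + z) * x} {y * x + z * x} λ n → ℚₚ.*-distribʳ-+ (seq x n) (seq y n) (seq z n)) }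
    ; *-comm = λ x y → pointwise⇒≈ {x * y} {y * x} λ n → ℚₚ.*-comm (seq x n) (seq y n) } }

≈⇒≤ : ∀ {x y} → x ≈ y → x ≤ y
≈⇒≤ {x} {y} x≈y ε 0<ε = let N , h = ≈⇒null {x} {y} x≈y ε 0<ε in N , λ n N≤n →
  by-slack (slack (proj₁ (h n N≤n))) (solve 3 (λ x y e → e :- (x :- y) := (y :+ e) :- x) refl (seq x n) (seq y n) ε)

≤-trans : ∀ {x y z} → x ≤ y → y ≤ z → x ≤ z
≤-trans {x} {y} {z} x≤y y≤z ε 0<ε =
  let M , h = x≤y (½ ℚ.* ε) (0<½* 0<ε)
      N , g = y≤z (½ ℚ.* ε) (0<½* 0<ε)
  in M ℕ.⊔ N , λ n ≤n → by-slack
       (slack (h n (ℕₚ.m⊔n≤o⇒m≤o M N ≤n)) ⊕ slack (g n (ℕₚ.m⊔n≤o⇒n≤o M N ≤n)))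
       (solve 4 (λ x y z e → ((y :+ con ½ :* e) :- x) :+ ((z :+ con ½ :* e) :- y) := (z :+ e) :- x) refl
         (seq x n) (seq y n) (seq z n) ε)

≤-antisym : ∀ {x y} → x ≤ y → y ≤ x → x ≈ y
≤-antisym {x} {y} x≤y y≤x = null⇒≈ {x} {y} λ ε 0<ε →
  let M , h = x≤y ε 0<ε
      N , g = y≤x ε 0<ε
  in M ℕ.⊔ N , λ n ≤n →
       by-slack (slack (h n (ℕₚ.m⊔n≤o⇒m≤o M N ≤n)))
         (solve 3 (λ x y e → (y :+ e) :- x := e :- (x :- y)) refl (seq x n) (seq y n) ε)
     , by-slack (slack (g n (ℕₚ.m⊔n≤o⇒n≤o M N ≤n)))
         (solve 3 (λ x y e → (x :+ e) :- y := e :- (:- (x :- y))) refl (seq x n) (seq y n) ε)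

eventually⇒≤ : ∀ {x y} N → (∀ n → N ℕ.≤ n → seq x n ℚ.≤ seq y n) → x ≤ y
eventually⇒≤ {x} {y} N h ε 0<ε = N , λ n N≤n → by-slack (slack (h n N≤n) ⊕ ℚₚ.<⇒≤ 0<ε)
  (solve 3 (λ x y e → (y :- x) :+ e := (y :+ e) :- x) refl (seq x n) (seq y n) ε)

<⇒≱ : ∀ {x y} → x < y → ¬ (y ≤ x)
<⇒≱ {x} {y} (δ , 0<δ , N , h) y≤x =
  let M , g = y≤x (½ ℚ.* δ) (0<½* 0<δ)
      n = M ℕ.⊔ N
  in ℚₚ.<-irrefl refl (ℚₚ.<-≤-trans (0<½* 0<δ) (by-slack (slack (h n (ℕₚ.m≤n⊔m M N)) ⊕ slack (g n (ℕₚ.m≤m⊔n M N)))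
       (solve 3 (λ x y d → (y :- (x :+ d)) :+ ((x :+ con ½ :* d) :- y) := con 0ℚ :- con ½ :* d) refl (seq x n) (seq y n) δ)))

<⇒≤ : ∀ {x y} → x < y → x ≤ y
<⇒≤ {x} {y} (δ , 0<δ , N , h) = eventually⇒≤ {x} {y} N λ n N≤n → by-slack (slack (h n N≤n) ⊕ ℚₚ.<⇒≤ 0<δ)
  (solve 3 (λ x y d → (y :- (x :+ d)) :+ d := y :- x) refl (seq x n) (seq y n) δ)

-- A Cauchy sequence exceeding ε once late enough exceeds ε / 2 from then on.
≮⇒≥ : ∀ {x y} → ¬ (x < y) → y ≤ x
≮⇒≥ {x} {y} x≮y ε 0<ε = let N , h = cauchy (y - x) (½ ℚ.* ε) (0<½* 0<ε) in N , λ n N≤n → decide N h n N≤n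
  where
  decide : ∀ N → (∀ m n → N ℕ.≤ m → N ℕ.≤ n → ℚ.∣ seq (y - x) m ℚ.- seq (y - x) n ∣ ℚ.< ½ ℚ.* ε) →
           ∀ n → N ℕ.≤ n → seq y n ℚ.≤ seq x n ℚ.+ ε
  decide N h n N≤n with seq y n ℚₚ.≤? seq x n ℚ.+ ε
  ... | yes le = le
  ... | no ¬le = contradiction (½ ℚ.* ε , 0<½* 0<ε , N , λ m N≤m → by-slack
      (slack (ℚₚ.<⇒≤ (ℚₚ.≰⇒> ¬le)) ⊕ slack (proj₂ (∣∣≤⇒Q (ℚₚ.<⇒≤ (h m n N≤m N≤n)))))
      (solve 5 (λ y x y′ x′ e → (y :- (x :+ e)) :+ (con ½ :* e :- (:- ((y′ :- x′) :- (y :- x)))) := y′ :- (x′ :+ con ½ :* e))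
        refl (seq y n) (seq x n) (seq y m) (seq x m) ε)) x≮y

fromℚ-mono : ∀ {p q} → p ℚ.≤ q → fromℚ p ≤ fromℚ q
fromℚ-mono {p} {q} p≤q = eventually⇒≤ {fromℚ p} {fromℚ q} 0 λ _ _ → p≤q

fromℚ-cancel : ∀ {p q} → fromℚ p ≤ fromℚ q → p ℚ.≤ q
fromℚ-cancel p≤q = ℚ-≤-limit λ n →
  let N , h = p≤q (1ℤ ℚ./ suc n) (ℚₚ.positive⁻¹ _ {{ℚₚ.normalize-pos 1 (suc n)}}) in h N ℕₚ.≤-refl

0<⊓ : ∀ {p q} → 0ℚ ℚ.< p → 0ℚ ℚ.< q → 0ℚ ℚ.< p ℚ.⊓ q
0<⊓ {p} {q} 0<p 0<q with ℚₚ.≤-total p q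
... | inj₁ p≤q = subst (0ℚ ℚ.<_) (sym (ℚₚ.p≤q⇒p⊓q≡p p≤q)) 0<p
... | inj₂ q≤p = subst (0ℚ ℚ.<_) (sym (ℚₚ.p≥q⇒p⊓q≡q q≤p)) 0<q

-- Entries of a nonnegative real may be slightly negative. From `x + η ≥ 0` and `y + η ≥ 0` it
-- follows that `x y ≥ - η (x + y + η)`, and with `x ≤ C`, `y ≤ D`, `η ≤ 1` this is at least
-- `- (C + D + 1) η`.
*-nonNeg : ∀ {x y} → 0ℝ ≤ x → 0ℝ ≤ y → 0ℝ ≤ x * y
*-nonNeg {x} {y} 0≤x 0≤y ε 0<ε =
  let C , L , hx = seq-bounded x
      D , M , hy = seq-bounded y
      B = C ℕ.+ D
      δ , 0<δ , Bδ≤ε = shrink (suc B) ε 0<ε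
      η = δ ℚ.⊓ 1ℚ
      0<η = 0<⊓ 0<δ (ℚₚ.positive⁻¹ 1ℚ)
      η≤δ = ℚₚ.p⊓q≤p δ 1ℚ
      η≤1 = ℚₚ.p⊓q≤q δ 1ℚ
      N , gx = 0≤x η 0<η
      P , gy = 0≤y η 0<η
  in (L ℕ.⊔ M) ℕ.⊔ (N ℕ.⊔ P) , λ n ≤n →
    let ≤₁ = ℕₚ.m⊔n≤o⇒m≤o (L ℕ.⊔ M) (N ℕ.⊔ P) ≤n
        ≤₂ = ℕₚ.m⊔n≤o⇒n≤o (L ℕ.⊔ M) (N ℕ.⊔ P) ≤n
        0≤x+η = gx n (ℕₚ.m⊔n≤o⇒m≤o N P ≤₂)
        0≤y+η = gy n (ℕₚ.m⊔n≤o⇒n≤o N P ≤₂)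
        x≤C = proj₁ (hx n (ℕₚ.m⊔n≤o⇒m≤o L M ≤₁))
        y≤D = proj₁ (hy n (ℕₚ.m⊔n≤o⇒n≤o L M ≤₁))
    in by-slack
      (slack 0≤x+η ⊛ slack 0≤y+η ⊕ ℚₚ.<⇒≤ 0<η ⊛ slack x≤C ⊕ ℚₚ.<⇒≤ 0<η ⊛ slack y≤D ⊕ ℚₚ.<⇒≤ 0<η ⊛ slack η≤1
        ⊕ slack (ℚₚ.≤-trans (Q.*-monoʳ-≤ (0≤toℚ (suc B)) η≤δ) Bδ≤ε))
      (trans (cong (λ b → ((seq x n ℚ.+ η) ℚ.- 0ℚ) ℚ.* ((seq y n ℚ.+ η) ℚ.- 0ℚ) ℚ.+ η ℚ.* (toℚ (+ C) ℚ.- seq x n)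
            ℚ.+ η ℚ.* (toℚ (+ D) ℚ.- seq y n) ℚ.+ η ℚ.* (1ℚ ℚ.- η) ℚ.+ (ε ℚ.- b ℚ.* η))
          (trans (toℚ-homo-+ 1ℤ (+ B)) (cong (1ℚ ℚ.+_) (toℚ-homo-+ (+ C) (+ D)))))
        (solve 6 (λ x y h c d e → ((x :+ h) :- con 0ℚ) :* ((y :+ h) :- con 0ℚ) :+ h :* (c :- x) :+ h :* (d :- y)
            :+ h :* (con 1ℚ :- h) :+ (e :- (con 1ℚ :+ (c :+ d)) :* h) := (x :* y :+ e) :- con 0ℚ)
          refl (seq x n) (seq y n) η (toℚ (+ C)) (toℚ (+ D)) ε))

module Real (lem : ExcludedMiddle 0ℓ) where

  ≤-total : ∀ x y → x ≤ y ⊎ y ≤ x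
  ≤-total x y with lem {x < y}
  ... | yes x<y = inj₁ (<⇒≤ {x} {y} x<y)
  ... | no  x≮y = inj₂ (≮⇒≥ {x} {y} x≮y)

  ≰⇒> : ∀ {x y} → ¬ (x ≤ y) → y < x
  ≰⇒> {x} {y} x≰y with lem {y < x}
  ... | yes y<x = y<x
  ... | no  y≮x = contradiction (≮⇒≥ {y} {x} y≮x) x≰y

  ℝ-orderedRing : OrderedRing
  ℝ-orderedRing = record
    { commutativeRing = ℝ-commutativeRing
    ; _≤_             = _≤_
    ; ≤-reflexive     = λ {x} {y} → ≈⇒≤ {x} {y}
    ; ≤-trans         = λ {x} {y} {z} → ≤-trans {x} {y} {z}
    ; ≤-antisym       = λ {x} {y} → ≤-antisym {x} {y}
    ; ≤-total         = ≤-total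
    ; +-monoˡ-≤       = λ z {x} {y} x≤y ε 0<ε → let N , h = x≤y ε 0<ε in N , λ n N≤n →
        by-slack (slack (h n N≤n)) (solve 4 (λ x y z e → (y :+ e) :- x := ((y :+ z) :+ e) :- (x :+ z)) refl
          (seq x n) (seq y n) (seq z n) ε)
    ; *-nonNeg        = λ {x} {y} → *-nonNeg {x} {y}
    ; fromℚ           = fromℚ
    ; fromℚ-homo-+    = λ p q → pointwise⇒≈ {fromℚ (p ℚ.+ q)} {fromℚ p + fromℚ q} λ _ → refl
    ; fromℚ-homo-*    = λ p q → pointwise⇒≈ {fromℚ (p ℚ.* q)} {fromℚ p * fromℚ q} λ _ → refl
    ; fromℚ-homo--    = λ p → pointwise⇒≈ {fromℚ (ℚ.- p)} { - fromℚ p} λ _ → refl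
    ; fromℚ-homo-0    = ≈-refl 0ℝ
    ; fromℚ-homo-1    = ≈-refl 1ℝ
    ; fromℚ-mono      = fromℚ-mono
    ; fromℚ-cancel    = fromℚ-cancel
    ; archimedean     = λ x → let C , N , h = seq-bounded x in
        C , eventually⇒≤ {x} {fromℚ (toℚ (+ C))} N λ n N≤n → proj₁ (h n N≤n)
    ; ≤-limit         = λ {x} {y} bound ε 0<ε →
        let n , 1/n≤½ε = 1/n≤p (½ ℚ.* ε) (0<½* 0<ε)
            N , h = bound n (½ ℚ.* ε) (0<½* 0<ε)
        in N , λ m N≤m → by-slack (slack (h m N≤m) ⊕ slack 1/n≤½ε)
             (solve 4 (λ x y u e → (((y :+ u) :+ con ½ :* e) :- x) :+ (con ½ :* e :- u) := (y :+ e) :- x) refl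
               (seq x m) (seq y m) (1ℤ ℚ./ suc n) ε)
    }

-- The exponential of a real number

seq-sum : ∀ (g : ℕ → ℝ) N n → seq (sum {N} (λ i → g (toℕ i))) n ≡ ∑ (λ i → seq (g i) n) N
seq-sum g zero    n = refl
seq-sum g (suc N) n = trans (cong (seq (g 0) n ℚ.+_) (seq-sum (g ∘ suc) N n))
  (sym (∑-shift (λ i → seq (g i) n) N))

reciprocal : ℕ → ℚ
reciprocal n = seq (1ℤ ÷ n) 0

reciprocal-seq : ∀ a n → seq (1ℤ ÷ a) n ≡ reciprocal a
reciprocal-seq zero    n = refl
reciprocal-seq (suc a) n = refl

reciprocal-inverse : ∀ a → 1 ℕ.≤ a → reciprocal a ℚ.* toℚ (+ a) ≡ 1ℚ
reciprocal-inverse (suc a) _ = 1/n*n≡1 (suc a)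

reciprocal-unique : ∀ a q → 1 ℕ.≤ a → q ℚ.* toℚ (+ a) ≡ 1ℚ → q ≡ reciprocal a
reciprocal-unique a q 1≤a qa≡1 = begin
  q                                   ≡⟨ sym (ℚₚ.*-identityʳ q) ⟩
  q ℚ.* 1ℚ                            ≡⟨ cong (q ℚ.*_) (sym (reciprocal-inverse a 1≤a)) ⟩
  q ℚ.* (reciprocal a ℚ.* toℚ (+ a))  ≡⟨ solve 3 (λ q r a → q :* (r :* a) := (q :* a) :* r) refl q (reciprocal a) (toℚ (+ a)) ⟩
  (q ℚ.* toℚ (+ a)) ℚ.* reciprocal a  ≡⟨ trans (cong (ℚ._* reciprocal a) qa≡1) (ℚₚ.*-identityˡ (reciprocal a)) ⟩
  reciprocal a                        ∎
  where open ≡-Reasoning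

series-term : ∀ x n i → seq (x ^ i * (1ℤ ÷ (i !))) n ≡ term (seq x n) i
series-term x n i = trans (cong (seq (x ^ i) n ℚ.*_) (reciprocal-seq (i !) n)) (go i)
  where
  p = seq x n
  go : ∀ i → seq (x ^ i) n ℚ.* reciprocal (i !) ≡ term p i
  go zero    = refl
  go (suc i) = begin
    (p ℚ.* seq (x ^ i) n) ℚ.* reciprocal (suc i !)
      ≡⟨ cong ((p ℚ.* seq (x ^ i) n) ℚ.*_) (sym (reciprocal-unique (suc i !) (reciprocal (i !) ℚ.* u i) (n!≥1 (suc i)) inverse)) ⟩
    (p ℚ.* seq (x ^ i) n) ℚ.* (reciprocal (i !) ℚ.* u i)
      ≡⟨ solve 4 (λ p y r u → (p :* y) :* (r :* u) := (y :* r) :* p :* u) refl p (seq (x ^ i) n) (reciprocal (i !)) (u i) ⟩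
    (seq (x ^ i) n ℚ.* reciprocal (i !)) ℚ.* p ℚ.* u i
      ≡⟨ cong (λ t → t ℚ.* p ℚ.* u i) (go i) ⟩
    term p (suc i) ∎
    where
    open ≡-Reasoning
    inverse : (reciprocal (i !) ℚ.* u i) ℚ.* toℚ (+ (suc i !)) ≡ 1ℚ
    inverse = begin
      (reciprocal (i !) ℚ.* u i) ℚ.* toℚ (+ (suc i ℕ.* i !))
        ≡⟨ cong ((reciprocal (i !) ℚ.* u i) ℚ.*_) (toℚ-pos-* (suc i) (i !)) ⟩
      (reciprocal (i !) ℚ.* u i) ℚ.* (toℚ (+ suc i) ℚ.* toℚ (+ (i !)))
        ≡⟨ solve 4 (λ r u a b → (r :* u) :* (a :* b) := (u :* a) :* (r :* b)) refl (reciprocal (i !)) (u i) (toℚ (+ suc i)) (toℚ (+ (i !))) ⟩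
      (u i ℚ.* toℚ (+ suc i)) ℚ.* (reciprocal (i !) ℚ.* toℚ (+ (i !)))
        ≡⟨ cong₂ ℚ._*_ (1/n*n≡1 (suc i)) (reciprocal-inverse (i !) (n!≥1 i)) ⟩
      1ℚ ∎

poly : ℝ → ℕ → ℝ
poly x N = sum {N} (λ i → x ^ toℕ i * (1ℤ ÷ (toℕ i !)))

poly-seq : ∀ x N n → seq (poly x N) n ≡ S (seq x n) N
poly-seq x N n = trans (seq-sum (λ i → x ^ i * (1ℤ ÷ (i !))) N n) (∑-cong N λ i _ → series-term x n i)

-- Uniformity in `p` is essential, since the argument of the series varies along the Cauchy sequence
-- of a real number.
uniform-tail : ∀ C ε → 0ℚ ℚ.< ε → ∃[ N ] (∀ p → Q.∣ p ∣≤ toℚ (+ C) → ∀ n → N ℕ.≤ n →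
  Q.∣ S p n ℚ.- S p N ∣≤ ε)
uniform-tail C ε 0<ε = let N , large , small = term-vanishes C ε 0<ε in N , λ p ∣p∣≤C n N≤n →
  subst (λ m → Q.∣ S p m ℚ.- S p N ∣≤ ε) (ℕₚ.m∸n+n≡m N≤n)
    (Q.∣∣≤-resp refl small (tail-bound {p} {toℚ (+ C)} N (0≤toℚ C) large ∣p∣≤C (n ∸ N)))

exp-tail : ∀ x ε → 0ℚ ℚ.< ε → ∃[ N ] (∀ m n → N ℕ.≤ m → N ℕ.≤ n → Q.∣ S (seq x n) m ℚ.- S (seq x n) N ∣≤ ε)
exp-tail x ε 0<ε =
  let C , M , bound = seq-bounded x
      N , tail = uniform-tail C (½ ℚ.* ε) (0<½* 0<ε)
      L = M ℕ.⊔ N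
  in L , λ m n L≤m L≤n → Q.∣∣≤-resp
       (solve 3 (λ a b c → (a :- b) :+ (:- (c :- b)) := a :- c) refl (S (seq x n) m) (S (seq x n) N) (S (seq x n) L))
       (½+½≤ ε)
       (Q.∣x+y∣≤ (tail (seq x n) (bound n (ℕₚ.m⊔n≤o⇒m≤o M N L≤n)) m (ℕₚ.≤-trans (ℕₚ.m≤n⊔m M N) L≤m))
         (Q.∣-x∣≤ (tail (seq x n) (bound n (ℕₚ.m⊔n≤o⇒m≤o M N L≤n)) L (ℕₚ.m≤n⊔m M N))))

-- A diagonal sequence, the `n`-th partial sum at the `n`-th entry. It is Cauchy by comparison with
-- a partial sum of fixed length, which is a polynomial in the real number.
exp : ℝ → ℝ
exp x = mkℝ (λ n → S (seq x n) n) is-cauchy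
  where
  is-cauchy : IsCauchy (λ n → S (seq x n) n)
  is-cauchy ε 0<ε =
    let η = ½ ℚ.* (½ ℚ.* ε)
        0<η = 0<½* (0<½* 0<ε)
        M , tail = exp-tail x η 0<η
        N , h = cauchy (poly x M) η 0<η
    in M ℕ.⊔ N , λ m n ≤m ≤n →
      let M≤m = ℕₚ.m⊔n≤o⇒m≤o M N ≤m
          M≤n = ℕₚ.m⊔n≤o⇒m≤o M N ≤n
          h′ = subst₂ (λ a b → Q.∣ a ℚ.- b ∣≤ η) (poly-seq x M m) (poly-seq x M n)
                 (∣∣≤⇒Q (ℚₚ.<⇒≤ (h m n (ℕₚ.m⊔n≤o⇒n≤o M N ≤m) (ℕₚ.m⊔n≤o⇒n≤o M N ≤n))))
      in ℚₚ.≤-<-trans (Q⇒∣∣≤ (Q.∣∣≤-resp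
           (solve 4 (λ a b c d → ((a :- b) :+ (b :- c)) :+ (:- (d :- c)) := a :- d) refl
             (S (seq x m) m) (S (seq x m) M) (S (seq x n) M) (S (seq x n) n))
           ℚₚ.≤-refl (Q.∣x+y∣≤ (Q.∣x+y∣≤ (tail m m M≤m M≤m) h′) (Q.∣-x∣≤ (tail n n M≤n M≤n)))))
         (subst₂ ℚ._<_ (ℚₚ.+-identityʳ (η ℚ.+ η ℚ.+ η))
           (solve 1 (λ e → con ½ :* (con ½ :* e) :+ con ½ :* (con ½ :* e) :+ con ½ :* (con ½ :* e) :+ con ½ :* (con ½ :* e) := e) refl ε)
           (ℚₚ.+-monoʳ-< (η ℚ.+ η ℚ.+ η) 0<η))

-- A positive real `ε` eventually exceeds a rational `δ`. An error of at most half of `δ` leaves the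
-- other half as the gap that the strict order asks for.
converges : ∀ {s x} → (∀ ε → 0ℚ ℚ.< ε → ∃[ N ] (∀ n → N ℕ.≤ n → ∃[ M ] (∀ m → M ℕ.≤ m →
            Q.∣ seq (s n) m ℚ.- seq x m ∣≤ ε))) → ConvergesTo s x
converges {s} {x} approx ε (δ , 0<δ , L , δ≤ε) =
  let η = ½ ℚ.* δ
      N , h = approx η (0<½* 0<δ)
  in N , λ n N≤n → let M , g = h n N≤n in η , 0<½* 0<δ , L ℕ.⊔ M , λ m ≤m →
    by-slack (slack (Q⇒∣∣≤ (g m (ℕₚ.m⊔n≤o⇒n≤o L M ≤m))) ⊕ slack (δ≤ε m (ℕₚ.m⊔n≤o⇒m≤o L M ≤m)))
      (solve 3 (λ a d e → (con ½ :* d :- a) :+ (e :- (con 0ℚ :+ d)) := e :- (a :+ con ½ :* d)) refl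
        ℚ.∣ seq (s n) m ℚ.- seq x m ∣ δ (seq ε m))

limit-unique : ∀ {s x y} → ConvergesTo s x → ConvergesTo s y → x ≈ y
limit-unique {s} {x} {y} s→x s→y = null⇒≈ {x} {y} λ ε 0<ε →
  let η = ½ ℚ.* ε
      0<η : 0ℝ < fromℚ η
      0<η = η , 0<½* 0<ε , 0 , λ _ _ → ℚₚ.≤-reflexive (ℚₚ.+-identityˡ η)
      M , hx = s→x (fromℚ η) 0<η
      N , hy = s→y (fromℚ η) 0<η
      n = M ℕ.⊔ N
      δ , 0<δ , K , gx = hx n (ℕₚ.m≤m⊔n M N)
      δ′ , 0<δ′ , L , gy = hy n (ℕₚ.m≤n⊔m M N)
  in K ℕ.⊔ L , λ m ≤m →
    let near-x = gx m (ℕₚ.m⊔n≤o⇒m≤o K L ≤m)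
        near-y = gy m (ℕₚ.m⊔n≤o⇒n≤o K L ≤m)
    in Q.∣∣≤-resp (solve 3 (λ s x y → (:- (s :- x)) :+ (s :- y) := x :- y) refl (seq (s n) m) (seq x m) (seq y m))
         (½+½≤ ε)
         (Q.∣x+y∣≤ (Q.∣-x∣≤ (∣∣≤⇒Q {seq (s n) m ℚ.- seq x m} (drop δ 0<δ near-x))) (∣∣≤⇒Q {seq (s n) m ℚ.- seq y m} (drop δ′ 0<δ′ near-y)))
  where
  drop : ∀ {a b} δ → 0ℚ ℚ.< δ → a ℚ.+ δ ℚ.≤ b → a ℚ.≤ b
  drop {a} {b} δ 0<δ a+δ≤b = by-slack (slack a+δ≤b ⊕ ℚₚ.<⇒≤ 0<δ)
    (solve 3 (λ a b d → (b :- (a :+ d)) :+ d := b :- a) refl a b δ)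

exp-isExp : ∀ {x y} → exp x ≈ y → IsExp x y
exp-isExp {x} {y} exp≈y = converges {poly x} {y} λ ε 0<ε →
  let η = ½ ℚ.* (½ ℚ.* ε)
      0<η = 0<½* (0<½* 0<ε)
      N , tail = exp-tail x η 0<η
      L , h = ≈⇒null {exp x} {y} exp≈y η 0<η
  in N , λ n N≤n → N ℕ.⊔ L , λ m ≤m →
    let N≤m = ℕₚ.m⊔n≤o⇒m≤o N L ≤m in
    Q.∣∣≤-resp
      (trans (solve 4 (λ a b c d → ((a :- b) :+ (:- (c :- b))) :+ (c :- d) := a :- d) refl
          (S (seq x m) n) (S (seq x m) N) (S (seq x m) m) (seq y m))
        (cong (ℚ._- seq y m) (sym (poly-seq x n m))))
      (by-slack (ℚₚ.<⇒≤ 0<η) (solve 1 (λ e → con ½ :* (con ½ :* e)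
          := e :- (con ½ :* (con ½ :* e) :+ con ½ :* (con ½ :* e) :+ con ½ :* (con ½ :* e))) refl ε))
      (Q.∣x+y∣≤ (Q.∣x+y∣≤ (tail n m N≤n N≤m) (Q.∣-x∣≤ (tail m m N≤m N≤m))) (h m (ℕₚ.m⊔n≤o⇒n≤o N L ≤m)))

isExp⇒exp : ∀ {x y} → IsExp x y → exp x ≈ y
isExp⇒exp {x} {y} is-exp = limit-unique {poly x} {exp x} {y}
  (exp-isExp {x} {exp x} (≈-refl (exp x))) is-exp

-- The `n`-th entries differ by at most `S (2 K) (2 n) - S (2 K) n`, where `K` bounds both
-- sequences; two tails of the same convergent series control this.
exp-+ : ∀ x y → exp (x + y) ≈ exp x * exp y
exp-+ x y = null⇒≈ {exp (x + y)} {exp x * exp y} λ ε 0<ε →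
  let C , M , hx = seq-bounded x
      D , N , hy = seq-bounded y
      B = C ℕ.+ D
      L , tail = uniform-tail (B ℕ.+ B) (½ ℚ.* ε) (0<½* 0<ε)
      K = toℚ (+ B)
      0≤K = 0≤toℚ B
      2K = K ℚ.+ K
      2K-bound : Q.∣ 2K ∣≤ toℚ (+ (B ℕ.+ B))
      2K-bound = ℚₚ.≤-reflexive (sym (toℚ-homo-+ (+ B) (+ B)))
        , ℚₚ.≤-trans (Q.neg-antimono-≤ (0≤K ⊕ 0≤K)) (0≤toℚ (B ℕ.+ B))
  in (M ℕ.⊔ N) ℕ.⊔ L , λ n ≤n →
    let ≤₁ = ℕₚ.m⊔n≤o⇒m≤o (M ℕ.⊔ N) L ≤n
        L≤n = ℕₚ.m⊔n≤o⇒n≤o (M ℕ.⊔ N) L ≤n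
        p = seq x n
        q = seq y n
        p≤K = Q.∣∣≤-resp refl (toℚ-mono-≤ {+ C} {+ B} (ℤ.+≤+ (ℕₚ.m≤m+n C D))) (hx n (ℕₚ.m⊔n≤o⇒m≤o M N ≤₁))
        q≤K = Q.∣∣≤-resp refl (toℚ-mono-≤ {+ D} {+ B} (ℤ.+≤+ (ℕₚ.m≤n+m D C))) (hy n (ℕₚ.m⊔n≤o⇒n≤o M N ≤₁))
        far  = proj₁ (tail 2K 2K-bound (n ℕ.+ n) (ℕₚ.≤-trans L≤n (ℕₚ.m≤m+n n n)))
        near = proj₂ (tail 2K 2K-bound n L≤n)
    in Q.∣∣≤-resp (solve 2 (λ a b → :- (a :- b) := b :- a) refl (S p n ℚ.* S q n) (S (p ℚ.+ q) n))
         (by-slack (slack far ⊕ slack near)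
           (solve 4 (λ a b c e → (con ½ :* e :- (a :- c)) :+ (con ½ :* e :- (:- (b :- c))) := e :- (a :- b)) refl
             (S 2K (n ℕ.+ n)) (S 2K n) (S 2K L) ε))
         (Q.∣-x∣≤ (∣product-error∣≤ n 0≤K p≤K q≤K))

exp-≈0 : ∀ {z} → z ≈ 0ℝ → exp z ≈ 1ℝ
exp-≈0 {z} z≈0 = null⇒≈ {exp z} {1ℝ} λ ε 0<ε →
  let η = (½ ℚ.* ε) ℚ.⊓ 1ℚ
      0<η = 0<⊓ (0<½* 0<ε) (ℚₚ.positive⁻¹ 1ℚ)
      N , h = ≈⇒null {z} {0ℝ} z≈0 η 0<η
  in N ℕ.⊔ 1 , λ n ≤n → subst (λ m → Q.∣ S (seq z n) m ℚ.- 1ℚ ∣≤ ε) (ℕₚ.m∸n+n≡m (ℕₚ.m⊔n≤o⇒n≤o N 1 ≤n))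
    (Q.∣∣≤-resp refl (by-slack (0≤fromℚ 2ℚ ⊛ slack (ℚₚ.p⊓q≤p (½ ℚ.* ε) 1ℚ))
        (solve 2 (λ e h → con 2ℚ :* (con ½ :* e :- h) := e :- con 2ℚ :* (con 1ℚ :* h :* con 1ℚ)) refl ε η))
      (tail-bound {seq z n} {η} 1 (ℚₚ.<⇒≤ 0<η) (Q.*-monoʳ-≤ {y = 1ℚ} (0≤fromℚ 2ℚ) (ℚₚ.p⊓q≤q (½ ℚ.* ε) 1ℚ))
        (Q.∣∣≤-resp (solve 1 (λ z → z :- con 0ℚ := z) refl (seq z n)) ℚₚ.≤-refl (h n (ℕₚ.m⊔n≤o⇒m≤o N 1 ≤n)))
        (n ∸ 1)))

-- The functional equation, applied to `x = y + (x - y)`, reduces this to the behaviour at 0.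
exp-cong : ∀ {x y} → x ≈ y → exp x ≈ exp y
exp-cong {x} {y} x≈y =
  ≈-trans {exp x} {exp (y + (x - y))} {exp y}
    (pointwise⇒≈ {exp x} {exp (y + (x - y))} λ n → cong (λ p → S p n) (solve 2 (λ x y → x := y :+ (x :- y)) refl (seq x n) (seq y n)))
    (≈-trans {exp (y + (x - y))} {exp y * exp (x - y)} {exp y} (exp-+ y (x - y))
      (≈-trans {exp y * exp (x - y)} {exp y * 1ℝ} {exp y}
        (*-cong {exp y} {exp y} {exp (x - y)} {1ℝ} (≈-refl (exp y)) (exp-≈0 {x - y} x-y≈0))
        (pointwise⇒≈ {exp y * 1ℝ} {exp y} λ n → ℚₚ.*-identityʳ (S (seq y n) n))))
  where
  x-y≈0 : x - y ≈ 0ℝ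
  x-y≈0 = null⇒≈ {x - y} {0ℝ} (null-resp (λ n → sym (ℚₚ.+-identityʳ (seq x n ℚ.- seq y n))) (≈⇒null {x} {y} x≈y))

-- Completeness by bisection

Bracket : (ℚ → Set) → Set
Bracket P = Σ (ℚ × ℚ) λ { (lo , hi) → lo ℚ.≤ hi × P lo × ¬ P hi }

module Bisection (lem : ExcludedMiddle 0ℓ) (P : ℚ → Set) (start : Bracket P) where

  lower upper width : Bracket P → ℚ
  lower ((lo , _) , _) = lo
  upper ((_ , hi) , _) = hi
  width b = upper b ℚ.- lower b

  record Refines (b b′ : Bracket P) : Set where
    field
      lower≤ : lower b ℚ.≤ lower b′
      upper≤ : upper b′ ℚ.≤ upper b
      halved : width b′ ≡ ½ ℚ.* width b

  open Refines

  halve : (b : Bracket P) → Σ (Bracket P) (Refines b)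
  halve ((lo , hi) , lo≤hi , Plo , ¬Phi) with lem {P (½ ℚ.* (lo ℚ.+ hi))}
  ... | yes Pmid = ((mid , hi) , mid≤hi , Pmid , ¬Phi) , record
    { lower≤ = lo≤mid ; upper≤ = ℚₚ.≤-refl
    ; halved = solve 2 (λ l h → h :- con ½ :* (l :+ h) := con ½ :* (h :- l)) refl lo hi }
    where
    mid = ½ ℚ.* (lo ℚ.+ hi)
    lo≤mid : lo ℚ.≤ mid
    lo≤mid = by-slack (0≤fromℚ ½ ⊛ slack lo≤hi) (solve 2 (λ l h → con ½ :* (h :- l) := con ½ :* (l :+ h) :- l) refl lo hi)
    mid≤hi : mid ℚ.≤ hi
    mid≤hi = by-slack (0≤fromℚ ½ ⊛ slack lo≤hi) (solve 2 (λ l h → con ½ :* (h :- l) := h :- con ½ :* (l :+ h)) refl lo hi)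
  ... | no ¬Pmid = ((lo , mid) , lo≤mid , Plo , ¬Pmid) , record
    { lower≤ = ℚₚ.≤-refl ; upper≤ = mid≤hi
    ; halved = solve 2 (λ l h → con ½ :* (l :+ h) :- l := con ½ :* (h :- l)) refl lo hi }
    where
    mid = ½ ℚ.* (lo ℚ.+ hi)
    lo≤mid : lo ℚ.≤ mid
    lo≤mid = by-slack (0≤fromℚ ½ ⊛ slack lo≤hi) (solve 2 (λ l h → con ½ :* (h :- l) := con ½ :* (l :+ h) :- l) refl lo hi)
    mid≤hi : mid ℚ.≤ hi
    mid≤hi = by-slack (0≤fromℚ ½ ⊛ slack lo≤hi) (solve 2 (λ l h → con ½ :* (h :- l) := h :- con ½ :* (l :+ h)) refl lo hi)

  bracket : ℕ → Bracket P
  bracket zero    = start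
  bracket (suc n) = proj₁ (halve (bracket n))

  private
    lo hi : ℕ → ℚ
    lo n = lower (bracket n)
    hi n = upper (bracket n)

    lo≤hi : ∀ n → lo n ℚ.≤ hi n
    lo≤hi n = proj₁ (proj₂ (bracket n))

    lo-mono : ∀ n r → lo n ℚ.≤ lo (r ℕ.+ n)
    lo-mono n zero    = ℚₚ.≤-refl
    lo-mono n (suc r) = ℚₚ.≤-trans (lo-mono n r) (lower≤ (proj₂ (halve (bracket (r ℕ.+ n)))))

    hi-mono : ∀ n r → hi (r ℕ.+ n) ℚ.≤ hi n
    hi-mono n zero    = ℚₚ.≤-refl
    hi-mono n (suc r) = ℚₚ.≤-trans (upper≤ (proj₂ (halve (bracket (r ℕ.+ n))))) (hi-mono n r)

    width≡ : ∀ n → width (bracket n) ≡ width start ℚ.* ½^ n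
    width≡ zero    = sym (ℚₚ.*-identityʳ (width start))
    width≡ (suc n) = trans (halved (proj₂ (halve (bracket n)))) (trans (cong (½ ℚ.*_) (width≡ n))
      (solve 2 (λ w h → con ½ :* (w :* h) := w :* (con ½ :* h)) refl (width start) (½^ n)))

    lo≤lo : ∀ {m n} → m ℕ.≤ n → lo m ℚ.≤ lo n
    lo≤lo {m} {n} m≤n = subst (λ j → lo m ℚ.≤ lo j) (ℕₚ.m∸n+n≡m m≤n) (lo-mono m (n ∸ m))

    lo≤hi′ : ∀ {m n} → m ℕ.≤ n → lo n ℚ.≤ hi m
    lo≤hi′ {m} {n} m≤n = ℚₚ.≤-trans (lo≤hi n)
      (subst (λ j → hi j ℚ.≤ hi m) (ℕₚ.m∸n+n≡m m≤n) (hi-mono m (n ∸ m)))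

    narrow : ∀ ε → 0ℚ ℚ.< ε → ∃[ n ] hi n ℚ.- lo n ℚ.≤ ε
    narrow ε 0<ε = let n , small = ½^-small (width start) ε 0<ε in
      n , subst (ℚ._≤ ε) (sym (width≡ n)) small

  cut : ℝ
  cut = mkℝ lo λ ε 0<ε → let N , small = narrow (½ ℚ.* ε) (0<½* 0<ε) in N , λ m n N≤m N≤n →
    ℚₚ.≤-<-trans (Q⇒∣∣≤
      ( by-slack (slack (lo≤hi′ N≤m) ⊕ slack (lo≤lo N≤n) ⊕ slack small)
          (solve 5 (λ l h a b e → (h :- a) :+ (b :- l) :+ (e :- (h :- l)) := e :- (a :- b)) refl (lo N) (hi N) (lo m) (lo n) (½ ℚ.* ε))
      , by-slack (slack (lo≤hi′ N≤n) ⊕ slack (lo≤lo N≤m) ⊕ slack small)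
          (solve 5 (λ l h a b e → (h :- b) :+ (a :- l) :+ (e :- (h :- l)) := e :- (:- (a :- b))) refl (lo N) (hi N) (lo m) (lo n) (½ ℚ.* ε))))
      (½*< 0<ε)

  cut-bracket : ∀ ε → 0ℚ ℚ.< ε → ∃[ p ] ∃[ q ] (P p × ¬ P q × fromℚ p ≤ cut × cut ≤ fromℚ q × q ℚ.≤ p ℚ.+ ε)
  cut-bracket ε 0<ε = let n , small = narrow ε 0<ε in
    lo n , hi n , proj₁ (proj₂ (proj₂ (bracket n))) , proj₂ (proj₂ (proj₂ (bracket n)))
    , eventually⇒≤ {fromℚ (lo n)} {cut} n (λ m n≤m → lo≤lo n≤m)
    , eventually⇒≤ {cut} {fromℚ (hi n)} n (λ m n≤m → lo≤hi′ n≤m)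
    , by-slack (slack small) (solve 3 (λ l h e → e :- (h :- l) := (l :+ e) :- h) refl (lo n) (hi n) ε)

module ℝ-Exponential (lem : ExcludedMiddle 0ℓ) where
  open Real lem

  ℝ-cuts : Cuts ℝ-orderedRing
  ℝ-cuts P a b a≤b Pa ¬Pb = Bisection.cut lem P start
    , λ n → Bisection.cut-bracket lem P start (1ℤ ℚ./ suc n) (ℚₚ.positive⁻¹ _ {{ℚₚ.normalize-pos 1 (suc n)}})
    where
    start : Bracket P
    start = (a , b) , a≤b , Pa , ¬Pb

  -- The rational bounds for the series need nonnegative arguments. If `0 < x`, the entries of `x`
  -- are eventually positive; the case `x ≈ 0` is settled by `exp-≈0`.
  0≤x⇒x≈0⊎0<x : ∀ x → 0ℝ ≤ x → x ≈ 0ℝ ⊎ 0ℝ < x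
  0≤x⇒x≈0⊎0<x x 0≤x with lem {0ℝ < x}
  ... | yes 0<x = inj₂ 0<x
  ... | no  0≮x = inj₁ (≤-antisym {x} {0ℝ} (≮⇒≥ {0ℝ} {x} 0≮x) 0≤x)

  1+x≤exp : ∀ {x} → 0ℝ ≤ x → 1ℝ + x ≤ exp x
  1+x≤exp {x} 0≤x with 0≤x⇒x≈0⊎0<x x 0≤x
  ... | inj₁ x≈0 = ≈⇒≤ {1ℝ + x} {exp x} (≈-trans {1ℝ + x} {1ℝ + 0ℝ} {exp x}
    (+-cong {1ℝ} {1ℝ} {x} {0ℝ} (≈-refl 1ℝ) x≈0)
    (≈-trans {1ℝ + 0ℝ} {1ℝ} {exp x} (pointwise⇒≈ {1ℝ + 0ℝ} {1ℝ} λ _ → refl) (≈-sym {exp x} {1ℝ} (exp-≈0 {x} x≈0))))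
  ... | inj₂ (δ , 0<δ , N , h) = eventually⇒≤ {1ℝ + x} {exp x} (N ℕ.⊔ 2) λ n ≤n →
    subst (λ m → 1ℚ ℚ.+ seq x n ℚ.≤ S (seq x n) m) (ℕₚ.m∸n+n≡m (ℕₚ.m⊔n≤o⇒n≤o N 2 ≤n))
      (S≥1+p (ℚₚ.≤-trans (ℚₚ.<⇒≤ 0<δ) (subst (ℚ._≤ seq x n) (ℚₚ.+-identityˡ δ) (h n (ℕₚ.m⊔n≤o⇒m≤o N 2 ≤n)))) (n ∸ 2))

  exp≤1+2x : ∀ {x} → 0ℝ ≤ x → x ≤ fromℚ ½ → exp x ≤ 1ℝ + fromℚ 2ℚ * x
  exp≤1+2x {x} 0≤x x≤½ with 0≤x⇒x≈0⊎0<x x 0≤x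
  ... | inj₁ x≈0 = ≈⇒≤ {exp x} {1ℝ + fromℚ 2ℚ * x} (≈-trans {exp x} {1ℝ} {1ℝ + fromℚ 2ℚ * x} (exp-≈0 {x} x≈0)
    (≈-sym {1ℝ + fromℚ 2ℚ * x} {1ℝ} (null⇒≈ {1ℝ + fromℚ 2ℚ * x} {1ℝ} (null-resp
      (λ n → solve 1 (λ x → (x :- con 0ℚ) :+ (x :- con 0ℚ) := (con 1ℚ :+ con 2ℚ :* x) :- con 1ℚ) refl (seq x n))
      (null-+ (≈⇒null {x} {0ℝ} x≈0) (≈⇒null {x} {0ℝ} x≈0))))))
  ... | inj₂ (δ , 0<δ , N , h) =
    let M , g = x≤½ ½ (ℚₚ.positive⁻¹ ½) in
    eventually⇒≤ {exp x} {1ℝ + fromℚ 2ℚ * x} ((N ℕ.⊔ M) ℕ.⊔ 1) λ n ≤n →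
      let ≤₁ = ℕₚ.m⊔n≤o⇒m≤o (N ℕ.⊔ M) 1 ≤n
          ≤₂ = ℕₚ.m⊔n≤o⇒n≤o (N ℕ.⊔ M) 1 ≤n
      in subst (λ m → S (seq x n) m ℚ.≤ 1ℚ ℚ.+ 2ℚ ℚ.* seq x n) (ℕₚ.m∸n+n≡m ≤₂)
        (S≤1+2p (ℚₚ.≤-trans (ℚₚ.<⇒≤ 0<δ) (subst (ℚ._≤ seq x n) (ℚₚ.+-identityˡ δ) (h n (ℕₚ.m⊔n≤o⇒m≤o N M ≤₁))))
          (g n (ℕₚ.m⊔n≤o⇒n≤o N M ≤₁)) (n ∸ 1))

  ℝ-exponentialFunction : ExponentialFunction ℝ-orderedRing
  ℝ-exponentialFunction = record
    { exp        = exp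
    ; exp-cong   = λ {x} {y} → exp-cong {x} {y}
    ; exp-+      = exp-+
    ; exp-0      = exp-≈0 {0ℝ} (≈-refl 0ℝ)
    ; exp-≥      = λ {x} → 1+x≤exp {x}
    ; exp-near-0 = λ {x} → exp≤1+2x {x}
    }

reciprocal-2^ : ∀ e → reciprocal (2 ℕ.^ e) ≡ ½^ e
reciprocal-2^ e = sym (reciprocal-unique (2 ℕ.^ e) (½^ e) (ℕₚ.m^n>0 2 e) (trans (ℚₚ.*-comm (½^ e) _) (2^*½^ e)))

z/n*n≡z : ∀ z n → (z ℚ./ suc n) ℚ.* toℚ (+ suc n) ≡ toℚ z
z/n*n≡z z n = trans (sym (fromℚᵘ-homo-* (mkℚᵘ z n) (mkℚᵘ (+ suc n) 0)))
  (ℚₚ.fromℚᵘ-cong {mkℚᵘ z n ℚᵘ.* mkℚᵘ (+ suc n) 0} {mkℚᵘ z 0}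
    (*≡* (trans (ℤₚ.*-identityʳ (z ℤ.* + suc n)) (cong (z ℤ.*_) (cong +_ (sym (ℕₚ.*-identityʳ (suc n))))))))

τ≡ : ∀ k → fromℚ (τℚ (suc k)) ≈ (1ℤ ℤ.- + suc k) ÷ (2 ℕ.* suc k)
τ≡ k = pointwise⇒≈ {fromℚ (τℚ (suc k))} {(1ℤ ℤ.- + suc k) ÷ (2 ℕ.* suc k)} λ _ → begin
  ½ ℚ.* (κ ℚ.- 1ℚ)
    ≡⟨ cong (λ x → ½ ℚ.* (κ ℚ.- x)) (sym (1/n*n≡1 (suc k))) ⟩
  ½ ℚ.* (κ ℚ.- κ ℚ.* K)
    ≡⟨ solve 2 (λ κ K → con ½ :* (κ :- κ :* K) := (con 1ℚ :- K) :* (con ½ :* κ)) refl κ K ⟩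
  (1ℚ ℚ.- K) ℚ.* (½ ℚ.* κ)
    ≡⟨ cong₂ ℚ._*_ (sym (trans (toℚ-homo-+ 1ℤ (ℤ.- + suc k)) (cong (1ℚ ℚ.+_) (toℚ-homo-neg (+ suc k)))))
         (reciprocal-unique (2 ℕ.* suc k) (½ ℚ.* κ) (ℕ.s≤s ℕ.z≤n) half) ⟩
  toℚ z ℚ.* r
    ≡⟨ cong (ℚ._* r) (sym (z/n*n≡z z n)) ⟩
  ((z ℚ./ suc n) ℚ.* toℚ (+ suc n)) ℚ.* r
    ≡⟨ solve 3 (λ q n r → (q :* n) :* r := q :* (r :* n)) refl (z ℚ./ suc n) (toℚ (+ suc n)) r ⟩
  (z ℚ./ suc n) ℚ.* (r ℚ.* toℚ (+ suc n))
    ≡⟨ cong ((z ℚ./ suc n) ℚ.*_) (1/n*n≡1 (suc n)) ⟩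
  (z ℚ./ suc n) ℚ.* 1ℚ
    ≡⟨ ℚₚ.*-identityʳ (z ℚ./ suc n) ⟩
  z ℚ./ suc n ∎
  where
  open ≡-Reasoning
  κ = 1ℤ ℚ./ suc k
  K = toℚ (+ suc k)
  z = 1ℤ ℤ.- + suc k
  n = ℕ.pred (2 ℕ.* suc k)
  r = reciprocal (2 ℕ.* suc k)
  half : (½ ℚ.* κ) ℚ.* toℚ (+ (2 ℕ.* suc k)) ≡ 1ℚ
  half = trans (cong ((½ ℚ.* κ) ℚ.*_) (toℚ-pos-* 2 (suc k)))
    (trans (solve 2 (λ κ K → (con ½ :* κ) :* (con 2ℚ :* K) := κ :* K) refl κ K) (1/n*n≡1 (suc k)))

-- The denominators and their series

module Denominators (k : ℕ) where

  index : ℕ → ℕ → ℕ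
  index n j = (n ∸ 1) ℕ.* k ℕ.+ j

  q : ℕ → ℕ → ℕ
  q n j = 2 ℕ.^ (index n j !)

  private
    next : ∀ n → 1 ℕ.≤ n → suc (index n k) ≡ index (suc n) 1
    next (suc n) _ = trans (cong suc (ℕₚ.+-comm (n ℕ.* k) k)) (ℕₚ.+-comm 1 (k ℕ.+ n ℕ.* k))

    -- Since `0 !` equals `1 !`, growth starts at `m = 1`, which is also the first index in use.
    2^!-increasing : ∀ m → 1 ℕ.≤ m → 2 ℕ.^ (m !) ℕ.< 2 ℕ.^ (suc m !)
    2^!-increasing m 1≤m = ℕₚ.^-monoʳ-< 2 (ℕ.s≤s (ℕ.s≤s ℕ.z≤n))
      (subst (ℕ._≤ suc m !) (ℕₚ.+-comm (m !) 1) (ℕₚ.+-monoʳ-≤ (m !) (ℕₚ.*-mono-≤ 1≤m (n!≥1 m))))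

    2^!-divides : ∀ m → 2 ℕ.^ (m !) ∣ 2 ℕ.^ (suc m !)
    2^!-divides m = subst (2 ℕ.^ (m !) ∣_) (sym (ℕₚ.^-distribˡ-+-* 2 (m !) (m ℕ.* m !))) (m∣m*n (2 ℕ.^ (m ℕ.* m !)))

  increasing : 1 ℕ.≤ k → Increasing k q
  increasing 1≤k n 1≤n =
      (λ j 1≤j _ → subst (λ m → q n j ℕ.< 2 ℕ.^ (m !)) (sym (ℕₚ.+-suc ((n ∸ 1) ℕ.* k) j))
        (2^!-increasing (index n j) (ℕₚ.≤-trans 1≤j (ℕₚ.m≤n+m j ((n ∸ 1) ℕ.* k)))))
    , subst (λ m → q n k ℕ.< 2 ℕ.^ (m !)) (next n 1≤n)
        (2^!-increasing (index n k) (ℕₚ.≤-trans 1≤k (ℕₚ.m≤n+m k ((n ∸ 1) ℕ.* k))))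

  divisibility : Divisibility k q
  divisibility n 1≤n =
      (λ j _ _ → subst (λ m → q n j ∣ 2 ℕ.^ (m !)) (sym (ℕₚ.+-suc ((n ∸ 1) ℕ.* k) j)) (2^!-divides (index n j)))
    , subst (λ m → q n k ∣ 2 ℕ.^ (m !)) (next n 1≤n) (2^!-divides (index n k))

module Sums (k : ℕ) .{{_ : ℕ.NonZero k}} where
  open Approximants k
  open Denominators k

  σ-close : ∀ i ε → 0ℚ ℚ.< ε → ∃[ N ] (∀ m n → N ℕ.≤ m → N ℕ.≤ n → Q.∣ σ m i ℚ.- σ n i ∣≤ ε)
  σ-close i ε 0<ε =
    let N , small = ½^-small 2ℚ ε 0<ε
        tail≤ε = ℚₚ.≤-trans (Q.*-monoʳ-≤ (0≤fromℚ 2ℚ) (½^-antitone (ℕₚ.≤-trans (ℕₚ.n≤1+n N) (n!≥n (suc N))))) small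
    in N , λ m n N≤m N≤n →
         by-slack (slack (σ-tail-≤ N≤m i) ⊕ slack (σ-mono-≤ N≤n i) ⊕ slack tail≤ε)
           (solve 5 (λ a b c t e → ((c :+ t) :- a) :+ (b :- c) :+ (e :- t) := e :- (a :- b)) refl
             (σ m i) (σ n i) (σ N i) (2ℚ ℚ.* ½^ (suc N !)) ε)
       , by-slack (slack (σ-tail-≤ N≤n i) ⊕ slack (σ-mono-≤ N≤m i) ⊕ slack tail≤ε)
           (solve 5 (λ a b c t e → ((c :+ t) :- b) :+ (a :- c) :+ (e :- t) := e :- (:- (a :- b))) refl
             (σ m i) (σ n i) (σ N i) (2ℚ ℚ.* ½^ (suc N !)) ε)

  ζ : Vector ℝ k
  ζ i = mkℝ (λ n → σ n i) λ ε 0<ε → let N , h = σ-close i (½ ℚ.* ε) (0<½* 0<ε) in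
    N , λ m n N≤m N≤n → ℚₚ.≤-<-trans (Q⇒∣∣≤ (h m n N≤m N≤n)) (½*< 0<ε)

  ζ-lower : ∀ m i → fromℚ (σ m i) ≤ ζ i
  ζ-lower m i = eventually⇒≤ {fromℚ (σ m i)} {ζ i} m λ n m≤n → σ-mono-≤ m≤n i

  ζ-upper : ∀ m i → ζ i ≤ fromℚ (σ m i ℚ.+ 2ℚ ℚ.* ½^ (suc m !))
  ζ-upper m i = eventually⇒≤ {ζ i} {fromℚ (σ m i ℚ.+ 2ℚ ℚ.* ½^ (suc m !))} m λ n m≤n →
    σ-tail-≤ m≤n i

  private
    toℕ-mod : ∀ r n → r ℕ.< k → toℕ ((r ℕ.+ n ℕ.* k) mod k) ≡ r
    toℕ-mod r n r<k = trans (Finₚ.toℕ-fromℕ< _) (trans ([m+kn]%n≡m%n r n k) (m<n⇒m%n≡m r<k))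

    block-before : ∀ i n r → r ℕ.≤ toℕ i → σ (r ℕ.+ n ℕ.* k) i ≡ σ (n ℕ.* k) i
    block-before i n zero    _   = refl
    block-before i n (suc r) r<i = trans
      (σ-skip (r ℕ.+ n ℕ.* k) i λ eq → ℕₚ.<⇒≢ r<i
        (trans (sym (toℕ-mod r n (ℕₚ.<-trans r<i (Finₚ.toℕ<n i)))) (cong toℕ eq)))
      (block-before i n r (ℕₚ.<⇒≤ r<i))

    -- Each block of `k` stages changes coordinate `i` exactly once, at its stage `i`, and there
    -- adds the term of the `(n + 1)`-st denominator.
    block-after : ∀ i n r → toℕ i ℕ.< r → r ℕ.≤ k →
      σ (r ℕ.+ n ℕ.* k) i ≡ σ (n ℕ.* k) i ℚ.+ ½^ (suc (toℕ i ℕ.+ n ℕ.* k) !)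
    block-after i n (suc r) (ℕ.s≤s i≤r) r<k with ℕₚ.m≤n⇒m<n∨m≡n i≤r
    ... | inj₁ i<r = trans
      (σ-skip (r ℕ.+ n ℕ.* k) i λ eq → ℕₚ.<⇒≢ i<r (trans (cong toℕ (sym eq)) (toℕ-mod r n r<k)))
      (block-after i n r i<r (ℕₚ.<⇒≤ r<k))
    ... | inj₂ refl = cong₂ ℚ._+_ (block-before i n r ℕₚ.≤-refl)
      (trans (cong (λ e → toℚ e ℚ.* ½^ (suc (r ℕ.+ n ℕ.* k) !))
          (trans (cong (λ j → δ j i) (Finₚ.toℕ-injective (toℕ-mod r n r<k))) (δ-refl i)))
        (ℚₚ.*-identityˡ (½^ (suc (r ℕ.+ n ℕ.* k) !))))

    block-sum : ∀ i N → ∑ (λ n → reciprocal (q (suc n) (suc (toℕ i)))) N ≡ σ (N ℕ.* k) i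
    block-sum i zero    = refl
    block-sum i (suc N) = trans
      (cong₂ ℚ._+_ (block-sum i N) (trans (reciprocal-2^ (index (suc N) (suc (toℕ i)) !))
        (cong (λ m → ½^ (m !)) (ℕₚ.+-comm (N ℕ.* k) (suc (toℕ i))))))
      (sym (block-after i N k (Finₚ.toℕ<n i) ℕₚ.≤-refl))

  ζ-series : ∀ i → IsSeries (λ n → 1ℤ ÷ q (suc n) (suc (toℕ i))) (ζ i)
  ζ-series i = converges {λ N → sum {N} (λ j → g (toℕ j))} {ζ i} λ ε 0<ε →
    let N , h = σ-close i ε 0<ε in N , λ n N≤n → N , λ m N≤m →
      Q.∣∣≤-resp (cong (ℚ._- σ m i) (sym (trans (seq-sum g n m)
          (trans (∑-cong n λ j _ → reciprocal-seq (q (suc j) (suc (toℕ i))) m) (block-sum i n)))))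
        ℚₚ.≤-refl (h (n ℕ.* k) m (ℕₚ.≤-trans N≤n (ℕₚ.m≤m*n n k)) N≤m)
    where
    g : ℕ → ℝ
    g n = 1ℤ ÷ q (suc n) (suc (toℕ i))

-- Translation between the logarithmic form and the statement

∣x∣≤⇒ : ∀ {x P} → ∣ x ∣ ≤ P → x ≤ P × - x ≤ P
∣x∣≤⇒ {x} {P} ∣x∣≤P =
    ≤-trans {x} {∣ x ∣} {P} (eventually⇒≤ {x} {∣ x ∣} 0 λ n _ → proj₁ (∣∣≤⇒Q {seq x n} ℚₚ.≤-refl)) ∣x∣≤P
  , ≤-trans { - x} {∣ x ∣} {P} (eventually⇒≤ { - x} {∣ x ∣} 0 λ n _ → proj₂ (∣∣≤⇒Q {seq x n} ℚₚ.≤-refl)) ∣x∣≤P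

⇒∣x∣≤ : ∀ {x P} → x ≤ P × - x ≤ P → ∣ x ∣ ≤ P
⇒∣x∣≤ {x} {P} (x≤P , -x≤P) ε 0<ε =
  let M , h = x≤P ε 0<ε
      N , g = -x≤P ε 0<ε
  in M ℕ.⊔ N , λ n ≤n → Q⇒∣∣≤ (h n (ℕₚ.m⊔n≤o⇒m≤o M N ≤n) , g n (ℕₚ.m⊔n≤o⇒n≤o M N ≤n))

∣∣≤-cong : ∀ {x P P′} → P ≈ P′ → x ≤ P × - x ≤ P → x ≤ P′ × - x ≤ P′
∣∣≤-cong {x} {P} {P′} P≈P′ (x≤P , -x≤P) =
  ≤-trans {x} {P} {P′} x≤P (≈⇒≤ {P} {P′} P≈P′) , ≤-trans { - x} {P} {P′} -x≤P (≈⇒≤ {P} {P′} P≈P′)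

-- Turns existence into a total function by excluded middle. For `ψ` the default 0 can occur only
-- outside `Q > 1` and `1 ≤ j ≤ k + 1`.
witness : ∀ {P : ℝ → Set} → Dec (Σ ℝ P) → ℝ
witness (yes (x , _)) = x
witness (no _)        = 0ℝ

witness-satisfies : ∀ {P : ℝ → Set} (P? : Dec (Σ ℝ P)) → Σ ℝ P → P (witness P?)
witness-satisfies (yes (_ , Px)) _  = Px
witness-satisfies (no ¬∃)        ∃P = contradiction ∃P ¬∃

module SolutionCorrespondence (lem : ExcludedMiddle 0ℓ) (k-1 : ℕ) where

  k : ℕ
  k = suc k-1

  open Real lem public
  open ℝ-Exponential lem public
  open Sums k public
  open Denominators k public
  module Log = Logarithm ℝ-orderedRing ℝ-exponentialFunction

  ℝ-setting : Setting
  ℝ-setting = record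
    { R = ℝ-orderedRing ; X = Log.exponential ℝ-cuts ; k-1 = k-1
    ; ζ = ζ ; ζ-lower = ζ-lower ; ζ-upper = ζ-upper ; lem = lem }

  module Minima = Approximation ℝ-setting

  -- `IsPower` carries some logarithm of `Q`; injectivity of `exp` identifies it with `l`, so the
  -- power is unique.
  power⇒ : ∀ {Q l θ P} → exp l ≈ Q → IsPower Q θ P → P ≈ exp (θ * l)
  power⇒ {Q} {l} {θ} {P} el≈Q (l′ , log , power) =
    ≈-sym {exp (θ * l)} {P} (≈-trans {exp (θ * l)} {exp (θ * l′)} {P}
      (exp-cong {θ * l} {θ * l′} (*-cong {θ} {θ} {l} {l′} (≈-refl θ) l≈l′))
      (isExp⇒exp {θ * l′} {P} power))
    where
    l≈l′ : l ≈ l′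
    l≈l′ = Log.exp-reflects-≈ {l} {l′} (≈-trans {exp l} {Q} {exp l′} el≈Q
      (≈-sym {exp l′} {Q} (isExp⇒exp {l′} {Q} log)))

  ⇒power : ∀ {Q l} θ → exp l ≈ Q → IsPower Q θ (exp (θ * l))
  ⇒power {Q} {l} θ el≈Q = l , exp-isExp {l} {Q} el≈Q
    , exp-isExp {θ * l} {exp (θ * l)} (≈-refl (exp (θ * l)))

  private
    second-exponent : ∀ l θ → exp ((-1ℤ ÷ k + θ) * l) ≈ exp ((- Minima.κ + θ) * l)
    second-exponent l θ = exp-cong {(-1ℤ ÷ k + θ) * l} {(- Minima.κ + θ) * l}
      (pointwise⇒≈ {(-1ℤ ÷ k + θ) * l} {(- Minima.κ + θ) * l} λ _ → refl)

  solves⇒solution : ∀ {Q l θ} w → exp l ≈ Q → Solves ζ Q θ w → Minima.Solution l θ w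
  solves⇒solution {Q} {l} {θ} w el≈Q ((P , power , bound) , (P′ , power′ , bounds)) =
      ∣∣≤-cong {fromℤ (w 0F)} {P} {exp ((1ℝ + θ) * l)} (power⇒ {Q} {l} {1ℝ + θ} {P} el≈Q power)
        (∣x∣≤⇒ {fromℤ (w 0F)} {P} bound)
    , λ i → ∣∣≤-cong {y i} {P′} {exp ((- Minima.κ + θ) * l)}
        (≈-trans {P′} {exp ((-1ℤ ÷ k + θ) * l)} {exp ((- Minima.κ + θ) * l)}
          (power⇒ {Q} {l} { -1ℤ ÷ k + θ} {P′} el≈Q power′) (second-exponent l θ))
        (∣x∣≤⇒ {y i} {P′} (bounds i))
    where
    y : Fin k → ℝ
    y i = ζ i * fromℤ (w 0F) - fromℤ (w (Fin.suc i))

  solution⇒solves : ∀ {Q l θ} w → exp l ≈ Q → Minima.Solution l θ w → Solves ζ Q θ w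
  solution⇒solves {Q} {l} {θ} w el≈Q (bound , bounds) =
      (exp ((1ℝ + θ) * l) , ⇒power {Q} {l} (1ℝ + θ) el≈Q , ⇒∣x∣≤ {fromℤ (w 0F)} {exp ((1ℝ + θ) * l)} bound)
    , (exp ((-1ℤ ÷ k + θ) * l) , ⇒power {Q} {l} (-1ℤ ÷ k + θ) el≈Q , λ i →
        ⇒∣x∣≤ {y i} {exp ((-1ℤ ÷ k + θ) * l)} (∣∣≤-cong {y i} {exp ((- Minima.κ + θ) * l)} {exp ((-1ℤ ÷ k + θ) * l)}
          (≈-sym {exp ((-1ℤ ÷ k + θ) * l)} {exp ((- Minima.κ + θ) * l)} (second-exponent l θ)) (bounds i)))
    where
    y : Fin k → ℝ
    y i = ζ i * fromℤ (w 0F) - fromℤ (w (Fin.suc i))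

  Has⇒independent : ∀ {j Q l θ} → exp l ≈ Q → HasIndependentSolutions ζ j Q θ → Minima.IndependentSolutions j l θ
  Has⇒independent {j} {Q} {l} {θ} el≈Q (v , ind , sol) =
    v , ind , λ i → solves⇒solution {Q} {l} {θ} (v i) el≈Q (sol i)

  independent⇒Has : ∀ {j Q l θ} → exp l ≈ Q → Minima.IndependentSolutions j l θ → HasIndependentSolutions ζ j Q θ
  independent⇒Has {j} {Q} {l} {θ} el≈Q (v , ind , sol) =
    v , ind , λ i → solution⇒solves {Q} {l} {θ} (v i) el≈Q (sol i)

  1<Q⇒log : ∀ Q → 1ℝ < Q → Σ ℝ λ l → exp l ≈ Q
  1<Q⇒log Q 1<Q = Log.logarithm ℝ-cuts Q (<⇒≤ {1ℝ} {Q} 1<Q)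

  log-positive : ∀ {Q l} → exp l ≈ Q → 1ℝ < Q → 0ℝ < l
  log-positive {Q} {l} el≈Q 1<Q = ≰⇒> {l} {0ℝ} λ l≤0 → <⇒≱ {1ℝ} {Q} 1<Q
    (≤-trans {Q} {exp l} {1ℝ} (≈⇒≤ {Q} {exp l} (≈-sym {exp l} {Q} el≈Q)) (Log.exp-≤1 {l} l≤0))

  positive⇒tolerance : ∀ {x} → 0ℝ < x → Minima.Tolerance x
  positive⇒tolerance {x} 0<x@(δ , 0<δ , N , h) =
    let n , 1/n≤δ = 1/n≤p δ 0<δ in <⇒≤ {0ℝ} {x} 0<x , suc n
    , eventually⇒≤ {1ℝ} {fromℤ (+ suc n) * x} N λ m N≤m →
        ℚₚ.≤-trans (ℚₚ.≤-reflexive (sym (trans (ℚₚ.*-comm (toℚ (+ suc n)) (1ℤ ℚ./ suc n)) (1/n*n≡1 (suc n)))))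
          (Q.*-monoʳ-≤ (0≤toℚ (suc n))
            (ℚₚ.≤-trans 1/n≤δ (subst (ℚ._≤ seq x m) (ℚₚ.+-identityˡ δ) (h m N≤m))))

  minimum : ∀ j → 1 ℕ.≤ j → j ℕ.≤ suc k → ∀ Q → 1ℝ < Q → Σ ℝ (IsMinimum (HasIndependentSolutions ζ j Q))
  minimum j 1≤j j≤ Q 1<Q =
    let l , el≈Q = 1<Q⇒log Q 1<Q
        0<l = log-positive {Q} {l} el≈Q 1<Q
        m , attained , least = Minima.minimum-exists ℝ-cuts {j} {l} 1≤j j≤ (positive⇒tolerance {l} 0<l)
    in m , independent⇒Has {j} {Q} {l} {m} el≈Q attained
         , λ θ sols → least θ (Has⇒independent {j} {Q} {l} {θ} el≈Q sols)

  ψ : ℕ → ℝ → ℝ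
  ψ j Q = witness (lem {Σ ℝ (IsMinimum (HasIndependentSolutions ζ j Q))})

  ψ-isPsi : IsPsi ζ ψ
  ψ-isPsi j 1≤j j≤ Q 1<Q = witness-satisfies lem (minimum j 1≤j j≤ Q 1<Q)

  module _ (j : ℕ) (1≤j : 1 ℕ.≤ j) (j≤ : j ℕ.≤ suc k) where

    ψ≤ : ∀ {Q l θ} → exp l ≈ Q → 1ℝ < Q → Minima.IndependentSolutions j l θ → ψ j Q ≤ θ
    ψ≤ {Q} {l} {θ} el≈Q 1<Q sols = proj₂ (ψ-isPsi j 1≤j j≤ Q 1<Q) θ (independent⇒Has {j} {Q} {l} {θ} el≈Q sols)

    <ψ : ∀ {Q l θ} → exp l ≈ Q → 1ℝ < Q → ¬ Minima.IndependentSolutions j l θ → θ < ψ j Q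
    <ψ {Q} {l} {θ} el≈Q 1<Q none = ≰⇒> {ψ j Q} {θ} λ ψ≤θ → none
      (Minima.independent-mono {j} {l} {ψ j Q} {θ} (<⇒≤ {0ℝ} {l} (log-positive {Q} {l} el≈Q 1<Q)) ψ≤θ
        (Has⇒independent {j} {Q} {l} {ψ j Q} el≈Q (proj₁ (ψ-isPsi j 1≤j j≤ Q 1<Q))))

    private
      half : ∀ {ε} → 0ℝ < ε → Minima.Tolerance (fromℚ ½ * ε)
      half {ε} (δ , 0<δ , N , h) = positive⇒tolerance {fromℚ ½ * ε} (½ ℚ.* δ , 0<½* 0<δ , N , λ n N≤n →
        by-slack (0≤fromℚ ½ ⊛ slack (h n N≤n)) (solve 2 (λ d e → con ½ :* (e :- (con 0ℚ :+ d)) := con ½ :* e :- (con 0ℚ :+ con ½ :* d)) refl δ (seq ε n)))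

      above : ∀ {c ε f} → 0ℝ < ε → c - fromℚ ½ * ε < f → c - ε < f
      above {c} {ε} {f} 0<ε@(_ , 0<δ , N , h) (δ , 0<δ′ , M , g) = δ , 0<δ′ , N ℕ.⊔ M , λ n ≤n →
        by-slack (slack (g n (ℕₚ.m⊔n≤o⇒n≤o N M ≤n)) ⊕ 0≤fromℚ ½ ⊛ (slack (h n (ℕₚ.m⊔n≤o⇒m≤o N M ≤n)) ⊕ ℚₚ.<⇒≤ 0<δ))
          (solve 5 (λ c e f d x → (f :- ((c :- con ½ :* e) :+ d)) :+ con ½ :* ((e :- (con 0ℚ :+ x)) :+ x) := f :- ((c :- e) :+ d)) refl
            (seq c n) (seq ε n) (seq f n) δ (proj₁ 0<ε))

      -- A minimum gives only a weak inequality; using it at `ε / 2` leaves the gap needed for a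
      -- strict one at `ε`.
      below : ∀ {c ε f} → 0ℝ < ε → f ≤ c + fromℚ ½ * ε → f < c + ε
      below {c} {ε} {f} (δ , 0<δ , N , h) f≤ =
        let η = ½ ℚ.* (½ ℚ.* δ)
            M , g = f≤ η (0<½* (0<½* 0<δ))
        in η , 0<½* (0<½* 0<δ) , N ℕ.⊔ M , λ n ≤n →
          by-slack (slack (g n (ℕₚ.m⊔n≤o⇒n≤o N M ≤n)) ⊕ 0≤fromℚ ½ ⊛ slack (h n (ℕₚ.m⊔n≤o⇒m≤o N M ≤n)))
            (solve 4 (λ c e f d → (((c :+ con ½ :* e) :+ con ½ :* (con ½ :* d)) :- f) :+ con ½ :* (e :- (con 0ℚ :+ d))
                := (c :+ e) :- (f :+ con ½ :* (con ½ :* d))) refl (seq c n) (seq ε n) (seq f n) δ)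

      eventually : ∀ {P : ℝ → Set} → Minima.Eventually P →
        ∃[ Q₀ ] (∀ Q → Q₀ < Q → 1ℝ < Q × Σ ℝ λ l → exp l ≈ Q × P l)
      eventually (L , 0≤L , h) = exp L , λ Q eL<Q →
        let 1≤eL = Log.1≤exp {L} 0≤L
            1<Q = ≰⇒> {Q} {1ℝ} λ Q≤1 → <⇒≱ {exp L} {Q} eL<Q (≤-trans {Q} {1ℝ} {exp L} Q≤1 1≤eL)
            l , el≈Q = 1<Q⇒log Q 1<Q
        in 1<Q , l , el≈Q , h l (Log.exp-reflects-≤ {L} {l}
             (≤-trans {exp L} {Q} {exp l} (<⇒≤ {exp L} {Q} eL<Q) (≈⇒≤ {Q} {exp l} (≈-sym {exp l} {Q} el≈Q))))

      often : ∀ {P : ℝ → Set} → Minima.Often P → ∀ Q₀ → Σ ℝ λ Q → Q₀ < Q × 1ℝ < Q × Σ ℝ λ l → exp l ≈ Q × P l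
      often h Q₀ =
        let n , exceeds = Log.exp-exceeds Q₀
            l , n<l , Pl = h (fromℤ (+ n))
            Q₀<el , 1<el = exceeds {l} n<l
        in exp l , ≰⇒> {exp l} {Q₀} Q₀<el , ≰⇒> {exp l} {1ℝ} 1<el , l , ≈-refl (exp l) , Pl

    ψ-liminf : IsLiminf (ψ j) (Minima.liminf j)
    ψ-liminf =
        (λ ε 0<ε → let Q₀ , h = eventually (Minima.eventually-above-liminf j 1≤j {fromℚ ½ * ε} (half {ε} 0<ε)) in
          Q₀ , λ Q Q₀<Q → let 1<Q , l , el≈Q , none = h Q Q₀<Q in
            above {Minima.liminf j} {ε} {ψ j Q} 0<ε (<ψ {Q} {l} {Minima.liminf j - fromℚ ½ * ε} el≈Q 1<Q none))
      , (λ ε 0<ε Q₀ → let Q , Q₀<Q , 1<Q , l , el≈Q , sols = often (Minima.often-below-liminf j 1≤j j≤ {fromℚ ½ * ε} (half {ε} 0<ε)) Q₀ in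
          Q , Q₀<Q , below {Minima.liminf j} {ε} {ψ j Q} 0<ε (ψ≤ {Q} {l} {Minima.liminf j + fromℚ ½ * ε} el≈Q 1<Q sols))

    ψ-limsup : IsLimsup (ψ j) (Minima.limsup j)
    ψ-limsup =
        (λ ε 0<ε → let Q₀ , h = eventually (Minima.eventually-below-limsup j 1≤j j≤ {fromℚ ½ * ε} (half {ε} 0<ε)) in
          Q₀ , λ Q Q₀<Q → let 1<Q , l , el≈Q , sols = h Q Q₀<Q in
            below {Minima.limsup j} {ε} {ψ j Q} 0<ε (ψ≤ {Q} {l} {Minima.limsup j + fromℚ ½ * ε} el≈Q 1<Q sols))
      , (λ ε 0<ε Q₀ → let Q , Q₀<Q , 1<Q , l , el≈Q , none = often (Minima.often-above-limsup j 1≤j {fromℚ ½ * ε} (half {ε} 0<ε)) Q₀ in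
          Q , Q₀<Q , above {Minima.limsup j} {ε} {ψ j Q} 0<ε (<ψ {Q} {l} {Minima.limsup j - fromℚ ½ * ε} el≈Q 1<Q none))

  b : ℕ → ℝ
  b = Minima.A

  b-isLog : ∀ m → IsLog (fromℤ (+ (2 ℕ.^ (m !)))) (b m)
  b-isLog m = exp-isExp {b m} {fromℤ (+ (2 ℕ.^ (m !)))} (Minima.exp-A m)

  b-ratios : RatiosTendTo∞ b
  b-ratios M =
    -- The quotient is exactly `m + 1` by `A-suc`, so it exceeds `M` as soon as `m ≥ n ≥ M`.
    let n , M≤n = Minima.archimedean M in n , λ m n≤m → fromℤ (+ suc m)
    , (nonzero m , ≈-sym {b (suc m)} {fromℤ (+ suc m) * b m} (Minima.A-suc m))
    , ≰⇒> {fromℤ (+ suc m)} {M} λ 1+m≤M → ℕₚ.<⇒≱ (ℕ.s≤s n≤m)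
        (ℤₚ.drop‿+≤+ (Minima.fromℤ-cancel {+ suc m} {+ n} (≤-trans {fromℤ (+ suc m)} {M} {fromℤ (+ n)} 1+m≤M M≤n)))
    where
    nonzero : ∀ m → ¬ (b m ≈ 0ℝ)
    nonzero m b≈0 = contradiction (fromℚ-cancel {½} {0ℚ} (≤-trans {fromℚ ½} {Minima.log2} {0ℝ} Minima.log2≥½
      (≤-trans {Minima.log2} {b m} {0ℝ} (Minima.log2≤A m) (≈⇒≤ {b m} {0ℝ} b≈0)))) λ { (ℚ.*≤* (ℤ.+≤+ ())) }

theorem3p2 : ExcludedMiddle 0ℓ →
    (k : ℕ) → 2 ℕ.≤ k →
    Σ (ℕ → ℕ → ℕ) λ q →
    Σ (Vector ℝ k) λ ζ →
    Σ (ℕ → ℝ → ℝ) λ ψ →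
    Σ (ℕ → ℝ) λ liminfψ →
    Σ (ℕ → ℝ) λ limsupψ →
    (∀ n j → 1 ℕ.≤ n → 1 ℕ.≤ j → j ℕ.≤ k → 0 ℕ.< q n j)
    × Increasing k q
    × Divisibility k q
    × (Σ (ℕ → ℝ) λ b →
    (∀ n j → 1 ℕ.≤ n → 1 ℕ.≤ j → j ℕ.≤ k →
    IsLog (fromℤ (+ q n j)) (b ((n ∸ 1) ℕ.* k ℕ.+ j)))
    × RatiosTendTo∞ b)
    × (∀ (i : Fin k) → IsSeries (λ n → 1ℤ ÷ q (suc n) (suc (toℕ i))) (ζ i))
    × LinearlyIndependentℚ (1ℝ ∷ ζ)
    × IsPsi ζ ψ
    × (∀ j → 1 ℕ.≤ j → j ℕ.≤ suc k →
    IsLiminf (ψ j) (liminfψ j) × IsLimsup (ψ j) (limsupψ j))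
    × liminfψ 1 ≈ fromℤ -1ℤ
    × (∀ j → 1 ℕ.≤ j → j ℕ.≤ k → liminfψ (suc j) ≈ limsupψ j)
    × limsupψ 1 ≈ (1ℤ ℤ.- + k) ÷ (2 ℕ.* k)
    × liminfψ 2 ≈ (1ℤ ℤ.- + k) ÷ (2 ℕ.* k)
    × (∀ j → 2 ℕ.≤ j → j ℕ.≤ k →
    limsupψ j ≈ 1ℤ ÷ k × liminfψ (suc j) ≈ 1ℤ ÷ k)
    × limsupψ (suc k) ≈ 1ℤ ÷ k
theorem3p2 _ 1 (ℕ.s≤s ())
theorem3p2 lem k@(suc (suc k-2)) _ =
    q , ζ , ψ , Minima.liminf , Minima.limsup
  , (λ n j _ _ _ → ℕₚ.m^n>0 2 (index n j !))
  , increasing (ℕ.s≤s ℕ.z≤n)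
  , divisibility
  , (b , (λ n j _ _ _ → b-isLog (index n j)) , b-ratios)
  , ζ-series
  , Minima.independent-over-ℚ
  , ψ-isPsi
  , (λ j 1≤j j≤ → ψ-liminf j 1≤j j≤ , ψ-limsup j 1≤j j≤)
  , ≈-refl (fromℤ -1ℤ)
  , (λ j _ _ → ≈-refl (Minima.limsup j))
  , τ≡ (suc k-2)
  , τ≡ (suc k-2)
  , (λ { 1 (ℕ.s≤s ()) _ ; (suc (suc _)) _ _ → ≈-refl Minima.κ , ≈-refl Minima.κ })
  , ≈-refl Minima.κ
  where
  open SolutionCorrespondence lem (suc k-2) hiding (k)
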